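{- Let $M$ be a matroid on a finite linearly ordered set $E$. Then $$t(M;x,y)=\sum\ \Bigl(\prod_{1\leq k\leq \iota}\beta\bigl(M(F_k)/F_{k-1}\bigr)\Bigr)\Bigl(\prod_{1\leq k\leq \varepsilon}\beta^*\bigl(M(F'_{k-1})/F'_{k}\bigr)\Bigr)\,x^{\iota}y^{\varepsilon},$$ where the sum can be equally taken either over all connected filtrations $\emptyset=F'_\varepsilon\subset\dots\subset F'_0=F_c=F_0\subset\dots\subset F_\iota=E$ of $M$, or over all filtrations $\emptyset=F'_\varepsilon\subset\dots\subset F'_0=F_c=F_0\subset\dots\subset F_\iota=E$ of $E$ (the lengths $\iota,\varepsilon\ge 0$ vary with the filtration).
   Context: $\subset$ denotes strict inclusion. For $A\subseteq G\subseteq E$, $M(G)$ is the restriction of $M$ to $G$, and $M(G)/A$ is the minor obtained by restricting to $G$ and contracting $A$. $t(M;x,y)$ is the Tutte polynomial of $M$. The beta invariant $\beta(M)$ is the coefficient of $x$ in $t(M;x,y)$; in particular $\beta(M)=1$ if $M$ is an isthmus (a single coloop, $U_{1,1}$) and $\beta(M)=0$ if $M$ is a loop (a single loop element). One sets $\beta^*(M)=\beta(M^*)$, where $M^*$ is the dual; thus $\beta^*(M)=\beta(M)$ if $|E|>1$, $\beta^*(M)=0$ if $M$ is an isthmus, and $\beta^*(M)=1$ if $M$ is a loop. A filtration of $M$ (or of $E$) is a sequence $(F'_\varepsilon,\dots,F'_0,F_c,F_0,\dots,F_\iota)$ of subsets of $E$ (with $\iota,\varepsilon\ge 0$) such that: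 $\emptyset=F'_\varepsilon\subset\dots\subset F'_0=F_c=F_0\subset\dots\subset F_\iota=E$; the sequence $\min(F_k\setminus F_{k-1})$, $1\le k\le\iota$, is increasing with $k$; and the sequence $\min(F'_{k-1}\setminus F'_k)$, $1\le k\le\varepsilon$, is increasing with $k$. It is a connected filtration of $M$ if in addition: for $1\le k\le\iota$, the minor $M(F_k)/F_{k-1}$ is connected and is not a loop; and for $1\le k\le\varepsilon$, the minor $M(F'_{k-1})/F'_k$ is connected and is not an isthmus. (One-element matroids are connected.) -}

module Defs where

open import Data.Bool.Base using (if_then_else_; _∧_)
import Data.Bool.Properties as 𝔹
open import Data.Fin.Base using (Fin)
open import Data.Fin.Subset
open import Data.Fin.Subset.Properties
open import Data.Integer.Base as ℤ using (ℤ; 0ℤ; 1ℤ; -1ℤ)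
open import Data.List.Base
  using (List; []; _∷_; _++_; [_]; length; map; concat; filter; foldr;
         cartesianProduct; cartesianProductWith)
open import Data.List.Membership.Propositional using () renaming (_∈_ to _∈ˡ_)
open import Data.List.Membership.Propositional.Properties
  using (∈-++⁺ˡ; ∈-++⁺ʳ; ∈-++⁻; ∈-map⁺; ∈-map⁻; ∈-filter⁺; ∈-filter⁻;
         ∈-cartesianProductWith⁺; ∈-cartesianProduct⁺)
open import Data.List.Properties using (∷-injective)
open import Data.List.Relation.Unary.All using (All; []; _∷_; all?)
open import Data.List.Relation.Unary.AllPairs using ([]; _∷_)
open import Data.List.Relation.Unary.Any using (here; there)
open import Data.List.Relation.Unary.Linked using (Linked; linked?)
open import Data.List.Relation.Unary.Unique.Propositional using (Unique)
import Data.List.Relation.Unary.Unique.Propositional.Properties as Unique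
open import Data.Nat.Base hiding (_^_; _/_)
open import Data.Nat.Properties
open import Data.Product.Base using (_×_; _,_; proj₁; proj₂)
open import Data.Sum.Base using (_⊎_; inj₁; inj₂)
open import Data.Vec.Base as Vec using ([]; _∷_)
import Data.Vec.Properties as Vec
open import Function.Base using (_∘_)
open import Function.Bundles using (_⇔_; mk⇔)
open import Level using (0ℓ)
open import Relation.Binary.PropositionalEquality
  using (_≡_; refl; sym; trans; cong; cong₂; subst; subst₂)
open import Relation.Nullary using (Dec; yes; no; ¬_)
open import Relation.Nullary.Decidable
  using (map′; ¬?; _×-dec_; _⊎-dec_; _→-dec_; decidable-stable)
open import Relation.Unary using (Pred; Decidable)

private
  variable
    n : ℕ

------------------------------------------------------------------------
-- Polynomials in ℤ[x,y]

-- A polynomial is a finite formal sum of terms (c , i , j) = c xⁱ yʲ.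
-- Exponent pairs may repeat, so equality is equality of all coefficients.

Poly : Set
Poly = List (ℤ × ℕ × ℕ)

coeff : Poly → ℕ → ℕ → ℤ
coeff []                i j = 0ℤ
coeff ((c , a , b) ∷ p) i j =
  (if (a ≡ᵇ i) ∧ (b ≡ᵇ j) then c else 0ℤ) ℤ.+ coeff p i j

infix  4 _≈_
infixr 7 _⊛_
infixr 8 _^_

_≈_ : Poly → Poly → Set
p ≈ q = ∀ i j → coeff p i j ≡ coeff q i j

_⊛_ : Poly → Poly → Poly
_⊛_ = cartesianProductWith λ (c , a , b) (d , a′ , b′) → c ℤ.* d , a + a′ , b + b′

_^_ : Poly → ℕ → Poly
p ^ zero  = [ 1ℤ , 0 , 0 ]
p ^ suc k = p ⊛ p ^ k

x-1 y-1 : Poly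
x-1 = (1ℤ , 1 , 0) ∷ (-1ℤ , 0 , 0) ∷ []
y-1 = (1ℤ , 0 , 1) ∷ (-1ℤ , 0 , 0) ∷ []

∑ : {A : Set} → List A → (A → Poly) → Poly
∑ xs f = concat (map f xs)

∏ : {A : Set} → List A → (A → ℤ) → ℤ
∏ xs f = foldr ℤ._*_ 1ℤ (map f xs)

------------------------------------------------------------------------
-- Subsets

subsets : Subset n → List (Subset n)
subsets []            = [ [] ]
subsets (outside ∷ S) = map (outside ∷_) (subsets S)
subsets (inside  ∷ S) = map (outside ∷_) (subsets S) ++ map (inside ∷_) (subsets S)

-- The position of the least element in the order of Fin n. (The value n
-- at ⊥ is never used below: min is only applied to B ─ A with A ⊂ B.)

min : Subset n → ℕ
min []            = 0
min (inside  ∷ S) = 0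
min (outside ∷ S) = suc (min S)

∪-lub : {S T U : Subset n} → S ⊆ U → T ⊆ U → S ∪ T ⊆ U
∪-lub {S = S} {T} f g x∈ with x∈p∪q⁻ S T x∈
... | inj₁ h = f h
... | inj₂ h = g h

∪-mono : {S T S′ T′ : Subset n} → S ⊆ S′ → T ⊆ T′ → S ∪ T ⊆ S′ ∪ T′
∪-mono {S′ = S′} {T′} f g = ∪-lub (λ h → p⊆p∪q T′ (f h)) (λ h → q⊆p∪q S′ T′ (g h))

∣∪∣+∣∩∣ : (S T : Subset n) → ∣ S ∪ T ∣ + ∣ S ∩ T ∣ ≡ ∣ S ∣ + ∣ T ∣
∣∪∣+∣∩∣ []            []            = refl
∣∪∣+∣∩∣ (inside  ∷ S) (inside  ∷ T) =
  cong suc (trans (+-suc _ _) (trans (cong suc (∣∪∣+∣∩∣ S T)) (sym (+-suc _ _))))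
∣∪∣+∣∩∣ (inside  ∷ S) (outside ∷ T) = cong suc (∣∪∣+∣∩∣ S T)
∣∪∣+∣∩∣ (outside ∷ S) (inside  ∷ T) = trans (cong suc (∣∪∣+∣∩∣ S T)) (sym (+-suc _ _))
∣∪∣+∣∩∣ (outside ∷ S) (outside ∷ T) = ∣∪∣+∣∩∣ S T

─-∪ : (E S T : Subset n) → E ─ (S ∪ T) ≡ (E ─ S) ∩ (E ─ T)
─-∪ []      []            []            = refl
─-∪ (e ∷ E) (inside  ∷ S) (inside  ∷ T) = cong (outside ∷_) (─-∪ E S T)
─-∪ (e ∷ E) (inside  ∷ S) (outside ∷ T) = cong (outside ∷_) (─-∪ E S T)
─-∪ (e ∷ E) (outside ∷ S) (inside  ∷ T) = cong₂ _∷_ (sym (𝔹.∧-zeroʳ e)) (─-∪ E S T)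
─-∪ (e ∷ E) (outside ∷ S) (outside ∷ T) = cong₂ _∷_ (sym (𝔹.∧-idem e)) (─-∪ E S T)

─-∩ : (E S T : Subset n) → E ─ (S ∩ T) ≡ (E ─ S) ∪ (E ─ T)
─-∩ []      []            []            = refl
─-∩ (e ∷ E) (inside  ∷ S) (inside  ∷ T) = cong (outside ∷_) (─-∩ E S T)
─-∩ (e ∷ E) (inside  ∷ S) (outside ∷ T) = cong (e ∷_) (─-∩ E S T)
─-∩ (e ∷ E) (outside ∷ S) (inside  ∷ T) = cong₂ _∷_ (sym (𝔹.∨-identityʳ e)) (─-∩ E S T)
─-∩ (e ∷ E) (outside ∷ S) (outside ∷ T) = cong₂ _∷_ (sym (𝔹.∨-idem e)) (─-∩ E S T)

x∈p─q⁻ : ∀ (S T : Subset n) {x} → x ∈ S ─ T → x ∈ S × ¬ x ∈ T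
x∈p─q⁻ (inside ∷ S) (outside ∷ T) Vec.here = Vec.here , λ ()
x∈p─q⁻ (inside  ∷ S) (inside  ∷ T) {Fin.zero} ()
x∈p─q⁻ (outside ∷ S) (outside ∷ T) {Fin.zero} ()
x∈p─q⁻ (outside ∷ S) (inside  ∷ T) {Fin.zero} ()
x∈p─q⁻ (s ∷ S) (t ∷ T) (Vec.there h) with x∈p─q⁻ S T h
... | a , b = Vec.there a , λ { (Vec.there c) → b c }

─-split : {E S T : Subset n} → T ⊆ E → E ─ S ⊆ (E ─ T) ∪ (T ─ S)
─-split {E = E} {S} {T} _ {x} h with x ∈? T | x∈p─q⁻ E S h
... | yes x∈T | _ , x∉S = x∈p∪q⁺ (inj₂ (x∈p∧x∉q⇒x∈p─q x∈T x∉S))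
... | no  x∉T | x∈E , _ = x∈p∪q⁺ (inj₁ (x∈p∧x∉q⇒x∈p─q x∈E x∉T))

card-─ : {S T : Subset n} → S ⊆ T → ∣ T ∣ ≡ ∣ S ∣ + ∣ T ─ S ∣
card-─ {S = []}          {[]}          _   = refl
card-─ {S = outside ∷ S} {outside ∷ T} sub = card-─ (drop-∷-⊆ sub)
card-─ {S = outside ∷ S} {inside  ∷ T} sub =
  trans (cong suc (card-─ (drop-∷-⊆ sub))) (sym (+-suc _ _))
card-─ {S = inside  ∷ S} {inside  ∷ T} sub = cong suc (card-─ (drop-∷-⊆ sub))
card-─ {S = inside  ∷ S} {outside ∷ T} sub with sub Vec.here
... | ()

∀Subset? : {P : Pred (Subset n) 0ℓ} → Decidable P → Dec (∀ S → P S)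
∀Subset? P? with anySubset? (¬? ∘ P?)
... | yes (S , ¬p) = no λ f → ¬p (f S)
... | no  ¬∃       = yes λ S → decidable-stable (P? S) λ ¬p → ¬∃ (S , ¬p)

_≟ˢ_ : (S T : Subset n) → Dec (S ≡ T)
_≟ˢ_ = Vec.≡-dec 𝔹._≟_

subsets-unique : (S : Subset n) → Unique (subsets S)
subsets-unique []            = [] ∷ []
subsets-unique (outside ∷ S) = Unique.map⁺ Vec.∷-injectiveʳ (subsets-unique S)
subsets-unique (inside  ∷ S) = Unique.++⁺
  (Unique.map⁺ Vec.∷-injectiveʳ (subsets-unique S))
  (Unique.map⁺ Vec.∷-injectiveʳ (subsets-unique S))
  λ (h , k) → disjoint h k
  where
  disjoint : ∀ {T} → T ∈ˡ map (outside ∷_) (subsets S) → ¬ T ∈ˡ map (inside ∷_) (subsets S)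
  disjoint h k with ∈-map⁻ (outside ∷_) h | ∈-map⁻ (inside ∷_) k
  ... | _ , _ , refl | _ , _ , ()

∈-subsets⁺ : {S T : Subset n} → T ⊆ S → T ∈ˡ subsets S
∈-subsets⁺ {S = []}          {[]}          _   = here refl
∈-subsets⁺ {S = outside ∷ S} {outside ∷ T} sub = ∈-map⁺ _ (∈-subsets⁺ (drop-∷-⊆ sub))
∈-subsets⁺ {S = outside ∷ S} {inside  ∷ T} sub with sub Vec.here
... | ()
∈-subsets⁺ {S = inside  ∷ S} {outside ∷ T} sub =
  ∈-++⁺ˡ (∈-map⁺ _ (∈-subsets⁺ (drop-∷-⊆ sub)))
∈-subsets⁺ {S = inside  ∷ S} {inside  ∷ T} sub =
  ∈-++⁺ʳ (map (outside ∷_) (subsets S)) (∈-map⁺ _ (∈-subsets⁺ (drop-∷-⊆ sub)))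

∈-subsets⁻ : {S T : Subset n} → T ∈ˡ subsets S → T ⊆ S
∈-subsets⁻ {S = []}          {[]} _ = λ ()
∈-subsets⁻ {S = outside ∷ S} h with ∈-map⁻ (outside ∷_) h
... | _ , k , refl = s⊆s (∈-subsets⁻ k)
∈-subsets⁻ {S = inside ∷ S} h
  with ∈-++⁻ (map (outside ∷_) (subsets S)) h
... | inj₁ k with ∈-map⁻ (outside ∷_) k
...   | _ , l , refl = out⊆ (∈-subsets⁻ l)
∈-subsets⁻ {S = inside ∷ S} h | inj₂ k with ∈-map⁻ (inside ∷_) k
...   | _ , l , refl = s⊆s (∈-subsets⁻ l)

------------------------------------------------------------------------
-- Matroids

-- A matroid on a set E ⊆ Fin n, given by its rank function. E carries
-- the linear order of Fin n, and minors stay inside the same Fin n.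
-- The values of r outside the subsets of E are irrelevant.

record Matroid (n : ℕ) : Set where
  field
    E         : Subset n
    r         : Subset n → ℕ
    r≤card    : ∀ {X} → X ⊆ E → r X ≤ ∣ X ∣
    r-mono    : ∀ {X Y} → X ⊆ Y → Y ⊆ E → r X ≤ r Y
    r-submod  : ∀ {X Y} → X ⊆ E → Y ⊆ E → r (X ∪ Y) + r (X ∩ Y) ≤ r X + r Y

open Matroid

∸-+ : ∀ {a b c} → c ≤ a → c ≤ b → (a ∸ c) + (b ∸ c) ≡ (a + b) ∸ (c + c)
∸-+ {a} {b} {c} p q = begin-equality
  (a ∸ c) + (b ∸ c)  ≡⟨ +-comm (a ∸ c) (b ∸ c) ⟩
  (b ∸ c) + (a ∸ c)  ≡⟨ sym (+-∸-assoc (b ∸ c) p) ⟩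
  (b ∸ c) + a ∸ c    ≡⟨ cong (_∸ c) (+-comm (b ∸ c) a) ⟩
  a + (b ∸ c) ∸ c    ≡⟨ cong (_∸ c) (sym (+-∸-assoc a q)) ⟩
  a + b ∸ c ∸ c      ≡⟨ ∸-+-assoc (a + b) c c ⟩
  a + b ∸ (c + c)    ∎
  where open ≤-Reasoning

∸-submod : ∀ {a b d e c} → c ≤ a → c ≤ b → c ≤ d → c ≤ e → a + b ≤ d + e →
           (a ∸ c) + (b ∸ c) ≤ (d ∸ c) + (e ∸ c)
∸-submod {c = c} p q s t h =
  subst₂ _≤_ (sym (∸-+ p q)) (sym (∸-+ s t)) (∸-monoˡ-≤ (c + c) h)

+-interchange : ∀ a b c d → (a + b) + (c + d) ≡ (a + c) + (b + d)
+-interchange a b c d = begin-equality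
  (a + b) + (c + d)  ≡⟨ +-assoc a b (c + d) ⟩
  a + (b + (c + d))  ≡⟨ cong (a +_) (sym (+-assoc b c d)) ⟩
  a + ((b + c) + d)  ≡⟨ cong (λ z → a + (z + d)) (+-comm b c) ⟩
  a + ((c + b) + d)  ≡⟨ cong (a +_) (+-assoc c b d) ⟩
  a + (c + (b + d))  ≡⟨ sym (+-assoc a c (b + d)) ⟩
  (a + c) + (b + d)  ∎
  where open ≤-Reasoning

subadditive : (M : Matroid n) → ∀ {X Y} → X ⊆ E M → Y ⊆ E M → r M (X ∪ Y) ≤ r M X + r M Y
subadditive M {X} {Y} p q = ≤-trans (m≤m+n _ (r M (X ∩ Y))) (r-submod M p q)

infixl 6 _↾_ _/_

-- Restriction to G ∩ E and contraction of A ∩ E, so that M ↾ G / A is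
-- defined for all G and A; it is the usual minor when A ⊆ G ⊆ E.

_↾_ : Matroid n → Subset n → Matroid n
M ↾ G = record
  { E        = E M ∩ G
  ; r        = r M
  ; r≤card   = λ p → r≤card M (⊆E p)
  ; r-mono   = λ p q → r-mono M p (⊆E q)
  ; r-submod = λ p q → r-submod M (⊆E p) (⊆E q)
  }
  where
  ⊆E : ∀ {X} → X ⊆ E M ∩ G → X ⊆ E M
  ⊆E p = p∩q⊆p (E M) G ∘ p

_/_ : Matroid n → Subset n → Matroid n
_/_ {n} M A = record
  { E        = E M ─ A
  ; r        = λ X → r M (X ∪ A′) ∸ r M A′
  ; r≤card   = λ {X} p → ≤-trans
      (m≤n+o⇒m∸n≤o _ (r M A′)
        (subst (r M (X ∪ A′) ≤_) (+-comm (r M X) (r M A′)) (subadditive M (⊆E p) A′⊆E)))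
      (r≤card M (⊆E p))
  ; r-mono   = λ p q → ∸-monoˡ-≤ (r M A′) (r-mono M (∪-mono p (λ h → h)) (∪A⊆E q))
  ; r-submod = λ {X} {Y} p q → ∸-submod
      (A≤ (∪-lub p q)) (A≤ (p ∘ p∩q⊆p X Y)) (A≤ p) (A≤ q)
      (subst₂ (λ U V → r M U + r M V ≤ r M (X ∪ A′) + r M (Y ∪ A′))
        (∪∪ X Y) (sym (∪-distribʳ-∩ A′ X Y))
        (r-submod M (∪A⊆E p) (∪A⊆E q)))
  }
  where
  A′ : Subset n
  A′ = A ∩ E M

  A′⊆E : A′ ⊆ E M
  A′⊆E = p∩q⊆q A (E M)

  ⊆E : ∀ {X} → X ⊆ E M ─ A → X ⊆ E M
  ⊆E p = p─q⊆p (E M) A ∘ p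

  ∪A⊆E : ∀ {X} → X ⊆ E M ─ A → X ∪ A′ ⊆ E M
  ∪A⊆E p = ∪-lub (⊆E p) A′⊆E

  A≤ : ∀ {X} → X ⊆ E M ─ A → r M A′ ≤ r M (X ∪ A′)
  A≤ {X} p = r-mono M (q⊆p∪q X A′) (∪A⊆E p)

  ∪∪ : ∀ X Y → (X ∪ A′) ∪ (Y ∪ A′) ≡ (X ∪ Y) ∪ A′
  ∪∪ X Y = ⊆-antisym
    (∪-lub (∪-mono (p⊆p∪q Y) (λ h → h)) (∪-mono (q⊆p∪q X Y) (λ h → h)))
    (∪-lub (∪-mono (p⊆p∪q A′) (p⊆p∪q A′)) (q⊆p∪q (X ∪ A′) (Y ∪ A′) ∘ q⊆p∪q Y A′))

dual : Matroid n → Matroid n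
dual {n} M = record
  { E        = E M
  ; r        = λ X → (∣ X ∣ + r M (E M ─ X)) ∸ r M (E M)
  ; r≤card   = λ {X} _ → m≤n+o⇒m∸n≤o _ (r M (E M))
      (subst (_≤ r M (E M) + ∣ X ∣) (+-comm (r M (E M ─ X)) ∣ X ∣)
        (+-monoˡ-≤ ∣ X ∣ (r-mono M (co X) (λ h → h))))
  ; r-mono   = λ p q → ∸-monoˡ-≤ (r M (E M)) (num-mono p q)
  ; r-submod = λ {X} {Y} p q →
      ∸-submod (num≥ (∪-lub p q)) (num≥ (p ∘ p∩q⊆p X Y)) (num≥ p) (num≥ q) (num-submod X Y)
  }
  where
  open ≤-Reasoning

  co : ∀ X → E M ─ X ⊆ E M
  co X = p─q⊆p (E M) X

  num : Subset n → ℕ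
  num X = ∣ X ∣ + r M (E M ─ X)

  num-mono : ∀ {X Y} → X ⊆ Y → Y ⊆ E M → num X ≤ num Y
  num-mono {X} {Y} p q = begin
    ∣ X ∣ + r M (E M ─ X)
      ≤⟨ +-monoʳ-≤ ∣ X ∣ (r-mono M (─-split q) (∪-lub (co Y) (q ∘ p─q⊆p Y X))) ⟩
    ∣ X ∣ + r M ((E M ─ Y) ∪ (Y ─ X))
      ≤⟨ +-monoʳ-≤ ∣ X ∣ (subadditive M (co Y) (q ∘ p─q⊆p Y X)) ⟩
    ∣ X ∣ + (r M (E M ─ Y) + r M (Y ─ X))
      ≤⟨ +-monoʳ-≤ ∣ X ∣ (+-monoʳ-≤ (r M (E M ─ Y)) (r≤card M (q ∘ p─q⊆p Y X))) ⟩
    ∣ X ∣ + (r M (E M ─ Y) + ∣ Y ─ X ∣)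
      ≡⟨ cong (∣ X ∣ +_) (+-comm (r M (E M ─ Y)) ∣ Y ─ X ∣) ⟩
    ∣ X ∣ + (∣ Y ─ X ∣ + r M (E M ─ Y))
      ≡⟨ sym (+-assoc ∣ X ∣ ∣ Y ─ X ∣ _) ⟩
    ∣ X ∣ + ∣ Y ─ X ∣ + r M (E M ─ Y)
      ≡⟨ cong (_+ r M (E M ─ Y)) (sym (card-─ p)) ⟩
    ∣ Y ∣ + r M (E M ─ Y)
      ∎

  num≥ : ∀ {X} → X ⊆ E M → r M (E M) ≤ num X
  num≥ {X} p = begin
    r M (E M)                 ≡⟨ cong (r M) (sym (p─⊥≡p (E M))) ⟩
    r M (E M ─ ⊥)             ≤⟨ m≤n+m _ ∣ ⊥ {n} ∣ ⟩
    ∣ ⊥ {n} ∣ + r M (E M ─ ⊥) ≤⟨ num-mono ⊥⊆ p ⟩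
    num X                     ∎

  num-submod : ∀ X Y → num (X ∪ Y) + num (X ∩ Y) ≤ num X + num Y
  num-submod X Y = begin
    num (X ∪ Y) + num (X ∩ Y)
      ≡⟨ +-interchange (∣ X ∪ Y ∣) _ (∣ X ∩ Y ∣) _ ⟩
    (∣ X ∪ Y ∣ + ∣ X ∩ Y ∣) + (r M (E M ─ (X ∪ Y)) + r M (E M ─ (X ∩ Y)))
      ≡⟨ cong₂ _+_ (∣∪∣+∣∩∣ X Y) (trans (cong₂ (λ U V → r M U + r M V) (─-∪ (E M) X Y) (─-∩ (E M) X Y)) (+-comm (r M ((E M ─ X) ∩ (E M ─ Y))) _)) ⟩
    (∣ X ∣ + ∣ Y ∣) + (r M ((E M ─ X) ∪ (E M ─ Y)) + r M ((E M ─ X) ∩ (E M ─ Y)))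
      ≤⟨ +-monoʳ-≤ (∣ X ∣ + ∣ Y ∣) (r-submod M (co X) (co Y)) ⟩
    (∣ X ∣ + ∣ Y ∣) + (r M (E M ─ X) + r M (E M ─ Y))
      ≡⟨ +-interchange (∣ X ∣) (∣ Y ∣) _ _ ⟩
    num X + num Y
      ∎

IsLoop IsIsthmus : Matroid n → Set
IsLoop    M = ∣ E M ∣ ≡ 1 × r M (E M) ≡ 0
IsIsthmus M = ∣ E M ∣ ≡ 1 × r M (E M) ≡ 1

-- M is the direct sum of its restrictions to A and to E ─ A.

IsSeparator : Matroid n → Subset n → Set
IsSeparator M A =
  A ⊆ E M × (∀ X → X ⊆ E M → r M X ≡ r M (X ∩ A) + r M (X ∩ (E M ─ A)))

Connected : Matroid n → Set
Connected M = ∀ A → IsSeparator M A → A ≡ ⊥ ⊎ A ≡ E M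

isLoop? : (M : Matroid n) → Dec (IsLoop M)
isLoop? M = (_ ≟ _) ×-dec (_ ≟ _)

isIsthmus? : (M : Matroid n) → Dec (IsIsthmus M)
isIsthmus? M = (_ ≟ _) ×-dec (_ ≟ _)

connected? : (M : Matroid n) → Dec (Connected M)
connected? M = ∀Subset? λ A →
  ((A ⊆? E M) ×-dec ∀Subset? λ X → (X ⊆? E M) →-dec (_ ≟ _))
  →-dec ((A ≟ˢ ⊥) ⊎-dec (A ≟ˢ E M))

------------------------------------------------------------------------
-- Tutte polynomial and beta invariants

-- The corank-nullity expansion Σ_{A ⊆ E} (x-1)^(r(E)-r(A)) (y-1)^(|A|-r(A)).

tutte : Matroid n → Poly
tutte M = ∑ (subsets (E M)) λ A →
  (x-1 ^ (r M (E M) ∸ r M A)) ⊛ (y-1 ^ (∣ A ∣ ∸ r M A))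

β β* : Matroid n → ℤ
β  M = coeff (tutte M) 1 0
β* M = β (dual M)

------------------------------------------------------------------------
-- Filtrations

-- ((F′₁ , … , F′_ε) , F_c , (F₁ , … , F_ι)); the repeated members
-- F′₀ = F_c = F₀ are stored once, and the F′ are listed going down.

Seq : ℕ → Set
Seq n = List (Subset n) × Subset n × List (Subset n)

-- steps A₀ (A₁ , … , Aₖ) = ((A₀ , A₁) , … , (Aₖ₋₁ , Aₖ)).

steps : Subset n → List (Subset n) → List (Subset n × Subset n)
steps A []       = []
steps A (B ∷ Bs) = (A , B) ∷ steps B Bs

last : Subset n → List (Subset n) → Subset n
last A []       = A
last A (B ∷ Bs) = last B Bs

record IsFiltration (E : Subset n) (F : Seq n) : Set where
  field
    up-⊂     : let (F′ , Fc , F) = F in All (λ (A , B) → A ⊂ B) (steps Fc F)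
    up-last  : let (F′ , Fc , F) = F in last Fc F ≡ E
    up-min   : let (F′ , Fc , F) = F in
               Linked _<_ (map (λ (A , B) → min (B ─ A)) (steps Fc F))
    down-⊂    : let (F′ , Fc , F) = F in All (λ (B , A) → A ⊂ B) (steps Fc F′)
    down-last : let (F′ , Fc , F) = F in last Fc F′ ≡ ⊥
    down-min  : let (F′ , Fc , F) = F in
                Linked _<_ (map (λ (B , A) → min (B ─ A)) (steps Fc F′))

record IsConnectedFiltration (M : Matroid n) (F : Seq n) : Set where
  field
    isFiltration : IsFiltration (E M) F
    up-conn      : let (F′ , Fc , F) = F in
                   All (λ (A , B) → Connected (M ↾ B / A) × ¬ IsLoop (M ↾ B / A)) (steps Fc F)
    down-conn    : let (F′ , Fc , F) = F in
                   All (λ (B , A) → Connected (M ↾ B / A) × ¬ IsIsthmus (M ↾ B / A)) (steps Fc F′)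

isFiltration? : (E : Subset n) → Decidable (IsFiltration E)
isFiltration? E (F′ , Fc , F) = map′
  (λ (a , b , c , d , e , f) → record
    { up-⊂ = a ; up-last = b ; up-min = c ; down-⊂ = d ; down-last = e ; down-min = f })
  (λ p → let open IsFiltration p in up-⊂ , up-last , up-min , down-⊂ , down-last , down-min)
  (all? (λ (A , B) → A ⊂? B) (steps Fc F) ×-dec (last Fc F ≟ˢ E) ×-dec linked? _<?_ _
   ×-dec all? (λ (B , A) → A ⊂? B) (steps Fc F′) ×-dec (last Fc F′ ≟ˢ ⊥) ×-dec linked? _<?_ _)

isConnectedFiltration? : (M : Matroid n) → Decidable (IsConnectedFiltration M)
isConnectedFiltration? M F@(F′ , Fc , G) = map′
  (λ (a , b , c) → record { isFiltration = a ; up-conn = b ; down-conn = c })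
  (λ p → let open IsConnectedFiltration p in isFiltration , up-conn , down-conn)
  (isFiltration? (E M) F
   ×-dec all? (λ (A , B) → connected? (M ↾ B / A) ×-dec ¬? (isLoop? (M ↾ B / A))) (steps Fc G)
   ×-dec all? (λ (B , A) → connected? (M ↾ B / A) ×-dec ¬? (isIsthmus? (M ↾ B / A))) (steps Fc F′))

listsUpTo : {A : Set} → ℕ → List A → List (List A)
listsUpTo zero    xs = [ [] ]
listsUpTo (suc k) xs = [] ∷ cartesianProductWith _∷_ xs (listsUpTo k xs)

-- A strict chain of subsets of Fin n has at most n steps, so all
-- filtrations occur here.

candidates : ∀ n → List (Seq n)
candidates n = cartesianProduct chains (cartesianProduct (subsets ⊤) chains)
  where chains = listsUpTo n (subsets ⊤)

filtrations : Subset n → List (Seq n)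
filtrations E = filter (isFiltration? E) (candidates _)

connectedFiltrations : Matroid n → List (Seq n)
connectedFiltrations M = filter (isConnectedFiltration? M) (candidates _)

listsUpTo-unique : {A : Set} (k : ℕ) {xs : List A} → Unique xs → Unique (listsUpTo k xs)
listsUpTo-unique zero    u = [] ∷ []
listsUpTo-unique (suc k) {xs} u =
  fresh (listsUpTo k xs) ∷ Unique.cartesianProductWith⁺ _∷_ ∷-injective u (listsUpTo-unique k u)
  where
  open import Data.List.Relation.Unary.All.Properties using (cartesianProductWith⁺)
  open import Relation.Binary.PropositionalEquality using (setoid)
  fresh : ∀ ys → All (λ z → ¬ [] ≡ z) (cartesianProductWith _∷_ xs ys)
  fresh ys = cartesianProductWith⁺ (setoid _) (setoid _) _∷_ xs ys (λ _ _ ())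

∈-listsUpTo : {A : Set} {k : ℕ} {xs ys : List A} → length ys ≤ k →
              All (_∈ˡ xs) ys → ys ∈ˡ listsUpTo k xs
∈-listsUpTo {k = zero}  {ys = []}     _       _        = here refl
∈-listsUpTo {k = suc k} {ys = []}     _       _        = here refl
∈-listsUpTo {k = suc k} {ys = y ∷ ys} (s≤s l) (h ∷ hs) =
  there (∈-cartesianProductWith⁺ _∷_ h (∈-listsUpTo l hs))

up-length : (A : Subset n) (Bs : List (Subset n)) →
            All (λ (A , B) → A ⊂ B) (steps A Bs) → ∣ A ∣ + length Bs ≤ n
up-length A []       _        = subst (_≤ _) (sym (+-identityʳ _)) (∣p∣≤n A)
up-length A (B ∷ Bs) (h ∷ hs) = ≤-trans
  (subst (_≤ ∣ B ∣ + length Bs) (sym (+-suc ∣ A ∣ _)) (+-monoˡ-≤ (length Bs) (p⊂q⇒∣p∣<∣q∣ h)))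
  (up-length B Bs hs)

down-length : (B : Subset n) (As : List (Subset n)) →
              All (λ (B , A) → A ⊂ B) (steps B As) → length As ≤ ∣ B ∣
down-length B []       _        = z≤n
down-length B (A ∷ As) (h ∷ hs) = ≤-trans (s≤s (down-length A As hs)) (p⊂q⇒∣p∣<∣q∣ h)

∈-subsets⊤ : (S : Subset n) → S ∈ˡ subsets ⊤
∈-subsets⊤ S = ∈-subsets⁺ (λ _ → ∈⊤)

all∈ : (Ss : List (Subset n)) → All (_∈ˡ subsets ⊤) Ss
all∈ []       = []
all∈ (S ∷ Ss) = ∈-subsets⊤ S ∷ all∈ Ss

candidates-unique : ∀ n → Unique (candidates n)
candidates-unique n = Unique.cartesianProduct⁺ chains
  (Unique.cartesianProduct⁺ (subsets-unique (⊤ {n})) chains)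
  where chains = listsUpTo-unique n (subsets-unique (⊤ {n}))

∈-candidates : {E : Subset n} {F : Seq n} → IsFiltration E F → F ∈ˡ candidates n
∈-candidates {F = F′ , Fc , F} p = ∈-cartesianProduct⁺
  (∈-listsUpTo (≤-trans (down-length Fc F′ down-⊂) (∣p∣≤n Fc)) (all∈ F′))
  (∈-cartesianProduct⁺ (∈-subsets⊤ Fc)
    (∈-listsUpTo (m+n≤o⇒n≤o ∣ Fc ∣ (up-length Fc F up-⊂)) (all∈ F)))
  where open IsFiltration p

filtrations-unique : (E : Subset n) → Unique (filtrations E)
filtrations-unique E = Unique.filter⁺ (isFiltration? E) (candidates-unique _)

connectedFiltrations-unique : (M : Matroid n) → Unique (connectedFiltrations M)
connectedFiltrations-unique M =
  Unique.filter⁺ (isConnectedFiltration? M) (candidates-unique _)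

∈-filtrations : {E : Subset n} {F : Seq n} → F ∈ˡ filtrations E ⇔ IsFiltration E F
∈-filtrations {E = E} = mk⇔
  (λ h → proj₂ (∈-filter⁻ (isFiltration? E) {xs = candidates _} h))
  (λ p → ∈-filter⁺ (isFiltration? E) (∈-candidates p) p)

∈-connectedFiltrations : {M : Matroid n} {F : Seq n} →
                         F ∈ˡ connectedFiltrations M ⇔ IsConnectedFiltration M F
∈-connectedFiltrations {M = M} = mk⇔
  (λ h → proj₂ (∈-filter⁻ (isConnectedFiltration? M) {xs = candidates _} h))
  (λ p → ∈-filter⁺ (isConnectedFiltration? M)
           (∈-candidates (IsConnectedFiltration.isFiltration p)) p)

term : Matroid n → Seq n → Poly
term M (F′ , Fc , F) =
  [ ∏ (steps Fc F)  (λ (A , B) → β  (M ↾ B / A)) ℤ.*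
    ∏ (steps Fc F′) (λ (B , A) → β* (M ↾ B / A))
  , length F , length F′ ]

{-# OPTIONS --safe #-}

-- Write t(M ; x , y) as the sum over F ⊆ E of t(M(F) ; 0 , y) t(M / F ; x , 0)
-- (the convolution formula). The minima along a filtration increase exactly if
-- each step takes the least element that is still available, so the sum over
-- filtrations through F_c = F factors into two sums over chains, and these obey
-- the recursions
--   t(M / A ; x , 0) = x Σ β(M(B) / A)  t(M / B ; x , 0)   over B ∋ min (E ─ A),
--   t(M(B) ; 0 , y)  = y Σ β*(M(B) / A) t(M(A) ; 0 , y)    over A ∌ min B.
-- Both hold with min replaced by any fixed element e: insert Crapo's formula
-- β(M(B) / A) = ± Σ (-1)^|C| r(C), exchange the sums, and apply Möbius inversion;
-- what remains is that r(C) - r(C ─ e) is 0 or 1, which makes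
-- (1 - z) (r(C) - r(C ─ e)) zʰ a difference of powers of z for h = r(E) - r(C).
-- A filtration that is not connected contributes 0, because β and β* vanish
-- on the minors that are not allowed.
module Submission where

-- Up to sign, every quantity is an alternating sum over an interval of the Boolean lattice of
-- subsets, with one fixed function for all minors: (1-x)^(r(E)-r(C)) for t(M / A ; x , 0),
-- (1-y)^(|C|-r(C)) for t(M(B) ; 0 , y), r(C) for β and r(C)-|C| for β*. Minors of minors therefore
-- never occur, and Möbius inversion is needed only on the Boolean lattice, where it is a sign. The
-- convolution formula is an instance of the same inversion. The powers are of z = 1-x or z = 1-y,
-- not of x-1 or y-1, because the factor x or y carried by each step is then exactly 1-z; the
-- difference of consecutive powers is a product with it and nothing is divided. The function
-- r(C)-|C| comes from the sum for the dual by reflecting subsets in the ground set. It is minus the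
-- nullity, which moves by 0 or 1 when an element is added just as the rank does; so the recursion
-- going down is the one going up, read through complements.

-- Alternating sums and Möbius inversion on intervals of subsets

module IntervalSums where

  open import Algebra.Bundles using (CommutativeRing)
  open import Data.Fin.Base using (Fin; zero; suc)
  open import Data.Fin.Subset hiding (_-_)
  open import Data.Fin.Subset.Properties
  open import Data.Nat.Base using (ℕ; suc)
  open import Data.Product.Base using (_×_; _,_)
  open import Data.Vec.Base using ([]; _∷_; here; there; _[_]≔_)
  import Data.Vec.Properties as Vec
  open import Function.Base using (_∘_)
  open import Level using (0ℓ)
  open import Relation.Binary.PropositionalEquality as ≡ using (_≡_)
  open import Relation.Nullary using (¬_; contradiction)

  private
    variable
      n : ℕ

  infixl 7 _[+_] _[-_]

  _[+_] _[-_] : Subset n → Fin n → Subset n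
  A [+ e ] = A [ e ]≔ inside
  A [- e ] = A [ e ]≔ outside

  ∈-[+] : ∀ {A : Subset n} e → e ∈ A [+ e ]
  ∈-[+] {A = A} e = Vec.[]≔-updates A e

  ⊆-[+] : ∀ {A : Subset n} e → A ⊆ A [+ e ]
  ⊆-[+] {A = a ∷ A} zero    here      = here
  ⊆-[+] {A = a ∷ A} zero    (there h) = there h
  ⊆-[+] {A = a ∷ A} (suc e) here      = here
  ⊆-[+] {A = a ∷ A} (suc e) (there h) = there (⊆-[+] e h)

  [-]-⊆ : ∀ {A : Subset n} e → A [- e ] ⊆ A
  [-]-⊆ {A = a ∷ A} zero    (there h) = there h
  [-]-⊆ {A = a ∷ A} (suc e) here      = here
  [-]-⊆ {A = a ∷ A} (suc e) (there h) = there ([-]-⊆ e h)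

  ∁-[-] : ∀ (A : Subset n) e → ∁ (A [- e ]) ≡ ∁ A [+ e ]
  ∁-[-] A e = Vec.map-[]≔ _ A e

  ∁-involutive : (A : Subset n) → ∁ (∁ A) ≡ A
  ∁-involutive A = ⊆-antisym (x∉∁p⇒x∈p ∘ x∈∁p⇒x∉p) (x∉p⇒x∈∁p ∘ x∈p⇒x∉∁p)

  in⊈out : ∀ {A B : Subset n} → ¬ inside ∷ A ⊆ outside ∷ B
  in⊈out A⊆B with () ← A⊆B here

  -- The ring is a parameter because Crapo's sums live in the integers and the recursions in the
  -- polynomials; `Σ-homo` connects the two instances.
  module IntervalSum (R : CommutativeRing 0ℓ 0ℓ) where
    open CommutativeRing R
    open import Algebra.Properties.Ring ring
    open import Algebra.Properties.CommutativeSemigroup +-commutativeSemigroup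
      using () renaming (interchange to +-interchange)
    open import Relation.Binary.Reasoning.Setoid setoid

    open import Algebra.Solver.CommutativeMonoid *-commutativeMonoid
      using (solve; _⊜_) renaming (_⊕_ to _⊗_)

    -- The sum over A ⊆ C ⊆ B. It is 0 if A ⊈ B, so that Σ-fubini holds without hypotheses.

    Σ⟦_,_⟧ : Subset n → Subset n → (Subset n → Carrier) → Carrier
    Σ⟦ []          , []          ⟧ f = f []
    Σ⟦ outside ∷ A , outside ∷ B ⟧ f = Σ⟦ A , B ⟧ (f ∘ (outside ∷_))
    Σ⟦ outside ∷ A , inside  ∷ B ⟧ f = Σ⟦ A , B ⟧ (f ∘ (outside ∷_)) + Σ⟦ A , B ⟧ (f ∘ (inside ∷_))
    Σ⟦ inside  ∷ A , outside ∷ B ⟧ f = 0#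
    Σ⟦ inside  ∷ A , inside  ∷ B ⟧ f = Σ⟦ A , B ⟧ (f ∘ (inside ∷_))

    Σ-cong : ∀ (A B : Subset n) {f g} → (∀ C → A ⊆ C → C ⊆ B → f C ≈ g C) → Σ⟦ A , B ⟧ f ≈ Σ⟦ A , B ⟧ g
    Σ-cong []            []            h = h [] (λ ()) (λ ())
    Σ-cong (outside ∷ A) (outside ∷ B) h = Σ-cong A B λ C p q → h _ (out⊆ p) (out⊆ q)
    Σ-cong (outside ∷ A) (inside  ∷ B) h =
      +-cong (Σ-cong A B λ C p q → h _ (out⊆ p) (out⊆ q)) (Σ-cong A B λ C p q → h _ (out⊆ p) (s⊆s q))
    Σ-cong (inside  ∷ A) (outside ∷ B) h = refl
    Σ-cong (inside  ∷ A) (inside  ∷ B) h = Σ-cong A B λ C p q → h _ (s⊆s p) (s⊆s q)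

    Σ-cong′ : ∀ (A B : Subset n) {f g} → (∀ C → f C ≈ g C) → Σ⟦ A , B ⟧ f ≈ Σ⟦ A , B ⟧ g
    Σ-cong′ A B h = Σ-cong A B λ C _ _ → h C

    Σ-0 : (A B : Subset n) → Σ⟦ A , B ⟧ (λ _ → 0#) ≈ 0#
    Σ-0 []            []            = refl
    Σ-0 (outside ∷ A) (outside ∷ B) = Σ-0 A B
    Σ-0 (outside ∷ A) (inside  ∷ B) = trans (+-cong (Σ-0 A B) (Σ-0 A B)) (+-identityˡ 0#)
    Σ-0 (inside  ∷ A) (outside ∷ B) = refl
    Σ-0 (inside  ∷ A) (inside  ∷ B) = Σ-0 A B

    Σ-+ : ∀ (A B : Subset n) f g → Σ⟦ A , B ⟧ (λ C → f C + g C) ≈ Σ⟦ A , B ⟧ f + Σ⟦ A , B ⟧ g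
    Σ-+ []            []            f g = refl
    Σ-+ (outside ∷ A) (outside ∷ B) f g = Σ-+ A B _ _
    Σ-+ (outside ∷ A) (inside  ∷ B) f g =
      trans (+-cong (Σ-+ A B _ _) (Σ-+ A B _ _)) (+-interchange _ _ _ _)
    Σ-+ (inside  ∷ A) (outside ∷ B) f g = sym (+-identityˡ 0#)
    Σ-+ (inside  ∷ A) (inside  ∷ B) f g = Σ-+ A B _ _

    Σ-*ˡ : ∀ (A B : Subset n) k f → Σ⟦ A , B ⟧ (λ C → k * f C) ≈ k * Σ⟦ A , B ⟧ f
    Σ-*ˡ []            []            k f = refl
    Σ-*ˡ (outside ∷ A) (outside ∷ B) k f = Σ-*ˡ A B k _
    Σ-*ˡ (outside ∷ A) (inside  ∷ B) k f =
      trans (+-cong (Σ-*ˡ A B k _) (Σ-*ˡ A B k _)) (sym (distribˡ k _ _))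
    Σ-*ˡ (inside  ∷ A) (outside ∷ B) k f = sym (zeroʳ k)
    Σ-*ˡ (inside  ∷ A) (inside  ∷ B) k f = Σ-*ˡ A B k _

    Σ-*ʳ : ∀ (A B : Subset n) k f → Σ⟦ A , B ⟧ (λ C → f C * k) ≈ Σ⟦ A , B ⟧ f * k
    Σ-*ʳ A B k f = trans (Σ-cong′ A B λ C → *-comm (f C) k) (trans (Σ-*ˡ A B k f) (*-comm k _))

    Σ-neg : ∀ (A B : Subset n) f → Σ⟦ A , B ⟧ (λ C → - f C) ≈ - Σ⟦ A , B ⟧ f
    Σ-neg A B f = begin
      Σ⟦ A , B ⟧ (λ C → - f C)      ≈⟨ Σ-cong′ A B (λ C → -1*x≈-x (f C)) ⟨
      Σ⟦ A , B ⟧ (λ C → - 1# * f C) ≈⟨ Σ-*ˡ A B (- 1#) f ⟩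
      - 1# * Σ⟦ A , B ⟧ f           ≈⟨ -1*x≈-x _ ⟩
      - Σ⟦ A , B ⟧ f                ∎

    Σ-singleton : ∀ (A : Subset n) f → Σ⟦ A , A ⟧ f ≡ f A
    Σ-singleton []            f = ≡.refl
    Σ-singleton (outside ∷ A) f = Σ-singleton A _
    Σ-singleton (inside  ∷ A) f = Σ-singleton A _

    Σ-fubini : ∀ (A B : Subset n) (f : Subset n → Subset n → Carrier) →
               Σ⟦ A , B ⟧ (λ C → Σ⟦ C , B ⟧ (f C)) ≈ Σ⟦ A , B ⟧ (λ D → Σ⟦ A , D ⟧ (λ C → f C D))
    Σ-fubini []            []            f = refl
    Σ-fubini (outside ∷ A) (outside ∷ B) f = Σ-fubini A B _
    Σ-fubini (outside ∷ A) (inside  ∷ B) f = begin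
      Σ⟦ A , B ⟧ (λ C → foo C + foi C) + Σ⟦ A , B ⟧ fii
        ≈⟨ +-congʳ (Σ-+ A B foo foi) ⟩
      Σ⟦ A , B ⟧ foo + Σ⟦ A , B ⟧ foi + Σ⟦ A , B ⟧ fii
        ≈⟨ +-assoc _ _ _ ⟩
      Σ⟦ A , B ⟧ foo + (Σ⟦ A , B ⟧ foi + Σ⟦ A , B ⟧ fii)
        ≈⟨ +-cong (Σ-fubini A B _) (+-cong (Σ-fubini A B _) (Σ-fubini A B _)) ⟩
      _
        ≈⟨ +-congˡ (Σ-+ A B _ _) ⟨
      _ ∎
      where
      foo foi fii : Subset _ → Carrier
      foo C = Σ⟦ C , B ⟧ (λ D → f (outside ∷ C) (outside ∷ D))
      foi C = Σ⟦ C , B ⟧ (λ D → f (outside ∷ C) (inside ∷ D))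
      fii C = Σ⟦ C , B ⟧ (λ D → f (inside ∷ C) (inside ∷ D))
    Σ-fubini (inside  ∷ A) (outside ∷ B) f = refl
    Σ-fubini (inside  ∷ A) (inside  ∷ B) f = Σ-fubini A B _

    Σ-∁ : ∀ (A B : Subset n) f → Σ⟦ ∁ B , ∁ A ⟧ f ≈ Σ⟦ A , B ⟧ (f ∘ ∁)
    Σ-∁ []            []            f = refl
    Σ-∁ (outside ∷ A) (outside ∷ B) f = Σ-∁ A B _
    Σ-∁ (outside ∷ A) (inside  ∷ B) f = trans (+-comm _ _) (+-cong (Σ-∁ A B _) (Σ-∁ A B _))
    Σ-∁ (inside  ∷ A) (outside ∷ B) f = refl
    Σ-∁ (inside  ∷ A) (inside  ∷ B) f = Σ-∁ A B _

    Σ-─ : ∀ (E : Subset n) f → Σ⟦ ⊥ , E ⟧ f ≈ Σ⟦ ⊥ , E ⟧ (λ X → f (E ─ X))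
    Σ-─ []            f = refl
    Σ-─ (outside ∷ E) f = Σ-─ E _
    Σ-─ (inside  ∷ E) f = trans (+-comm _ _) (+-cong (Σ-─ E _) (Σ-─ E _))

    Σ⊥⊤-0 : Σ⟦ ⊥ {n} , ⊤ ⟧ (λ _ → 0#) ≈ 0#
    Σ⊥⊤-0 {n} = Σ-0 (⊥ {n}) ⊤

    -- Chains are summed over all subsets of `Fin n`, with zero terms for inadmissible steps. This
    -- passes from there to the interval of admissible ones.
    Σ-restrict : ∀ (A B : Subset n) {f g} → (∀ C → A ⊆ C → C ⊆ B → f C ≈ g C) →
                 (∀ C → ¬ (A ⊆ C × C ⊆ B) → f C ≈ 0#) → Σ⟦ ⊥ , ⊤ ⟧ f ≈ Σ⟦ A , B ⟧ g
    Σ-restrict []            []            h z = h [] (λ ()) (λ ())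
    Σ-restrict {suc n} (outside ∷ A) (outside ∷ B) h z = trans
      (+-cong (Σ-restrict A B (λ C p q → h _ (out⊆ p) (out⊆ q)) λ C ∉ → z _ λ (p , q) → ∉ (drop-∷-⊆ p , drop-∷-⊆ q))
        (trans (Σ-cong′ ⊥ ⊤ λ C → z (inside ∷ C) λ (p , q) → in⊈out q) (Σ⊥⊤-0 {n})))
      (+-identityʳ _)
    Σ-restrict (outside ∷ A) (inside  ∷ B) h z = +-cong
      (Σ-restrict A B (λ C p q → h _ (out⊆ p) (out⊆ q)) λ C ∉ → z _ λ (p , q) → ∉ (drop-∷-⊆ p , drop-∷-⊆ q))
      (Σ-restrict A B (λ C p q → h _ (out⊆ p) (s⊆s q)) λ C ∉ → z _ λ (p , q) → ∉ (drop-∷-⊆ p , drop-∷-⊆ q))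
    Σ-restrict {n} (inside  ∷ A) (outside ∷ B) h z = trans
      (Σ-cong′ ⊥ ⊤ λ C → z C λ (p , q) → in⊈out (⊆-trans p q)) (Σ⊥⊤-0 {n})
    Σ-restrict {suc n} (inside  ∷ A) (inside  ∷ B) h z = trans
      (+-cong (trans (Σ-cong′ ⊥ ⊤ λ C → z (outside ∷ C) λ (p , q) → in⊈out p) (Σ⊥⊤-0 {n}))
        (Σ-restrict A B (λ C p q → h _ (s⊆s p) (s⊆s q)) λ C ∉ → z _ λ (p , q) → ∉ (drop-∷-⊆ p , drop-∷-⊆ q)))
      (+-identityˡ _)

    -- Toggling `e` is an involution of the interval. Both the cancellation in `Σ±-const` and the
    -- last step of `up-recursion` rest on this pairing.
    Σ-pair : ∀ {A E : Subset n} {e} → e ∉ A → e ∈ E → ∀ f →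
             Σ⟦ A , E ⟧ f ≈ Σ⟦ A [+ e ] , E ⟧ (λ C → f C + f (C [- e ]))
    Σ-pair {A = outside ∷ A} {inside ∷ E} {zero} e∉A e∈E f = trans (+-comm _ _) (sym (Σ-+ A E _ _))
    Σ-pair {A = inside  ∷ A} {e = zero} e∉A e∈E f = contradiction here e∉A
    Σ-pair {A = outside ∷ A} {outside ∷ E} {suc e} e∉A (there e∈E) f = Σ-pair (e∉A ∘ there) e∈E _
    Σ-pair {A = outside ∷ A} {inside  ∷ E} {suc e} e∉A (there e∈E) f =
      +-cong (Σ-pair (e∉A ∘ there) e∈E _) (Σ-pair (e∉A ∘ there) e∈E _)
    Σ-pair {A = inside  ∷ A} {outside ∷ E} {suc e} e∉A (there e∈E) f = refl
    Σ-pair {A = inside  ∷ A} {inside  ∷ E} {suc e} e∉A (there e∈E) f = Σ-pair (e∉A ∘ there) e∈E _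

    sgn : Subset n → Carrier
    sgn []            = 1#
    sgn (outside ∷ A) = sgn A
    sgn (inside  ∷ A) = - sgn A

    -x*-y≈x*y : ∀ x y → - x * - y ≈ x * y
    -x*-y≈x*y x y = trans (sym (-‿distribˡ-* x (- y)))
      (trans (-‿cong (sym (-‿distribʳ-* x y))) (-‿involutive (x * y)))

    sgn² : (A : Subset n) → sgn A * sgn A ≈ 1#
    sgn² []            = *-identityˡ 1#
    sgn² (outside ∷ A) = sgn² A
    sgn² (inside  ∷ A) = trans (-x*-y≈x*y _ _) (sgn² A)

    sgn-∁ : (A : Subset n) → sgn (∁ A) ≈ sgn {n} ⊤ * sgn A
    sgn-∁ []            = sym (*-identityˡ 1#)
    sgn-∁ (outside ∷ A) = trans (-‿cong (sgn-∁ A)) (-‿distribˡ-* _ _)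
    sgn-∁ (inside  ∷ A) = trans (sgn-∁ A) (sym (-x*-y≈x*y _ _))

    sgn-[-] : ∀ {A : Subset n} {e} → e ∈ A → sgn (A [- e ]) ≈ - sgn A
    sgn-[-] {A = inside  ∷ A} {zero}  here      = sym (-‿involutive _)
    sgn-[-] {A = outside ∷ A} {suc e} (there h) = sgn-[-] h
    sgn-[-] {A = inside  ∷ A} {suc e} (there h) = -‿cong (sgn-[-] h)

    Σ± : Subset n → Subset n → (Subset n → Carrier) → Carrier
    Σ± A B f = Σ⟦ A , B ⟧ (λ C → sgn C * f C)

    Σ±-inside : ∀ (A B : Subset n) f →
                Σ⟦ A , B ⟧ (λ C → sgn (inside ∷ C) * f C) ≈ - Σ± A B f
    Σ±-inside A B f = trans (Σ-cong′ A B λ C → sym (-‿distribˡ-* (sgn C) (f C))) (Σ-neg A B _)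

    -- Moves a sum over the ground set of a minor to an interval of the original lattice. The factor
    -- `sgn A` arises because X and A are disjoint, so their signs multiply.
    Σ±-─ : ∀ {A B : Subset n} → A ⊆ B → ∀ f → Σ± ⊥ (B ─ A) (λ X → f (X ∪ A)) ≈ sgn A * Σ± A B f
    Σ±-─ {A = []}          {[]}          A⊆B f = sym (*-identityˡ _)
    Σ±-─ {A = outside ∷ A} {outside ∷ B} A⊆B f = Σ±-─ (drop-∷-⊆ A⊆B) _
    Σ±-─ {A = outside ∷ A} {inside  ∷ B} A⊆B f = begin
      Σ± ⊥ (B ─ A) (λ X → f (outside ∷ X ∪ A)) + Σ⟦ ⊥ , B ─ A ⟧ (λ X → - sgn X * f (inside ∷ X ∪ A))
        ≈⟨ +-congˡ (Σ±-inside ⊥ (B ─ A) _) ⟩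
      Σ± ⊥ (B ─ A) (λ X → f (outside ∷ X ∪ A)) + - Σ± ⊥ (B ─ A) (λ X → f (inside ∷ X ∪ A))
        ≈⟨ +-cong (Σ±-─ (drop-∷-⊆ A⊆B) _) (-‿cong (Σ±-─ (drop-∷-⊆ A⊆B) _)) ⟩
      sgn A * Σ± A B (f ∘ (outside ∷_)) + - (sgn A * Σ± A B (f ∘ (inside ∷_)))
        ≈⟨ +-congˡ (-‿distribʳ-* _ _) ⟩
      sgn A * Σ± A B (f ∘ (outside ∷_)) + sgn A * - Σ± A B (f ∘ (inside ∷_))
        ≈⟨ distribˡ _ _ _ ⟨
      sgn A * (Σ± A B (f ∘ (outside ∷_)) + - Σ± A B (f ∘ (inside ∷_)))
        ≈⟨ *-congˡ (+-congˡ (Σ±-inside A B _)) ⟨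
      _ ∎
    Σ±-─ {A = inside  ∷ A} {outside ∷ B} A⊆B f with () ← A⊆B here
    Σ±-─ {A = inside  ∷ A} {inside  ∷ B} A⊆B f = begin
      Σ± ⊥ (B ─ A) (λ X → f (inside ∷ X ∪ A))    ≈⟨ Σ±-─ (drop-∷-⊆ A⊆B) _ ⟩
      sgn A * Σ± A B (f ∘ (inside ∷_))           ≈⟨ -x*-y≈x*y _ _ ⟨
      - sgn A * - Σ± A B (f ∘ (inside ∷_))       ≈⟨ *-congˡ (Σ±-inside A B _) ⟨
      _ ∎

    -- Adding `e` to X reverses the sign and leaves `X ∩ A` as it is, so the terms cancel in pairs.
    Σ±-∩ : ∀ {A E : Subset n} {e} → e ∈ E → e ∉ A → (f : Subset n → Carrier) → Σ± ⊥ E (λ X → f (X ∩ A)) ≈ 0#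
    Σ±-∩ {A = inside  ∷ A} {inside ∷ E} {zero} here e∉A f = contradiction here e∉A
    Σ±-∩ {A = outside ∷ A} {inside ∷ E} {zero} here e∉A f =
      trans (+-congˡ (Σ±-inside ⊥ E _)) (-‿inverseʳ _)
    Σ±-∩ {A = a ∷ A} {outside ∷ E} {suc e} (there e∈E) e∉A f = Σ±-∩ e∈E (e∉A ∘ there) (f ∘ (outside ∷_))
    Σ±-∩ {A = a ∷ A} {inside  ∷ E} {suc e} (there e∈E) e∉A f = begin
      _ ≈⟨ +-cong (Σ±-∩ e∈E (e∉A ∘ there) (f ∘ (outside ∷_))) (Σ±-inside ⊥ E _) ⟩
      0# + - _ ≈⟨ +-congˡ (-‿cong (Σ±-∩ e∈E (e∉A ∘ there) (f ∘ (a ∷_)))) ⟩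
      0# + - 0# ≈⟨ -‿inverseʳ 0# ⟩
      0# ∎

    Σ±-const : ∀ {A B : Subset n} {e} → e ∈ B → e ∉ A → ∀ k → Σ± A B (λ _ → k) ≈ 0#
    Σ±-const {A = A} {B} {e} e∈B e∉A k = begin
      Σ± A B (λ _ → k)
        ≈⟨ Σ-pair e∉A e∈B _ ⟩
      Σ⟦ A [+ e ] , B ⟧ (λ C → sgn C * k + sgn (C [- e ]) * k)
        ≈⟨ Σ-cong (A [+ e ]) B (λ C A⊆C _ → trans (+-congˡ (trans (*-congʳ (sgn-[-] (A⊆C (∈-[+] {A = A} e)))) (sym (-‿distribˡ-* _ _)))) (-‿inverseʳ _)) ⟩
      Σ⟦ A [+ e ] , B ⟧ (λ _ → 0#)
        ≈⟨ Σ-0 (A [+ e ]) B ⟩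
      0# ∎

    -- Normalising constants, such as r(E) in Crapo's formula or r(A) in the rank of a contraction,
    -- disappear through this.
    Σ±-shift : ∀ {A B : Subset n} {e} → e ∈ B → e ∉ A → ∀ {f g k} →
               (∀ C → A ⊆ C → C ⊆ B → f C ≈ g C + k) → Σ± A B f ≈ Σ± A B g
    Σ±-shift {A = A} {B} e∈B e∉A {f} {g} {k} h = begin
      Σ± A B f
        ≈⟨ Σ-cong A B (λ C p q → trans (*-congˡ (h C p q)) (distribˡ _ _ _)) ⟩
      Σ⟦ A , B ⟧ (λ C → sgn C * g C + sgn C * k)
        ≈⟨ Σ-+ A B _ _ ⟩
      Σ± A B g + Σ± A B (λ _ → k)
        ≈⟨ trans (+-congˡ (Σ±-const e∈B e∉A k)) (+-identityʳ _) ⟩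
      Σ± A B g ∎

    y+[x-y]≈x : ∀ x y → y + (x - y) ≈ x
    y+[x-y]≈x x y = trans (+-comm _ _) (trans (+-assoc _ _ _) (trans (+-congˡ (-‿inverseˡ y)) (+-identityʳ x)))

    möbius-step : ∀ (A B : Subset n) g → sgn (inside ∷ B) * Σ± (outside ∷ A) (inside ∷ B) g ≈
      sgn B * Σ± A B (g ∘ (inside ∷_)) - sgn B * Σ± A B (g ∘ (outside ∷_))
    möbius-step A B g = trans (*-congˡ (+-congˡ (Σ±-inside A B _))) (lemma (sgn B) _ _)
      where
      lemma : ∀ s x y → - s * (x + - y) ≈ s * y - s * x
      lemma s x y = trans (distribˡ (- s) x (- y))
        (trans (+-comm _ _) (+-cong (-x*-y≈x*y s y) (sym (-‿distribˡ-* s x))))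

    möbius-inside : ∀ (A B : Subset n) g →
      sgn (inside ∷ B) * Σ± (inside ∷ A) (inside ∷ B) g ≈ sgn B * Σ± A B (g ∘ (inside ∷_))
    möbius-inside A B g = trans (*-congˡ (Σ±-inside A B _)) (-x*-y≈x*y _ _)

    -- Induction on the ground set. At an element of C outside A, the subsets B that avoid it cancel
    -- against half of the contribution of those that contain it, and the other half is the
    -- inversion one element lower.
    möbius : ∀ {A C : Subset n} → A ⊆ C → ∀ g → Σ⟦ A , C ⟧ (λ B → sgn B * Σ± A B g) ≈ g C
    möbius {A = []}          {[]}          A⊆C g = trans (sym (*-assoc _ _ _)) (trans (*-congʳ (*-identityˡ _)) (*-identityˡ _))
    möbius {A = outside ∷ A} {outside ∷ C} A⊆C g = möbius (drop-∷-⊆ A⊆C) _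
    möbius {A = outside ∷ A} {inside  ∷ C} A⊆C g = begin
      J (outside ∷_) + Σ⟦ A , C ⟧ (λ B → sgn (inside ∷ B) * Σ± (outside ∷ A) (inside ∷ B) g)
        ≈⟨ +-congˡ (Σ-cong′ A C λ B → möbius-step A B g) ⟩
      J (outside ∷_) + Σ⟦ A , C ⟧ (λ B → sgn B * Σ± A B (g ∘ (inside ∷_)) - sgn B * Σ± A B (g ∘ (outside ∷_)))
        ≈⟨ +-congˡ (Σ-+ A C _ _) ⟩
      J (outside ∷_) + (J (inside ∷_) + Σ⟦ A , C ⟧ (λ B → - (sgn B * Σ± A B (g ∘ (outside ∷_)))))
        ≈⟨ +-congˡ (+-congˡ (Σ-neg A C _)) ⟩
      J (outside ∷_) + (J (inside ∷_) - J (outside ∷_))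
        ≈⟨ y+[x-y]≈x _ _ ⟩
      J (inside ∷_)
        ≈⟨ möbius (drop-∷-⊆ A⊆C) _ ⟩
      g (inside ∷ C) ∎
      where
      J : (Subset _ → Subset _) → Carrier
      J φ = Σ⟦ A , C ⟧ (λ B → sgn B * Σ± A B (g ∘ φ))
    möbius {A = inside  ∷ A} {outside ∷ C} A⊆C g with () ← A⊆C here
    möbius {A = inside  ∷ A} {inside  ∷ C} A⊆C g =
      trans (Σ-cong′ A C λ B → möbius-inside A B g) (möbius (drop-∷-⊆ A⊆C) _)

    -- The omitted B, those avoiding `e`, are exactly the ones of the inversion at `C [- e ]`; this
    -- is where the difference comes from.
    möbius-[+] : ∀ {A C : Subset n} {e} → e ∉ A → A [+ e ] ⊆ C → ∀ g →
                 Σ⟦ A [+ e ] , C ⟧ (λ B → sgn B * Σ± A B g) ≈ g C - g (C [- e ])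
    möbius-[+] {A = inside  ∷ A} {c ∷ C} {zero} e∉A A⊆C g = contradiction here e∉A
    möbius-[+] {A = outside ∷ A} {outside ∷ C} {zero} e∉A A⊆C g with () ← A⊆C here
    möbius-[+] {A = outside ∷ A} {inside  ∷ C} {zero} e∉A A⊆C g = begin
      Σ⟦ A , C ⟧ (λ B → sgn (inside ∷ B) * Σ± (outside ∷ A) (inside ∷ B) g)
        ≈⟨ Σ-cong′ A C (λ B → möbius-step A B g) ⟩
      Σ⟦ A , C ⟧ (λ B → sgn B * Σ± A B (g ∘ (inside ∷_)) - sgn B * Σ± A B (g ∘ (outside ∷_)))
        ≈⟨ Σ-+ A C _ _ ⟩
      _ + Σ⟦ A , C ⟧ (λ B → - (sgn B * Σ± A B (g ∘ (outside ∷_))))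
        ≈⟨ +-cong (möbius (drop-∷-⊆ A⊆C) _) (trans (Σ-neg A C _) (-‿cong (möbius (drop-∷-⊆ A⊆C) _))) ⟩
      g (inside ∷ C) - g (outside ∷ C) ∎
    möbius-[+] {A = outside ∷ A} {outside ∷ C} {suc e} e∉A A⊆C g = möbius-[+] (e∉A ∘ there) (drop-∷-⊆ A⊆C) _
    möbius-[+] {A = outside ∷ A} {inside  ∷ C} {suc e} e∉A A⊆C g = begin
      J (outside ∷_) + Σ⟦ A [+ e ] , C ⟧ (λ B → sgn (inside ∷ B) * Σ± (outside ∷ A) (inside ∷ B) g)
        ≈⟨ +-congˡ (Σ-cong′ (A [+ e ]) C λ B → möbius-step A B g) ⟩
      J (outside ∷_) + Σ⟦ A [+ e ] , C ⟧ (λ B → sgn B * Σ± A B (g ∘ (inside ∷_)) - sgn B * Σ± A B (g ∘ (outside ∷_)))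
        ≈⟨ +-congˡ (Σ-+ (A [+ e ]) C _ _) ⟩
      J (outside ∷_) + (J (inside ∷_) + Σ⟦ A [+ e ] , C ⟧ (λ B → - (sgn B * Σ± A B (g ∘ (outside ∷_)))))
        ≈⟨ +-congˡ (+-congˡ (Σ-neg (A [+ e ]) C _)) ⟩
      J (outside ∷_) + (J (inside ∷_) - J (outside ∷_))
        ≈⟨ y+[x-y]≈x _ _ ⟩
      J (inside ∷_)
        ≈⟨ möbius-[+] (e∉A ∘ there) (drop-∷-⊆ A⊆C) _ ⟩
      _ ∎
      where
      J : (Subset _ → Subset _) → Carrier
      J φ = Σ⟦ A [+ e ] , C ⟧ (λ B → sgn B * Σ± A B (g ∘ φ))
    möbius-[+] {A = inside  ∷ A} {outside ∷ C} {suc e} e∉A A⊆C g with () ← A⊆C here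
    möbius-[+] {A = inside  ∷ A} {inside  ∷ C} {suc e} e∉A A⊆C g =
      trans (Σ-cong′ (A [+ e ]) C λ B → möbius-inside A B g) (möbius-[+] (e∉A ∘ there) (drop-∷-⊆ A⊆C) _)

    -- For matroids `g` is the function in Crapo's sum and `w` the power of z. All that the argument
    -- needs about them is the difference equation, so the rank function is kept out and the
    -- statement can be carried over to complements.
    up-recursion : ∀ {A E : Subset n} {e} → e ∉ A → e ∈ E → ∀ c w g →
      (∀ C → A [+ e ] ⊆ C → C ⊆ E → c * ((g C - g (C [- e ])) * w C) ≈ w C - w (C [- e ])) →
      Σ± A E w ≈ c * Σ⟦ A [+ e ] , E ⟧ (λ B → sgn B * Σ± A B g * Σ± B E w)
    up-recursion {A = A} {E} {e} e∉A e∈E c w g h = sym (begin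
      c * Σ⟦ A [+ e ] , E ⟧ (λ B → sgn B * Σ± A B g * Σ± B E w)
        ≈⟨ *-congˡ (Σ-cong′ (A [+ e ]) E λ B → Σ-*ˡ B E (sgn B * Σ± A B g) _) ⟨
      c * Σ⟦ A [+ e ] , E ⟧ (λ B → Σ⟦ B , E ⟧ (λ C → sgn B * Σ± A B g * (sgn C * w C)))
        ≈⟨ *-congˡ (Σ-fubini (A [+ e ]) E _) ⟩
      c * Σ⟦ A [+ e ] , E ⟧ (λ C → Σ⟦ A [+ e ] , C ⟧ (λ B → sgn B * Σ± A B g * (sgn C * w C)))
        ≈⟨ *-congˡ (Σ-cong′ (A [+ e ]) E λ C → Σ-*ʳ (A [+ e ]) C (sgn C * w C) _) ⟩
      c * Σ⟦ A [+ e ] , E ⟧ (λ C → Σ⟦ A [+ e ] , C ⟧ (λ B → sgn B * Σ± A B g) * (sgn C * w C))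
        ≈⟨ Σ-*ˡ (A [+ e ]) E c _ ⟨
      Σ⟦ A [+ e ] , E ⟧ (λ C → c * (Σ⟦ A [+ e ] , C ⟧ (λ B → sgn B * Σ± A B g) * (sgn C * w C)))
        ≈⟨ Σ-cong (A [+ e ]) E step ⟩
      Σ⟦ A [+ e ] , E ⟧ (λ C → sgn C * w C + sgn (C [- e ]) * w (C [- e ]))
        ≈⟨ Σ-pair e∉A e∈E _ ⟨
      Σ± A E w ∎)
      where
      swap : ∀ c d s w → c * (d * (s * w)) ≈ s * (c * (d * w))
      swap = solve 4 (λ c d s w → c ⊗ (d ⊗ (s ⊗ w)) ⊜ s ⊗ (c ⊗ (d ⊗ w))) refl

      step : ∀ C → A [+ e ] ⊆ C → C ⊆ E →
             c * (Σ⟦ A [+ e ] , C ⟧ (λ B → sgn B * Σ± A B g) * (sgn C * w C)) ≈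
             sgn C * w C + sgn (C [- e ]) * w (C [- e ])
      step C A⊆C C⊆E = begin
        c * (Σ⟦ A [+ e ] , C ⟧ (λ B → sgn B * Σ± A B g) * (sgn C * w C))
          ≈⟨ *-congˡ (*-congʳ (möbius-[+] e∉A A⊆C g)) ⟩
        c * ((g C - g (C [- e ])) * (sgn C * w C))
          ≈⟨ swap c _ (sgn C) (w C) ⟩
        sgn C * (c * ((g C - g (C [- e ])) * w C))
          ≈⟨ *-congˡ (h C A⊆C C⊆E) ⟩
        sgn C * (w C - w (C [- e ]))
          ≈⟨ distribˡ _ _ _ ⟩
        sgn C * w C + sgn C * - w (C [- e ])
          ≈⟨ +-congˡ (trans (sym (-‿distribʳ-* _ _)) (-‿distribˡ-* _ _)) ⟩
        sgn C * w C + - sgn C * w (C [- e ])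
          ≈⟨ +-congˡ (*-congʳ (sgn-[-] (A⊆C (∈-[+] {A = A} e)))) ⟨
        sgn C * w C + sgn (C [- e ]) * w (C [- e ]) ∎

    Σ±-∁ : ∀ (A B : Subset n) f → Σ± (∁ B) (∁ A) (f ∘ ∁) ≈ sgn {n} ⊤ * Σ± A B f
    Σ±-∁ {n} A B f = begin
      Σ± (∁ B) (∁ A) (f ∘ ∁)                      ≈⟨ Σ-∁ A B _ ⟩
      Σ⟦ A , B ⟧ (λ C → sgn (∁ C) * f (∁ (∁ C)))  ≈⟨ Σ-cong′ A B step ⟩
      Σ⟦ A , B ⟧ (λ C → sgn {n} ⊤ * (sgn C * f C)) ≈⟨ Σ-*ˡ A B _ _ ⟩
      sgn {n} ⊤ * Σ± A B f                         ∎
      where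
      step : ∀ C → sgn (∁ C) * f (∁ (∁ C)) ≈ sgn {n} ⊤ * (sgn C * f C)
      step C = trans (*-cong (sgn-∁ C) (reflexive (≡.cong f (∁-involutive C)))) (*-assoc _ _ _)

    -- The image of up-recursion under complementation in Fin n.

    down-recursion : ∀ {A B : Subset n} {e} → e ∉ A → e ∈ B → ∀ c w g →
      (∀ D → A ⊆ D → D ⊆ B [- e ] → c * ((g D - g (D [+ e ])) * w D) ≈ w D - w (D [+ e ])) →
      Σ± A B w ≈ c * Σ⟦ A , B [- e ] ⟧ (λ D → sgn D * Σ± D B g * Σ± A D w)
    down-recursion {n} {A} {B} {e} e∉A e∈B c w g h = begin
      Σ± A B w
        ≈⟨ *-identityˡ _ ⟨
      1# * Σ± A B w
        -- Complementing an alternating sum costs the sign of the full set. Its square is inserted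
        -- to pay for the sum on the left; on the right two sums and `sgn D` cost three such signs,
        -- of which one is left over to cancel the remaining `s`.
        ≈⟨ *-congʳ (sgn² (⊤ {n})) ⟨
      s * s * Σ± A B w
        ≈⟨ *-assoc _ _ _ ⟩
      s * (s * Σ± A B w)
        ≈⟨ *-congˡ (Σ±-∁ A B w) ⟨
      s * Σ± (∁ B) (∁ A) (w ∘ ∁)
        ≈⟨ *-congˡ (up-recursion (x∈p⇒x∉∁p e∈B) (x∉p⇒x∈∁p e∉A) c (w ∘ ∁) (g ∘ ∁) h′) ⟩
      s * (c * Σ⟦ ∁ B [+ e ] , ∁ A ⟧ F)
        ≡⟨ ≡.cong (λ X → s * (c * Σ⟦ X , ∁ A ⟧ F)) (∁-[-] B e) ⟨
      s * (c * Σ⟦ ∁ (B [- e ]) , ∁ A ⟧ F)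
        ≈⟨ *-congˡ (*-congˡ (Σ-∁ A (B [- e ]) F)) ⟩
      s * (c * Σ⟦ A , B [- e ] ⟧ (F ∘ ∁))
        ≈⟨ *-congˡ (*-congˡ (Σ-cong′ A (B [- e ]) step)) ⟩
      s * (c * Σ⟦ A , B [- e ] ⟧ (λ D → s * (sgn D * Σ± D B g * Σ± A D w)))
        ≈⟨ *-congˡ (*-congˡ (Σ-*ˡ A (B [- e ]) s _)) ⟩
      s * (c * (s * G))
        ≈⟨ swap s c G ⟩
      s * s * (c * G)
        ≈⟨ *-congʳ (sgn² (⊤ {n})) ⟩
      1# * (c * G)
        ≈⟨ *-identityˡ _ ⟩
      c * G ∎
      where
      s = sgn {n} ⊤
      G = Σ⟦ A , B [- e ] ⟧ (λ D → sgn D * Σ± D B g * Σ± A D w)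

      F : Subset n → Carrier
      F C = sgn C * Σ± (∁ B) C (g ∘ ∁) * Σ± C (∁ A) (w ∘ ∁)

      swap : ∀ s c G → s * (c * (s * G)) ≈ s * s * (c * G)
      swap = solve 3 (λ s c g → s ⊗ (c ⊗ (s ⊗ g)) ⊜ (s ⊗ s) ⊗ (c ⊗ g)) refl

      swap′ : ∀ s d x y → s * d * (s * x) * (s * y) ≈ s * s * (s * (d * x * y))
      swap′ = solve 4 (λ s d x y → ((s ⊗ d) ⊗ (s ⊗ x)) ⊗ (s ⊗ y) ⊜ (s ⊗ s) ⊗ (s ⊗ ((d ⊗ x) ⊗ y))) refl

      step : ∀ D → F (∁ D) ≈ s * (sgn D * Σ± D B g * Σ± A D w)
      step D = begin
        F (∁ D)
          ≈⟨ *-cong (*-cong (sgn-∁ D) (Σ±-∁ D B g)) (Σ±-∁ A D w) ⟩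
        s * sgn D * (s * Σ± D B g) * (s * Σ± A D w)
          ≈⟨ swap′ s (sgn D) _ _ ⟩
        s * s * (s * (sgn D * Σ± D B g * Σ± A D w))
          ≈⟨ trans (*-congʳ (sgn² (⊤ {n}))) (*-identityˡ _) ⟩
        s * (sgn D * Σ± D B g * Σ± A D w) ∎

      h′ : ∀ C → ∁ B [+ e ] ⊆ C → C ⊆ ∁ A →
           c * ((g (∁ C) - g (∁ (C [- e ]))) * w (∁ C)) ≈ w (∁ C) - w (∁ (C [- e ]))
      h′ C B⊆C C⊆A rewrite ∁-[-] C e = h (∁ C)
        (x∉p⇒x∈∁p ∘ λ x∈A x∈C → x∈∁p⇒x∉p (C⊆A x∈C) x∈A)
        (x∉∁p⇒x∈p ∘ λ x∉C x∈B → x∈∁p⇒x∉p x∉C (B⊆C (≡.subst (_ ∈_) (∁-[-] B e) x∈B)))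

  module _ {R S : CommutativeRing 0ℓ 0ℓ} where
    private
      module R = CommutativeRing R
      module S = CommutativeRing S
      module ΣR = IntervalSum R
      module ΣS = IntervalSum S

    -- Only additivity is asked for, because one of the maps it is used for, taking the coefficient
    -- of x, is not multiplicative.
    Σ-homo : (φ : R.Carrier → S.Carrier) → φ R.0# S.≈ S.0# → (∀ x y → φ (x R.+ y) S.≈ φ x S.+ φ y) →
             ∀ (A B : Subset n) f → φ (ΣR.Σ⟦ A , B ⟧ f) S.≈ ΣS.Σ⟦ A , B ⟧ (φ ∘ f)
    Σ-homo φ φ0 φ+ []            []            f = S.refl
    Σ-homo φ φ0 φ+ (outside ∷ A) (outside ∷ B) f = Σ-homo φ φ0 φ+ A B _
    Σ-homo φ φ0 φ+ (outside ∷ A) (inside  ∷ B) f =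
      S.trans (φ+ _ _) (S.+-cong (Σ-homo φ φ0 φ+ A B _) (Σ-homo φ φ0 φ+ A B _))
    Σ-homo φ φ0 φ+ (inside  ∷ A) (outside ∷ B) f = φ0
    Σ-homo φ φ0 φ+ (inside  ∷ A) (inside  ∷ B) f = Σ-homo φ φ0 φ+ A B _

open IntervalSums

open import Data.Nat.Base using (ℕ)
open import Data.Product.Base using (_×_; _,_)
open import Defs

-- The commutative ring of polynomials in x and y

module Polynomials where

  open import Algebra.Bundles using (CommutativeMonoid; CommutativeRing)
  open import Algebra.Structures using (IsCommutativeMonoid)
  open import Data.Bool.Base using (T; true; false; if_then_else_; _∧_)
  import Data.Bool.Properties as 𝔹
  open import Data.Integer.Base as ℤ using (ℤ; 0ℤ; 1ℤ; +_)
  import Data.Integer.Properties as ℤ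
  open import Data.List.Base using (List; []; _∷_; _++_; [_]; map)
  import Data.List.Properties as List
  open import Data.Nat.Base using (ℕ; zero; suc; _+_; _≡ᵇ_)
  open import Data.Nat.Properties using (+-assoc; +-comm; _≤?_; m+[n∸m]≡n; m≤m+n; ≡ᵇ⇒≡)
  open import Data.Product.Base using (_×_; _,_; ∃-syntax; -,_)
  open import Data.Sum.Base using (_⊎_; inj₁; inj₂)
  open import Level using (0ℓ)
  open import Relation.Binary.Structures using (IsEquivalence)
  open import Relation.Binary.PropositionalEquality hiding ([_])
  open import Relation.Nullary using (¬_; yes; no; contradiction)

  Monomial : Set
  Monomial = ℤ × ℕ × ℕ

  infixr 7 _·_

  _·_ : Monomial → Monomial → Monomial
  (c , a , b) · (d , a′ , b′) = c ℤ.* d , a + a′ , b + b′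

  ·-comm : ∀ m m′ → m · m′ ≡ m′ · m
  ·-comm (c , a , b) (d , a′ , b′) =
    cong₂ _,_ (ℤ.*-comm c d) (cong₂ _,_ (+-comm a a′) (+-comm b b′))

  ·-assoc : ∀ l m k → (l · m) · k ≡ l · (m · k)
  ·-assoc (c , a , b) (d , a′ , b′) (e , a″ , b″) =
    cong₂ _,_ (ℤ.*-assoc c d e) (cong₂ _,_ (+-assoc a a′ a″) (+-assoc b b′ b″))

  coeff-++ : ∀ p q i j → coeff (p ++ q) i j ≡ coeff p i j ℤ.+ coeff q i j
  coeff-++ []              q i j = sym (ℤ.+-identityˡ _)
  coeff-++ ((c , a , b) ∷ p) q i j =
    trans (cong (ℤ._+_ c′) (coeff-++ p q i j)) (sym (ℤ.+-assoc c′ (coeff p i j) (coeff q i j)))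
    where c′ = if (a ≡ᵇ i) ∧ (b ≡ᵇ j) then c else 0ℤ

  +-≡ᵇ : ∀ a b c → (a + b ≡ᵇ a + c) ≡ (b ≡ᵇ c)
  +-≡ᵇ zero    b c = refl
  +-≡ᵇ (suc a) b c = +-≡ᵇ a b c

  if-* : ∀ b c d → (if b then c ℤ.* d else 0ℤ) ≡ c ℤ.* (if b then d else 0ℤ)
  if-* true  c d = refl
  if-* false c d = sym (ℤ.*-zeroʳ c)

  coeff-·-shift : ∀ c a b q i j → coeff (map ((c , a , b) ·_) q) (a + i) (b + j) ≡ c ℤ.* coeff q i j
  coeff-·-shift c a b []                  i j = sym (ℤ.*-zeroʳ c)
  coeff-·-shift c a b ((d , a′ , b′) ∷ q) i j
    rewrite +-≡ᵇ a a′ i | +-≡ᵇ b b′ j =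
    trans (cong₂ ℤ._+_ (if-* ((a′ ≡ᵇ i) ∧ (b′ ≡ᵇ j)) c d) (coeff-·-shift c a b q i j))
          (sym (ℤ.*-distribˡ-+ c _ (coeff q i j)))

  +-≢ᵇ : ∀ {a i} → ¬ (∃[ k ] i ≡ a + k) → ∀ b → (a + b ≡ᵇ i) ≡ false
  +-≢ᵇ {a} {i} ∄ b with a + b ≡ᵇ i in eq
  ... | false = refl
  ... | true  = contradiction (b , sym (≡ᵇ⇒≡ (a + b) i (subst T (sym eq) _))) ∄

  coeff-·-0 : ∀ c a b q i j → ¬ (∃[ k ] i ≡ a + k) ⊎ ¬ (∃[ k ] j ≡ b + k) →
              coeff (map ((c , a , b) ·_) q) i j ≡ 0ℤ
  coeff-·-0 c a b []                  i j ∄ = refl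
  coeff-·-0 c a b ((d , a′ , b′) ∷ q) i j (inj₁ ∄)
    rewrite +-≢ᵇ {a} {i} ∄ a′ = trans (ℤ.+-identityˡ _) (coeff-·-0 c a b q i j (inj₁ ∄))
  coeff-·-0 c a b ((d , a′ , b′) ∷ q) i j (inj₂ ∄)
    rewrite +-≢ᵇ {b} {j} ∄ b′ | 𝔹.∧-zeroʳ (a + a′ ≡ᵇ i) =
    trans (ℤ.+-identityˡ _) (coeff-·-0 c a b q i j (inj₂ ∄))

  summand? : ∀ a i → ∃[ k ] i ≡ a + k ⊎ ¬ (∃[ k ] i ≡ a + k)
  summand? a i with a ≤? i
  ... | yes a≤i = inj₁ (-, sym (m+[n∸m]≡n a≤i))
  ... | no  a≰i = inj₂ λ { (k , refl) → a≰i (m≤m+n a k) }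

  -- A record, so that the two polynomials can be inferred from a proof of equality.

  infix 4 _≋_

  record _≋_ (p q : Poly) : Set where
    constructor mk≋
    field at : p ≈ q

  open _≋_

  ≋-isEquivalence : IsEquivalence _≋_
  ≋-isEquivalence = record
    { refl  = mk≋ λ i j → refl
    ; sym   = λ e → mk≋ λ i j → sym (at e i j)
    ; trans = λ e f → mk≋ λ i j → trans (at e i j) (at f i j)
    }

  open IsEquivalence ≋-isEquivalence
    renaming (refl to ≋-refl; sym to ≋-sym; trans to ≋-trans; reflexive to ≋-reflexive)

  -- Products are computed on term lists, while equality only sees coefficients. The coefficient of
  -- a monomial multiple at (i , j) is either a multiple of one coefficient of `q`, at the shifted
  -- place, or 0 when no shift reaches (i , j); in both cases it does not depend on the list chosen.
  ·-cong : ∀ m {q q′} → q ≋ q′ → map (m ·_) q ≋ map (m ·_) q′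
  ·-cong (c , a , b) {q} {q′} q≋ .at i j with summand? a i | summand? b j
  ... | inj₁ (i′ , refl) | inj₁ (j′ , refl) = begin
    _                     ≡⟨ coeff-·-shift c a b q i′ j′ ⟩
    c ℤ.* coeff q  i′ j′  ≡⟨ cong (c ℤ.*_) (at q≋ i′ j′) ⟩
    c ℤ.* coeff q′ i′ j′  ≡⟨ coeff-·-shift c a b q′ i′ j′ ⟨
    _                     ∎
    where open ≡-Reasoning
  ... | inj₂ ∄ | _      = trans (coeff-·-0 c a b q i j (inj₁ ∄)) (sym (coeff-·-0 c a b q′ i j (inj₁ ∄)))
  ... | inj₁ _ | inj₂ ∄ = trans (coeff-·-0 c a b q i j (inj₂ ∄)) (sym (coeff-·-0 c a b q′ i j (inj₂ ∄)))

  ++-cong : ∀ {p p′ q q′} → p ≋ p′ → q ≋ q′ → p ++ q ≋ p′ ++ q′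
  ++-cong {p} {p′} {q} {q′} e f .at i j =
    trans (coeff-++ p q i j) (trans (cong₂ ℤ._+_ (at e i j) (at f i j)) (sym (coeff-++ p′ q′ i j)))

  ++-comm : ∀ p q → p ++ q ≋ q ++ p
  ++-comm p q .at i j =
    trans (coeff-++ p q i j) (trans (ℤ.+-comm (coeff p i j) (coeff q i j)) (sym (coeff-++ q p i j)))

  ++-isCommutativeMonoid : IsCommutativeMonoid _≋_ _++_ []
  ++-isCommutativeMonoid = record
    { isMonoid = record
      { isSemigroup = record
        { isMagma = record { isEquivalence = ≋-isEquivalence ; ∙-cong = ++-cong }
        ; assoc   = λ p q r → ≋-reflexive (List.++-assoc p q r) }
      ; identity = (λ p → ≋-refl) , λ p → ≋-reflexive (List.++-identityʳ p) }
    ; comm = ++-comm }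

  negate : Poly → Poly
  negate = map λ (c , a , b) → ℤ.- c , a , b

  if-neg : ∀ b c → (if b then ℤ.- c else 0ℤ) ≡ ℤ.- (if b then c else 0ℤ)
  if-neg true  c = refl
  if-neg false c = refl

  coeff-negate : ∀ p i j → coeff (negate p) i j ≡ ℤ.- coeff p i j
  coeff-negate []                i j = refl
  coeff-negate ((c , a , b) ∷ p) i j =
    trans (cong₂ ℤ._+_ (if-neg ((a ≡ᵇ i) ∧ (b ≡ᵇ j)) c) (coeff-negate p i j))
          (sym (ℤ.neg-distrib-+ (if (a ≡ᵇ i) ∧ (b ≡ᵇ j) then c else 0ℤ) (coeff p i j)))

  ⊛-zeroʳ : ∀ p → p ⊛ [] ≡ []
  ⊛-zeroʳ []      = refl
  ⊛-zeroʳ (m ∷ p) = ⊛-zeroʳ p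

  ⊛-congʳ : ∀ p {q q′} → q ≋ q′ → p ⊛ q ≋ p ⊛ q′
  ⊛-congʳ []      e = ≋-refl
  ⊛-congʳ (m ∷ p) e = ++-cong (·-cong m e) (⊛-congʳ p e)

  -- The product recurses on its left factor. Recursion on the right factor permutes the terms, so
  -- it holds only up to `≋`; commutativity follows from it.
  ⊛-∷ : ∀ p m q → p ⊛ (m ∷ q) ≋ map (m ·_) p ++ p ⊛ q
  ⊛-∷ []      m q = ≋-refl
  ⊛-∷ (k ∷ p) m q = begin
    [ k · m ] ++ map (k ·_) q ++ p ⊛ (m ∷ q)
      ≈⟨ ++-cong (≋-reflexive (cong [_] (·-comm k m))) (++-cong ≋-refl (⊛-∷ p m q)) ⟩
    [ m · k ] ++ map (k ·_) q ++ map (m ·_) p ++ p ⊛ q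
      ≈⟨ ++-cong {[ m · k ]} ≋-refl (x∙yz≈y∙xz (map (k ·_) q) (map (m ·_) p) (p ⊛ q)) ⟩
    [ m · k ] ++ map (m ·_) p ++ map (k ·_) q ++ p ⊛ q
      ∎
    where
    ++-commutativeMonoid : CommutativeMonoid _ _
    ++-commutativeMonoid = record { isCommutativeMonoid = ++-isCommutativeMonoid }
    open import Algebra.Properties.CommutativeSemigroup
      (CommutativeMonoid.commutativeSemigroup ++-commutativeMonoid) using (x∙yz≈y∙xz)
    open import Relation.Binary.Reasoning.Setoid (CommutativeMonoid.setoid ++-commutativeMonoid)

  ⊛-comm : ∀ p q → p ⊛ q ≋ q ⊛ p
  ⊛-comm []      q = ≋-reflexive (sym (⊛-zeroʳ q))
  ⊛-comm (m ∷ p) q = ≋-trans (++-cong ≋-refl (⊛-comm p q)) (≋-sym (⊛-∷ q m p))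

  ⊛-distribʳ : ∀ r p q → (p ++ q) ⊛ r ≡ p ⊛ r ++ q ⊛ r
  ⊛-distribʳ r []      q = refl
  ⊛-distribʳ r (m ∷ p) q =
    trans (cong (map (m ·_) r ++_) (⊛-distribʳ r p q)) (sym (List.++-assoc (map (m ·_) r) (p ⊛ r) (q ⊛ r)))

  ·-⊛ : ∀ m p q → map (m ·_) p ⊛ q ≡ map (m ·_) (p ⊛ q)
  ·-⊛ m []      q = refl
  ·-⊛ m (k ∷ p) q = begin
    map ((m · k) ·_) q ++ map (m ·_) p ⊛ q          ≡⟨ cong₂ _++_ (List.map-cong (·-assoc m k) q) (·-⊛ m p q) ⟩
    map (λ l → m · k · l) q ++ map (m ·_) (p ⊛ q)   ≡⟨ cong (_++ _) (List.map-∘ q) ⟩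
    map (m ·_) (map (k ·_) q) ++ map (m ·_) (p ⊛ q) ≡⟨ List.map-++ (m ·_) (map (k ·_) q) (p ⊛ q) ⟨
    map (m ·_) (map (k ·_) q ++ p ⊛ q)              ∎
    where open ≡-Reasoning

  ⊛-assoc : ∀ p q r → (p ⊛ q) ⊛ r ≡ p ⊛ (q ⊛ r)
  ⊛-assoc []      q r = refl
  ⊛-assoc (m ∷ p) q r = trans (⊛-distribʳ r (map (m ·_) q) (p ⊛ q)) (cong₂ _++_ (·-⊛ m q r) (⊛-assoc p q r))

  const : ℤ → Poly
  const c = [ c , 0 , 0 ]

  ⊛-identityˡ : ∀ p → const 1ℤ ⊛ p ≡ p
  ⊛-identityˡ p = trans (List.++-identityʳ _)
    (trans (List.map-cong (λ (c , a , b) → cong (_, a , b) (ℤ.*-identityˡ c)) p) (List.map-id p))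

  polyRing : CommutativeRing 0ℓ 0ℓ
  polyRing = record
    { Carrier = Poly ; _≈_ = _≋_ ; _+_ = _++_ ; _*_ = _⊛_ ; -_ = negate ; 0# = [] ; 1# = const 1ℤ
    ; isCommutativeRing = record
      { isRing = record
        { +-isAbelianGroup = record
          { isGroup = record
            { isMonoid = IsCommutativeMonoid.isMonoid ++-isCommutativeMonoid
            ; inverse  = inverseˡ , λ p → ≋-trans (++-comm p (negate p)) (inverseˡ p)
            ; ⁻¹-cong  = λ {p} {q} e → mk≋ λ i j →
                trans (coeff-negate p i j) (trans (cong ℤ.-_ (at e i j)) (sym (coeff-negate q i j))) }
          ; comm = ++-comm }
        -- Congruence is available for the right factor only, so the left factor is exchanged with
        -- it and back.
        ; *-cong = λ {p} {p′} {q} {q′} e f → ≋-trans (⊛-congʳ p f)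
            (≋-trans (⊛-comm p q′) (≋-trans (⊛-congʳ q′ e) (⊛-comm q′ p′)))
        ; *-assoc = λ p q r → ≋-reflexive (⊛-assoc p q r)
        ; *-identity = (λ p → ≋-reflexive (⊛-identityˡ p)) ,
            λ p → ≋-trans (⊛-comm p (const 1ℤ)) (≋-reflexive (⊛-identityˡ p))
        ; distrib = (λ r p q → ≋-trans (⊛-comm r (p ++ q))
            (≋-trans (≋-reflexive (⊛-distribʳ r p q)) (++-cong (⊛-comm p r) (⊛-comm q r)))) ,
            λ r p q → ≋-reflexive (⊛-distribʳ r p q) }
      ; *-comm = ⊛-comm } }
    where
    inverseˡ : ∀ p → negate p ++ p ≋ []
    inverseˡ p .at i j = trans (coeff-++ (negate p) p i j)
      (trans (cong (ℤ._+ coeff p i j) (coeff-negate p i j)) (ℤ.+-inverseˡ (coeff p i j)))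

open Polynomials

-- Crapo's formula for the beta invariant and its dual

module BetaInvariants where

  open import Data.Fin.Subset hiding (_-_)
  open import Data.Fin.Subset.Properties
  open import Data.Integer.Base as ℤ using (ℤ; 0ℤ; 1ℤ; -1ℤ; +_; -_; _+_; _-_; _*_)
  import Data.Integer.Properties as ℤ
  open import Data.Integer.Tactic.RingSolver using (solve-∀)
  open import Data.Bool.Base using (if_then_else_; _∧_)
  open import Data.List.Base using (List; []; _∷_; _++_; map; concat)
  import Data.List.Properties as List
  open import Data.Nat.Base as ℕ using (ℕ; zero; suc; _≤_; _∸_; _≡ᵇ_)
  import Data.Nat.Properties as ℕ
  open import Data.Product.Base using (_,_; proj₂)
  open import Data.Sum.Base using (_⊎_; inj₁; inj₂)
  open import Data.Vec.Base using ([]; _∷_)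
  open import Function.Base using (_∘_)
  open import Relation.Binary.PropositionalEquality hiding ([_])
  open import Relation.Nullary using (yes; no)
  open import Relation.Nullary.Decidable using (decidable-stable)

  private
    variable
      n : ℕ

  open Matroid
  open ≡-Reasoning

  module Σℤ = IntervalSum ℤ.+-*-commutativeRing
  open Σℤ using (Σ⟦_,_⟧; Σ±; sgn)
  module Σₚ = IntervalSum polyRing

  coeff₀₀ : Poly → ℤ
  coeff₀₀ p = coeff p 0 0

  coeff₁₀ : Poly → ℤ
  coeff₁₀ p = coeff p 1 0

  coeff₀₀-· : ∀ c a b q → coeff₀₀ (map ((c , a , b) ·_) q) ≡ (if (a ≡ᵇ 0) ∧ (b ≡ᵇ 0) then c else 0ℤ) * coeff₀₀ q
  coeff₀₀-· c zero    zero    q = coeff-·-shift c 0 0 q 0 0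
  coeff₀₀-· c zero    (suc b) q = trans (coeff-·-0 c 0 (suc b) q 0 0 (inj₂ λ ())) (sym (ℤ.*-zeroˡ (coeff₀₀ q)))
  coeff₀₀-· c (suc a) b       q = trans (coeff-·-0 c (suc a) b q 0 0 (inj₁ λ ())) (sym (ℤ.*-zeroˡ (coeff₀₀ q)))

  -- The constant coefficient is the value at x = y = 0.
  coeff₀₀-⊛ : ∀ p q → coeff₀₀ (p ⊛ q) ≡ coeff₀₀ p * coeff₀₀ q
  coeff₀₀-⊛ []                q = sym (ℤ.*-zeroˡ (coeff₀₀ q))
  coeff₀₀-⊛ ((c , a , b) ∷ p) q = begin
    coeff₀₀ (map ((c , a , b) ·_) q ++ p ⊛ q)      ≡⟨ coeff-++ (map ((c , a , b) ·_) q) (p ⊛ q) 0 0 ⟩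
    coeff₀₀ (map ((c , a , b) ·_) q) + coeff₀₀ (p ⊛ q)  ≡⟨ cong₂ _+_ (coeff₀₀-· c a b q) (coeff₀₀-⊛ p q) ⟩
    c₀ * coeff₀₀ q + coeff₀₀ p * coeff₀₀ q                   ≡⟨ ℤ.*-distribʳ-+ (coeff₀₀ q) c₀ (coeff₀₀ p) ⟨
    (c₀ + coeff₀₀ p) * coeff₀₀ q                        ∎
    where c₀ = if (a ≡ᵇ 0) ∧ (b ≡ᵇ 0) then c else 0ℤ

  coeff₁₀-· : ∀ c a b q → coeff₁₀ (map ((c , a , b) ·_) q) ≡
        (if (a ≡ᵇ 1) ∧ (b ≡ᵇ 0) then c else 0ℤ) * coeff₀₀ q + (if (a ≡ᵇ 0) ∧ (b ≡ᵇ 0) then c else 0ℤ) * coeff₁₀ q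
  coeff₁₀-· c 0 0 q = trans (coeff-·-shift c 0 0 q 1 0)
    (sym (trans (cong (_+ c * coeff₁₀ q) (ℤ.*-zeroˡ (coeff₀₀ q))) (ℤ.+-identityˡ (c * coeff₁₀ q))))
  coeff₁₀-· c 1 0 q = trans (coeff-·-shift c 1 0 q 0 0)
    (sym (trans (cong (_+_ (c * coeff₀₀ q)) (ℤ.*-zeroˡ (coeff₁₀ q))) (ℤ.+-identityʳ (c * coeff₀₀ q))))
  coeff₁₀-· c 0 (suc b) q = trans (coeff-·-0 c 0 (suc b) q 1 0 (inj₂ λ ()))
    (sym (cong₂ _+_ (ℤ.*-zeroˡ (coeff₀₀ q)) (ℤ.*-zeroˡ (coeff₁₀ q))))
  coeff₁₀-· c 1 (suc b) q = trans (coeff-·-0 c 1 (suc b) q 1 0 (inj₂ λ ()))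
    (sym (cong₂ _+_ (ℤ.*-zeroˡ (coeff₀₀ q)) (ℤ.*-zeroˡ (coeff₁₀ q))))
  coeff₁₀-· c (suc (suc a)) b q = trans (coeff-·-0 c (suc (suc a)) b q 1 0 (inj₁ λ ()))
    (sym (cong₂ _+_ (ℤ.*-zeroˡ (coeff₀₀ q)) (ℤ.*-zeroˡ (coeff₁₀ q))))

  -- The product rule: the coefficient of x is the derivative in x at the origin.
  coeff₁₀-⊛ : ∀ p q → coeff₁₀ (p ⊛ q) ≡ coeff₁₀ p * coeff₀₀ q + coeff₀₀ p * coeff₁₀ q
  coeff₁₀-⊛ []                q = sym (cong₂ _+_ (ℤ.*-zeroˡ (coeff₀₀ q)) (ℤ.*-zeroˡ (coeff₁₀ q)))
  coeff₁₀-⊛ ((c , a , b) ∷ p) q = begin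
    coeff₁₀ (map ((c , a , b) ·_) q ++ p ⊛ q)
      ≡⟨ coeff-++ (map ((c , a , b) ·_) q) (p ⊛ q) 1 0 ⟩
    coeff₁₀ (map ((c , a , b) ·_) q) + coeff₁₀ (p ⊛ q)
      ≡⟨ cong₂ _+_ (coeff₁₀-· c a b q) (coeff₁₀-⊛ p q) ⟩
    c₁ * coeff₀₀ q + c₀ * coeff₁₀ q + (coeff₁₀ p * coeff₀₀ q + coeff₀₀ p * coeff₁₀ q)
      ≡⟨ regroup c₁ c₀ (coeff₁₀ p) (coeff₀₀ p) (coeff₀₀ q) (coeff₁₀ q) ⟩
    (c₁ + coeff₁₀ p) * coeff₀₀ q + (c₀ + coeff₀₀ p) * coeff₁₀ q ∎
    where
    c₁ = if (a ≡ᵇ 1) ∧ (b ≡ᵇ 0) then c else 0ℤ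
    c₀ = if (a ≡ᵇ 0) ∧ (b ≡ᵇ 0) then c else 0ℤ

    regroup : ∀ u v s t x y → u * x + v * y + (s * x + t * y) ≡ (u + s) * x + (v + t) * y
    regroup = solve-∀

  ε : ℕ → ℤ
  ε zero    = 1ℤ
  ε (suc k) = - ε k

  ε-+ : ∀ k l → ε (k ℕ.+ l) ≡ ε k * ε l
  ε-+ zero    l = sym (ℤ.*-identityˡ (ε l))
  ε-+ (suc k) l = trans (cong -_ (ε-+ k l)) (ℤ.neg-distribˡ-* (ε k) (ε l))

  ε² : ∀ k → ε k * ε k ≡ 1ℤ
  ε² zero    = refl
  ε² (suc k) = trans (Σℤ.-x*-y≈x*y (ε k) (ε k)) (ε² k)

  ε²-cancel : ∀ k i → ε k * ε k * i ≡ i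
  ε²-cancel k i = trans (cong (_* i) (ε² k)) (ℤ.*-identityˡ i)

  -- Each sign is its own inverse. Exponents that are truncated differences of ranks thereby become
  -- products of signs, which the ring solver can handle.
  ε-∸ : ∀ {k l} → l ≤ k → ε (k ∸ l) ≡ ε k * ε l
  ε-∸ {k} {l} l≤k = begin
    ε (k ∸ l)                ≡⟨ ℤ.*-identityʳ _ ⟨
    ε (k ∸ l) * 1ℤ           ≡⟨ cong (ε (k ∸ l) *_) (ε² l) ⟨
    ε (k ∸ l) * (ε l * ε l)  ≡⟨ ℤ.*-assoc (ε (k ∸ l)) (ε l) (ε l) ⟨
    ε (k ∸ l) * ε l * ε l    ≡⟨ cong (_* ε l) (ε-+ (k ∸ l) l) ⟨
    ε (k ∸ l ℕ.+ l) * ε l    ≡⟨ cong (λ m → ε m * ε l) (ℕ.m∸n+n≡m l≤k) ⟩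
    ε k * ε l                ∎

  sgn-ε : (X : Subset n) → sgn X ≡ ε ∣ X ∣
  sgn-ε []            = refl
  sgn-ε (outside ∷ X) = sgn-ε X
  sgn-ε (inside  ∷ X) = cong -_ (sgn-ε X)

  pos-∸ : ∀ {k l} → l ≤ k → + (k ∸ l) ≡ + k - + l
  pos-∸ {k} {l} l≤k = trans (sym (ℤ.⊖-≥ l≤k)) (sym (ℤ.m-n≡m⊖n k l))

  coeff₀₀-x-1^ : ∀ k → coeff₀₀ (x-1 ^ k) ≡ ε k
  coeff₀₀-x-1^ zero    = refl
  coeff₀₀-x-1^ (suc k) = trans (coeff₀₀-⊛ x-1 (x-1 ^ k)) (trans (ℤ.-1*i≡-i (coeff₀₀ (x-1 ^ k))) (cong -_ (coeff₀₀-x-1^ k)))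

  coeff₀₀-y-1^ : ∀ k → coeff₀₀ (y-1 ^ k) ≡ ε k
  coeff₀₀-y-1^ zero    = refl
  coeff₀₀-y-1^ (suc k) = trans (coeff₀₀-⊛ y-1 (y-1 ^ k)) (trans (ℤ.-1*i≡-i (coeff₀₀ (y-1 ^ k))) (cong -_ (coeff₀₀-y-1^ k)))

  coeff₁₀-x-1^ : ∀ k → coeff₁₀ (x-1 ^ k) ≡ - (ε k * + k)
  coeff₁₀-x-1^ zero    = refl
  coeff₁₀-x-1^ (suc k) = begin
    coeff₁₀ (x-1 ^ suc k)                          ≡⟨ coeff₁₀-⊛ x-1 (x-1 ^ k) ⟩
    1ℤ * coeff₀₀ (x-1 ^ k) + -1ℤ * coeff₁₀ (x-1 ^ k)    ≡⟨ cong₂ (λ a b → 1ℤ * a + -1ℤ * b) (coeff₀₀-x-1^ k) (coeff₁₀-x-1^ k) ⟩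
    1ℤ * ε k + -1ℤ * (- (ε k * + k))         ≡⟨ regroup (ε k) (+ k) ⟩
    - (- ε k * (1ℤ + + k))                   ∎
    where
    regroup : ∀ e k → 1ℤ * e + -1ℤ * (- (e * k)) ≡ - (- e * (1ℤ + k))
    regroup = solve-∀

  coeff₁₀-y-1^ : ∀ k → coeff₁₀ (y-1 ^ k) ≡ 0ℤ
  coeff₁₀-y-1^ zero    = refl
  coeff₁₀-y-1^ (suc k) = trans (coeff₁₀-⊛ y-1 (y-1 ^ k))
    (cong₂ (λ a b → a + -1ℤ * b) (ℤ.*-zeroˡ (coeff₀₀ (y-1 ^ k))) (coeff₁₀-y-1^ k))

  -- An equality of lists: `subsets` and the interval sum both branch on each element with `outside`
  -- before `inside`.
  ∑-subsets : (S : Subset n) (f : Subset n → Poly) → ∑ (subsets S) f ≡ Σₚ.Σ⟦ ⊥ , S ⟧ f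
  ∑-subsets []            f = List.++-identityʳ (f [])
  ∑-subsets (outside ∷ S) f =
    trans (cong concat (sym (List.map-∘ (subsets S)))) (∑-subsets S (f ∘ (outside ∷_)))
  ∑-subsets (inside  ∷ S) f = begin
    concat (map f (map (outside ∷_) (subsets S) ++ map (inside ∷_) (subsets S)))
      ≡⟨ cong concat (List.map-++ f (map (outside ∷_) (subsets S)) _) ⟩
    concat (map f (map (outside ∷_) (subsets S)) ++ map f (map (inside ∷_) (subsets S)))
      ≡⟨ List.concat-++ (map f (map (outside ∷_) (subsets S))) _ ⟨
    ∑ (map (outside ∷_) (subsets S)) f ++ ∑ (map (inside ∷_) (subsets S)) f
      ≡⟨ cong₂ _++_
        (trans (cong concat (sym (List.map-∘ (subsets S)))) (∑-subsets S (f ∘ (outside ∷_))))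
        (trans (cong concat (sym (List.map-∘ (subsets S)))) (∑-subsets S (f ∘ (inside ∷_)))) ⟩
    _ ∎

  r-⊥ : (M : Matroid n) → r M ⊥ ≡ 0
  r-⊥ {n} M = ℕ.n≤0⇒n≡0 (subst (r M ⊥ ≤_) (∣⊥∣≡0 n) (r≤card M ⊥⊆))

  -- The term of X contributes -(-1)^(R-r(X)) (R-r(X)) (-1)^(|X|-r(X)) to the coefficient of x. The
  -- parity of r(X) occurs twice and cancels, and the constant R has alternating sum 0 because the
  -- ground set is nonempty.
  crapo : (M : Matroid n) → Nonempty (E M) → β M ≡ ε (r M (E M)) * Σ± ⊥ (E M) (λ X → + r M X)
  crapo M (e , e∈E) = begin
    β M
      ≡⟨ cong coeff₁₀ (∑-subsets (E M) _) ⟩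
    coeff₁₀ (Σₚ.Σ⟦ ⊥ , E M ⟧ t)
      ≡⟨ Σ-homo {polyRing} {ℤ.+-*-commutativeRing} coeff₁₀ refl (λ p q → coeff-++ p q 1 0) ⊥ (E M) t ⟩
    Σ⟦ ⊥ , E M ⟧ (coeff₁₀ ∘ t)
      ≡⟨ Σℤ.Σ-cong ⊥ (E M) (λ X _ X⊆E → step X X⊆E) ⟩
    Σ⟦ ⊥ , E M ⟧ (λ X → ε R * (sgn X * (+ r M X - + R)))
      ≡⟨ Σℤ.Σ-*ˡ ⊥ (E M) (ε R) _ ⟩
    ε R * Σ± ⊥ (E M) (λ X → + r M X - + R)
      ≡⟨ cong (ε R *_) (Σℤ.Σ±-shift e∈E ∉⊥ {g = λ X → + r M X} {k = - + R} λ X _ _ → refl) ⟩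
    ε R * Σ± ⊥ (E M) (λ X → + r M X) ∎
    where
    R = r M (E M)

    t : Subset _ → Poly
    t X = (x-1 ^ (R ∸ r M X)) ⊛ (y-1 ^ (∣ X ∣ ∸ r M X))

    regroup : ∀ a b s R ρ → - (a * b * (R - ρ)) * (s * b) + a * b * 0ℤ ≡ b * b * (a * (s * (ρ - R)))
    regroup = solve-∀

    step : ∀ X → X ⊆ E M → coeff₁₀ (t X) ≡ ε R * (sgn X * (+ r M X - + R))
    step X X⊆E = begin
      coeff₁₀ (t X)
        ≡⟨ coeff₁₀-⊛ (x-1 ^ k) (y-1 ^ l) ⟩
      coeff₁₀ (x-1 ^ k) * coeff₀₀ (y-1 ^ l) + coeff₀₀ (x-1 ^ k) * coeff₁₀ (y-1 ^ l)
        ≡⟨ cong₂ _+_ (cong₂ _*_ (coeff₁₀-x-1^ k) (coeff₀₀-y-1^ l)) (cong₂ _*_ (coeff₀₀-x-1^ k) (coeff₁₀-y-1^ l)) ⟩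
      - (ε k * + k) * ε l + ε k * 0ℤ
        ≡⟨ cong₂ (λ a b → - (a * + k) * b + a * 0ℤ) (ε-∸ ρ≤R) (ε-∸ (r≤card M X⊆E)) ⟩
      - (ε R * ε ρ * + k) * (ε ∣ X ∣ * ε ρ) + ε R * ε ρ * 0ℤ
        ≡⟨ cong₂ (λ a b → - (ε R * ε ρ * a) * (b * ε ρ) + ε R * ε ρ * 0ℤ) (pos-∸ ρ≤R) (sym (sgn-ε X)) ⟩
      - (ε R * ε ρ * (+ R - + ρ)) * (sgn X * ε ρ) + ε R * ε ρ * 0ℤ
        ≡⟨ regroup (ε R) (ε ρ) (sgn X) (+ R) (+ ρ) ⟩
      ε ρ * ε ρ * (ε R * (sgn X * (+ ρ - + R)))
        ≡⟨ ε²-cancel ρ _ ⟩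
      ε R * (sgn X * (+ ρ - + R)) ∎
      where
      ρ = r M X
      ρ≤R : ρ ≤ R
      ρ≤R = r-mono M X⊆E (λ x∈ → x∈)
      k = R ∸ ρ
      l = ∣ X ∣ ∸ ρ

  p─p≡⊥ : (p : Subset n) → p ─ p ≡ ⊥
  p─p≡⊥ []            = refl
  p─p≡⊥ (outside ∷ p) = cong (outside ∷_) (p─p≡⊥ p)
  p─p≡⊥ (inside  ∷ p) = cong (outside ∷_) (p─p≡⊥ p)

  p─[p─q]≡q : {p q : Subset n} → q ⊆ p → p ─ (p ─ q) ≡ q
  p─[p─q]≡q {p = p} {q} q⊆p = ⊆-antisym
    (λ h → let (x∈p , x∉) = x∈p─q⁻ p (p ─ q) h in
      decidable-stable (_ ∈? q) λ x∉q → x∉ (x∈p∧x∉q⇒x∈p─q x∈p x∉q))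
    (λ x∈q → x∈p∧x∉q⇒x∈p─q (q⊆p x∈q) λ h → proj₂ (x∈p─q⁻ p q h) x∈q)

  -- Crapo's formula for the dual, reflected by the map from X to `E M ─ X`. The extra |X| accounts
  -- for the difference between β and β*: its alternating sum over a nonempty set vanishes unless
  -- the set has exactly one element.
  crapo* : (M : Matroid n) → Nonempty (E M) → β* M ≡ ε (r M (E M)) * Σ± ⊥ (E M) (λ X → + r M X - + ∣ X ∣)
  crapo* M (e , e∈E) = begin
    β* M
      ≡⟨ crapo (dual M) (e , e∈E) ⟩
    ε (r (dual M) E′) * Σ± ⊥ E′ (λ X → + r (dual M) X)
      ≡⟨ cong₂ _*_ (cong ε corank) (Σℤ.Σ±-shift e∈E ∉⊥ {k = - + R} (λ X _ X⊆E → dual-rank X X⊆E)) ⟩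
    ε (∣ E′ ∣ ∸ R) * Σ± ⊥ E′ (λ X → + ∣ X ∣ + + r M (E′ ─ X))
      ≡⟨ cong₂ _*_ (ε-∸ (r≤card M (λ x∈ → x∈))) (Σℤ.Σ-─ E′ _) ⟩
    ε ∣ E′ ∣ * ε R * Σ⟦ ⊥ , E′ ⟧ (λ X → sgn (E′ ─ X) * (+ ∣ E′ ─ X ∣ + + r M (E′ ─ (E′ ─ X))))
      ≡⟨ cong (ε ∣ E′ ∣ * ε R *_) (Σℤ.Σ-cong ⊥ E′ λ X _ → reflect X) ⟩
    ε ∣ E′ ∣ * ε R * Σ⟦ ⊥ , E′ ⟧ (λ X → ε ∣ E′ ∣ * (sgn X * (+ r M X - + ∣ X ∣ + + ∣ E′ ∣)))
      ≡⟨ cong (ε ∣ E′ ∣ * ε R *_) (Σℤ.Σ-*ˡ ⊥ E′ (ε ∣ E′ ∣) _) ⟩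
    ε ∣ E′ ∣ * ε R * (ε ∣ E′ ∣ * Σ± ⊥ E′ (λ X → + r M X - + ∣ X ∣ + + ∣ E′ ∣))
      -- Reflection replaced |X| by |E| - |X|; the constant |E| drops out.
      ≡⟨ cong (λ s → ε ∣ E′ ∣ * ε R * (ε ∣ E′ ∣ * s)) (Σℤ.Σ±-shift e∈E ∉⊥ λ X _ _ → refl) ⟩
    ε ∣ E′ ∣ * ε R * (ε ∣ E′ ∣ * S)
      ≡⟨ regroup (ε ∣ E′ ∣) (ε R) S ⟩
    ε ∣ E′ ∣ * ε ∣ E′ ∣ * (ε R * S)
      ≡⟨ ε²-cancel ∣ E′ ∣ _ ⟩
    ε R * S ∎
    where
    E′ = E M
    R  = r M E′
    S  = Σ± ⊥ E′ (λ X → + r M X - + ∣ X ∣)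

    corank : r (dual M) E′ ≡ ∣ E′ ∣ ∸ R
    corank = cong (_∸ R) (trans (cong (λ X → ∣ E′ ∣ ℕ.+ r M X) (p─p≡⊥ E′))
      (trans (cong (∣ E′ ∣ ℕ.+_) (r-⊥ M)) (ℕ.+-identityʳ _)))

    -- Ensures that the truncated subtraction in the rank of the dual is a true one.
    R≤ : ∀ X → X ⊆ E′ → R ≤ ∣ X ∣ ℕ.+ r M (E′ ─ X)
    R≤ X X⊆E = ℕ.≤-trans
      (r-mono M (λ {x} x∈E → x∈p∪q⁺ (x∈X⊎x∈E─X x∈E)) (∪-lub X⊆E (p─q⊆p E′ X)))
      (ℕ.≤-trans (subadditive M X⊆E (p─q⊆p E′ X)) (ℕ.+-monoˡ-≤ _ (r≤card M X⊆E)))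
      where
      x∈X⊎x∈E─X : ∀ {x} → x ∈ E′ → x ∈ X ⊎ x ∈ E′ ─ X
      x∈X⊎x∈E─X {x} x∈E with x ∈? X
      ... | yes x∈X = inj₁ x∈X
      ... | no  x∉X = inj₂ (x∈p∧x∉q⇒x∈p─q x∈E x∉X)

    dual-rank : ∀ X → X ⊆ E′ → + r (dual M) X ≡ + ∣ X ∣ + + r M (E′ ─ X) + - + R
    dual-rank X X⊆E = pos-∸ (R≤ X X⊆E)

    reflect : ∀ X → X ⊆ E′ → sgn (E′ ─ X) * (+ ∣ E′ ─ X ∣ + + r M (E′ ─ (E′ ─ X))) ≡
              ε ∣ E′ ∣ * (sgn X * (+ r M X - + ∣ X ∣ + + ∣ E′ ∣))
    reflect X X⊆E = begin
      sgn (E′ ─ X) * (+ ∣ E′ ─ X ∣ + + r M (E′ ─ (E′ ─ X)))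
        ≡⟨ cong₂ (λ a b → a * (+ ∣ E′ ─ X ∣ + + r M b)) (sgn-ε (E′ ─ X)) (p─[p─q]≡q X⊆E) ⟩
      ε ∣ E′ ─ X ∣ * (+ ∣ E′ ─ X ∣ + + r M X)
        ≡⟨ cong (λ m → ε m * (+ m + + r M X)) ∣E─X∣ ⟩
      ε (∣ E′ ∣ ∸ ∣ X ∣) * (+ (∣ E′ ∣ ∸ ∣ X ∣) + + r M X)
        ≡⟨ cong₂ (λ a b → a * (b + + r M X)) (ε-∸ ∣X∣≤) (pos-∸ ∣X∣≤) ⟩
      ε ∣ E′ ∣ * ε ∣ X ∣ * (+ ∣ E′ ∣ - + ∣ X ∣ + + r M X)
        ≡⟨ cong (λ a → ε ∣ E′ ∣ * a * (+ ∣ E′ ∣ - + ∣ X ∣ + + r M X)) (sym (sgn-ε X)) ⟩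
      ε ∣ E′ ∣ * sgn X * (+ ∣ E′ ∣ - + ∣ X ∣ + + r M X)
        ≡⟨ swap (ε ∣ E′ ∣) (sgn X) (+ ∣ E′ ∣) (+ ∣ X ∣) (+ r M X) ⟩
      ε ∣ E′ ∣ * (sgn X * (+ r M X - + ∣ X ∣ + + ∣ E′ ∣)) ∎
      where
      ∣X∣≤ = p⊆q⇒∣p∣≤∣q∣ X⊆E
      ∣E─X∣ : ∣ E′ ─ X ∣ ≡ ∣ E′ ∣ ∸ ∣ X ∣
      ∣E─X∣ = sym (trans (cong (_∸ ∣ X ∣) (card-─ X⊆E)) (ℕ.m+n∸m≡n (∣ X ∣) (∣ E′ ─ X ∣)))
      swap : ∀ a b c d f → a * b * (c - d + f) ≡ a * (b * (f - d + c))
      swap = solve-∀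

    regroup : ∀ a b s → a * b * (a * s) ≡ a * a * (b * s)
    regroup = solve-∀

open BetaInvariants

-- Beta invariants of minors and their vanishing

module Minors where

  open import Data.Fin.Base using (Fin)
  open import Data.Fin.Subset hiding (_-_)
  open import Data.Fin.Subset.Properties
  open import Data.Integer.Base as ℤ using (ℤ; 0ℤ; +_; -_; _+_; _-_; _*_)
  import Data.Integer.Properties as ℤ
  open import Data.Integer.Tactic.RingSolver using (solve-∀)
  open import Data.Nat.Base as ℕ using (ℕ; _≤_; _∸_)
  import Data.Nat.Properties as ℕ
  open import Data.Product.Base using (_×_; _,_; proj₁; proj₂; ∃-syntax)
  open import Data.Sum.Base using (inj₁; inj₂)
  open import Function.Base using (_∘_)
  open import Relation.Binary.PropositionalEquality hiding ([_])
  open import Relation.Nullary using (¬_; yes; no; contradiction)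
  open import Relation.Nullary.Decidable using (decidable-stable)

  private
    variable
      n : ℕ

  open Matroid
  open ≡-Reasoning
  open Σℤ using (Σ⟦_,_⟧; Σ±; sgn)

  p∪[q─p]≡q : {p q : Subset n} → p ⊆ q → (q ─ p) ∪ p ≡ q
  p∪[q─p]≡q {p = p} {q} p⊆q = ⊆-antisym (∪-lub (p─q⊆p q p) p⊆q) q⊆
    where
    q⊆ : q ⊆ (q ─ p) ∪ p
    q⊆ {x} x∈q with x ∈? p
    ... | yes x∈p = x∈p∪q⁺ (inj₂ x∈p)
    ... | no  x∉p = x∈p∪q⁺ (inj₁ (x∈p∧x∉q⇒x∈p─q x∈q x∉p))

  ⊆⇒∩≡ : {p q : Subset n} → p ⊆ q → p ∩ q ≡ p
  ⊆⇒∩≡ {p = p} {q} p⊆q = ⊆-antisym (p∩q⊆p p q) λ x∈p → x∈p∩q⁺ (x∈p , p⊆q x∈p)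

  disjoint-∣∪∣ : {p q : Subset n} → (∀ {x} → x ∈ p → x ∉ q) → ∣ p ∪ q ∣ ≡ ∣ p ∣ ℕ.+ ∣ q ∣
  disjoint-∣∪∣ {n} {p} {q} dis = begin
    ∣ p ∪ q ∣                 ≡⟨ ℕ.+-identityʳ _ ⟨
    ∣ p ∪ q ∣ ℕ.+ 0           ≡⟨ cong (∣ p ∪ q ∣ ℕ.+_) ∣p∩q∣≡0 ⟨
    ∣ p ∪ q ∣ ℕ.+ ∣ p ∩ q ∣   ≡⟨ ∣∪∣+∣∩∣ p q ⟩
    ∣ p ∣ ℕ.+ ∣ q ∣           ∎
    where
    ∣p∩q∣≡0 : ∣ p ∩ q ∣ ≡ 0
    ∣p∩q∣≡0 = trans
      (cong ∣_∣ (Empty-unique λ (x , h) → let (x∈p , x∈q) = x∈p∩q⁻ p q h in dis x∈p x∈q)) (∣⊥∣≡0 n)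

  ⊂⇒Nonempty-─ : {p q : Subset n} → p ⊂ q → Nonempty (q ─ p)
  ⊂⇒Nonempty-─ (_ , x , x∈q , x∉p) = x , x∈p∧x∉q⇒x∈p─q x∈q x∉p

  Nonempty-≢⊥ : {p : Subset n} → p ≢ ⊥ → Nonempty p
  Nonempty-≢⊥ {p = p} p≢⊥ = decidable-stable (nonempty? p) (p≢⊥ ∘ Empty-unique)

  ⊆∧≢⇒⊂ : {p q : Subset n} → p ⊆ q → p ≢ q → p ⊂ q
  ⊆∧≢⇒⊂ {p = p} {q} p⊆q p≢q = p⊆q , decidable-stable (anyFin? q p) λ ∄ →
    p≢q (⊆-antisym p⊆q λ {x} x∈q → decidable-stable (x ∈? p) λ x∉p → ∄ (x , x∈q , x∉p))
    where
    open import Data.Fin.Properties using (any?)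
    open import Relation.Nullary.Decidable using (Dec; _×-dec_; ¬?)
    anyFin? : (q p : Subset _) → Dec (∃[ x ] (x ∈ q × x ∉ p))
    anyFin? q p = any? λ x → (x ∈? q) ×-dec ¬? (x ∈? p)

  module Minor (M : Matroid n) {A B : Subset n} (A⊂B : A ⊂ B) (B⊆E : B ⊆ E M) where
    private
      A⊆B : A ⊆ B
      A⊆B = proj₁ A⊂B

      E∩B≡B : E M ∩ B ≡ B
      E∩B≡B = trans (∩-comm (E M) B) (⊆⇒∩≡ B⊆E)

      A∩[E∩B]≡A : A ∩ (E M ∩ B) ≡ A
      A∩[E∩B]≡A = trans (cong (A ∩_) E∩B≡B) (⊆⇒∩≡ A⊆B)

      E-minor : E (M ↾ B / A) ≡ B ─ A
      E-minor = cong (_─ A) E∩B≡B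

      rA≤ : ∀ {X} → A ⊆ X → X ⊆ B → r M A ≤ r M X
      rA≤ A⊆X X⊆B = r-mono M A⊆X (B⊆E ∘ X⊆B)

      X∪A⊆B : ∀ {X} → X ⊆ B ─ A → X ∪ A ⊆ B
      X∪A⊆B X⊆ = ∪-lub (p─q⊆p B A ∘ X⊆) A⊆B

      e : Fin n
      e = proj₁ (⊂⇒Nonempty-─ A⊂B)

      e∈B─A : e ∈ B ─ A
      e∈B─A = proj₂ (⊂⇒Nonempty-─ A⊂B)

      -- The weight φ lets β and β* share the rewriting of the minor.

      crapo-sum : (φ : ℕ → Subset n → ℤ) → ℤ
      crapo-sum φ = ε (r M B) * ε (r M A) * Σ± ⊥ (B ─ A) (λ X → φ (r M (X ∪ A) ∸ r M A) X)

      rewrite-minor : (φ : ℕ → Subset n → ℤ) →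
        ε (r (M ↾ B / A) (E (M ↾ B / A))) * Σ± ⊥ (E (M ↾ B / A)) (λ X → φ (r (M ↾ B / A) X) X) ≡ crapo-sum φ
      rewrite-minor φ = begin
        _
          -- The operations on `M` intersect with the ground set. The ground set F of the minor and
          -- the contracted set C are replaced by `B ─ A` and `A` everywhere at once.
          ≡⟨ cong₂ (λ F C → ε (r M (F ∪ C) ∸ r M C) * Σ± ⊥ F (λ X → φ (r M (X ∪ C) ∸ r M C) X)) E-minor A∩[E∩B]≡A ⟩
        ε (r M ((B ─ A) ∪ A) ∸ r M A) * S
          ≡⟨ cong (λ C → ε (r M C ∸ r M A) * S) (p∪[q─p]≡q A⊆B) ⟩
        ε (r M B ∸ r M A) * S
          ≡⟨ cong (_* S) (ε-∸ (rA≤ A⊆B (λ x∈ → x∈))) ⟩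
        crapo-sum φ ∎
        where S = Σ± ⊥ (B ─ A) (λ X → φ (r M (X ∪ A) ∸ r M A) X)

    nonempty-minor : Nonempty (E (M ↾ B / A))
    nonempty-minor = e , subst (e ∈_) (sym E-minor) e∈B─A

    -- After adding A to every subset of `B ─ A`, only the rank function of `M` itself is left under
    -- the sum, the same for all A and B. This is what lets a single `g` in `up-recursion` stand for
    -- all the minors.
    β-minor : β (M ↾ B / A) ≡ ε (r M B) * ε (r M A) * (sgn A * Σ± A B (λ C → + r M C))
    β-minor = begin
      β (M ↾ B / A)
        ≡⟨ crapo (M ↾ B / A) nonempty-minor ⟩
      _
        ≡⟨ rewrite-minor (λ k _ → + k) ⟩
      crapo-sum (λ k _ → + k)
        ≡⟨ cong (ε (r M B) * ε (r M A) *_) (Σℤ.Σ±-shift e∈B─A ∉⊥ {g = λ X → + r M (X ∪ A)} {k = - + r M A}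
             λ X _ X⊆ → pos-∸ (rA≤ (q⊆p∪q X A) (X∪A⊆B X⊆))) ⟩
      ε (r M B) * ε (r M A) * Σ± ⊥ (B ─ A) (λ X → + r M (X ∪ A))
        ≡⟨ cong (ε (r M B) * ε (r M A) *_) (Σℤ.Σ±-─ A⊆B (λ C → + r M C)) ⟩
      _ ∎

    β*-minor : β* (M ↾ B / A) ≡ ε (r M B) * ε (r M A) * (sgn A * Σ± A B (λ C → + r M C - + ∣ C ∣))
    β*-minor = begin
      β* (M ↾ B / A)
        ≡⟨ crapo* (M ↾ B / A) nonempty-minor ⟩
      _
        ≡⟨ rewrite-minor (λ k X → + k - + ∣ X ∣) ⟩
      crapo-sum (λ k X → + k - + ∣ X ∣)
        -- The constant has two sources: - r(A) from the contraction, and |A| from replacing |X| by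
        -- |X ∪ A|, as X and A are disjoint.
        ≡⟨ cong (ε (r M B) * ε (r M A) *_) (Σℤ.Σ±-shift e∈B─A ∉⊥
             {g = λ X → + r M (X ∪ A) - + ∣ X ∪ A ∣} {k = + ∣ A ∣ - + r M A} λ X _ → step X) ⟩
      ε (r M B) * ε (r M A) * Σ± ⊥ (B ─ A) (λ X → + r M (X ∪ A) - + ∣ X ∪ A ∣)
        ≡⟨ cong (ε (r M B) * ε (r M A) *_) (Σℤ.Σ±-─ A⊆B (λ C → + r M C - + ∣ C ∣)) ⟩
      _ ∎
      where
      regroup : ∀ a b c d → a - b - c ≡ a - (c + d) + (d - b)
      regroup = solve-∀

      step : ∀ X → X ⊆ B ─ A → + (r M (X ∪ A) ∸ r M A) - + ∣ X ∣ ≡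
             + r M (X ∪ A) - + ∣ X ∪ A ∣ + (+ ∣ A ∣ - + r M A)
      step X X⊆ = begin
        + (r M (X ∪ A) ∸ r M A) - + ∣ X ∣
          ≡⟨ cong (_- + ∣ X ∣) (pos-∸ (rA≤ (q⊆p∪q X A) (X∪A⊆B X⊆))) ⟩
        + r M (X ∪ A) - + r M A - + ∣ X ∣
          ≡⟨ regroup (+ r M (X ∪ A)) (+ r M A) (+ ∣ X ∣) (+ ∣ A ∣) ⟩
        + r M (X ∪ A) - + (∣ X ∣ ℕ.+ ∣ A ∣) + (+ ∣ A ∣ - + r M A)
          ≡⟨ cong (λ k → + r M (X ∪ A) - + k + (+ ∣ A ∣ - + r M A))
               (disjoint-∣∪∣ λ x∈X → proj₂ (x∈p─q⁻ B A (X⊆ x∈X))) ⟨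
        _ ∎

  -- Each of the two parts ignores some element of E: `g` ignores one outside A, and `h` one inside
  -- A. Both alternating sums vanish by `Σ±-∩`.
  Σ±-separated : {E A : Subset n} {f g h : Subset n → ℤ} → A ⊆ E → A ≢ ⊥ → A ≢ E →
    (∀ X → X ⊆ E → f X ≡ g (X ∩ A) + h (X ∩ (E ─ A))) → Σ± ⊥ E f ≡ 0ℤ
  Σ±-separated {E = E} {A} {f} {g} {h} A⊆E A≢⊥ A≢E f≡ = begin
    Σ± ⊥ E f
      ≡⟨ Σℤ.Σ-cong ⊥ E (λ X _ X⊆E → trans (cong (sgn X *_) (f≡ X X⊆E)) (ℤ.*-distribˡ-+ (sgn X) _ _)) ⟩
    Σ⟦ ⊥ , E ⟧ (λ X → sgn X * g (X ∩ A) + sgn X * h (X ∩ (E ─ A)))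
      ≡⟨ Σℤ.Σ-+ ⊥ E _ _ ⟩
    Σ± ⊥ E (λ X → g (X ∩ A)) + Σ± ⊥ E (λ X → h (X ∩ (E ─ A)))
      ≡⟨ cong₂ _+_ (Σℤ.Σ±-∩ y∈E y∉A g) (Σℤ.Σ±-∩ (A⊆E x∈A) (λ x∈ → proj₂ (x∈p─q⁻ E A x∈) x∈A) h) ⟩
    0ℤ ∎
    where
    x∈A = proj₂ (Nonempty-≢⊥ A≢⊥)
    y∈E = proj₁ (proj₂ (proj₂ (⊆∧≢⇒⊂ A⊆E A≢E)))
    y∉A = proj₂ (proj₂ (proj₂ (⊆∧≢⇒⊂ A⊆E A≢E)))

  module Vanishing (M : Matroid n) (ne : Nonempty (E M)) where
    private
      ε* : ∀ {x} → x ≡ 0ℤ → ε (r M (E M)) * x ≡ 0ℤ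
      ε* eq = trans (cong (ε (r M (E M)) *_) eq) (ℤ.*-zeroʳ (ε (r M (E M))))

      Σ±-zero : ∀ {f} → (∀ X → X ⊆ E M → f X ≡ 0ℤ) → Σ± ⊥ (E M) f ≡ 0ℤ
      Σ±-zero f≡0 = trans
        (Σℤ.Σ-cong ⊥ (E M) λ X _ X⊆E → trans (cong (sgn X *_) (f≡0 X X⊆E)) (ℤ.*-zeroʳ (sgn X)))
        (Σℤ.Σ-0 ⊥ (E M))

    β-loop : IsLoop M → β M ≡ 0ℤ
    β-loop (_ , rE≡0) = trans (crapo M ne) (ε* (Σ±-zero λ X X⊆E →
      cong +_ (ℕ.n≤0⇒n≡0 (subst (r M X ≤_) rE≡0 (r-mono M X⊆E (λ x∈ → x∈))))))

    β*-isthmus : IsIsthmus M → β* M ≡ 0ℤ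
    β*-isthmus (∣E∣≡1 , rE≡1) = trans (crapo* M ne) (ε* (Σ±-zero λ X X⊆E →
      trans (cong (λ k → + k - + ∣ X ∣) (ℕ.≤-antisym (r≤card M X⊆E) (∣X∣≤r X X⊆E))) (ℤ.+-inverseʳ (+ ∣ X ∣))))
      where
      -- The ground set is independent, so |E| = r(E) ≤ r(E ─ X) + r(X) ≤ |E ─ X| + r(X), and |E ─
      -- X| cancels.
      ∣X∣≤r : ∀ X → X ⊆ E M → ∣ X ∣ ≤ r M X
      ∣X∣≤r X X⊆E = ℕ.+-cancelʳ-≤ (∣ E M ─ X ∣) _ _ (subst₂ _≤_
        (trans (cong (r M) (p∪[q─p]≡q X⊆E)) (trans rE≡1 (trans (sym ∣E∣≡1) (card-─ X⊆E))))
        (ℕ.+-comm (∣ E M ─ X ∣) (r M X))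
        (ℕ.≤-trans (subadditive M (p─q⊆p (E M) X) X⊆E) (ℕ.+-monoˡ-≤ (r M X) (r≤card M (p─q⊆p (E M) X)))))

    module _ {A : Subset n} (sep : IsSeparator M A) (A≢⊥ : A ≢ ⊥) (A≢E : A ≢ E M) where
      private
        A⊆E = proj₁ sep

      β-separator : β M ≡ 0ℤ
      β-separator = trans (crapo M ne) (ε* (Σ±-separated {g = +_ ∘ r M} {+_ ∘ r M} A⊆E A≢⊥ A≢E λ X X⊆E →
        cong +_ (proj₂ sep X X⊆E)))

      -- Cardinality splits along A just as the rank does, so their difference `κ` splits too.
      β*-separator : β* M ≡ 0ℤ
      β*-separator = trans (crapo* M ne) (ε* (Σ±-separated {g = κ} {κ} A⊆E A≢⊥ A≢E λ X X⊆E →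
        trans (cong₂ (λ k l → + k - + l) (proj₂ sep X X⊆E) (∣X∣ X X⊆E))
          (regroup (+ r M (X ∩ A)) (+ r M (X ∩ (E M ─ A))) (+ ∣ X ∩ A ∣) (+ ∣ X ∩ (E M ─ A) ∣))))
        where
        κ : Subset n → ℤ
        κ X = + r M X - + ∣ X ∣

        regroup : ∀ a b c d → a + b - (c + d) ≡ (a - c) + (b - d)
        regroup = solve-∀

        ∣X∣ : ∀ X → X ⊆ E M → ∣ X ∣ ≡ ∣ X ∩ A ∣ ℕ.+ ∣ X ∩ (E M ─ A) ∣
        ∣X∣ X X⊆E = begin
          ∣ X ∣                              ≡⟨ cong ∣_∣ (⊆⇒∩≡ X⊆E) ⟨
          ∣ X ∩ E M ∣                        ≡⟨ cong (λ Y → ∣ X ∩ Y ∣) (trans (∪-comm A (E M ─ A)) (p∪[q─p]≡q A⊆E)) ⟨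
          ∣ X ∩ (A ∪ (E M ─ A)) ∣            ≡⟨ cong ∣_∣ (∩-distribˡ-∪ X A (E M ─ A)) ⟩
          ∣ (X ∩ A) ∪ (X ∩ (E M ─ A)) ∣      ≡⟨ disjoint-∣∪∣ (λ h k →
            proj₂ (x∈p─q⁻ (E M) A (p∩q⊆q X (E M ─ A) k)) (p∩q⊆q X A h)) ⟩
          ∣ X ∩ A ∣ ℕ.+ ∣ X ∩ (E M ─ A) ∣    ∎

    private
      connected : (b : ℤ) → (∀ {A} → IsSeparator M A → A ≢ ⊥ → A ≢ E M → b ≡ 0ℤ) → b ≢ 0ℤ → Connected M
      connected b sep⇒0 b≢0 A sep with A ≟ˢ ⊥ | A ≟ˢ E M
      ... | yes A≡⊥ | _       = inj₁ A≡⊥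
      ... | no  _   | yes A≡E = inj₂ A≡E
      ... | no  A≢⊥ | no  A≢E = contradiction (sep⇒0 sep A≢⊥ A≢E) b≢0

    β≢0⇒connected : β M ≢ 0ℤ → Connected M × ¬ IsLoop M
    β≢0⇒connected β≢0 = connected (β M) β-separator β≢0 , β≢0 ∘ β-loop

    β*≢0⇒connected : β* M ≢ 0ℤ → Connected M × ¬ IsIsthmus M
    β*≢0⇒connected β*≢0 = connected (β* M) β*-separator β*≢0 , β*≢0 ∘ β*-isthmus

open Minors

-- The two recursions and the convolution formula

module Recursion where

  open import Algebra.Bundles using (CommutativeRing)
  open import Data.Fin.Base using (zero; suc)
  open import Data.Fin.Subset hiding (_-_)
  open import Data.Fin.Subset.Properties
  open import Data.Integer.Base as ℤ using (ℤ; 0ℤ; 1ℤ; -1ℤ; +_; -_; _+_; _-_; _*_)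
  import Data.Integer.Properties as ℤ
  open import Data.Integer.Tactic.RingSolver using (solve-∀)
  open import Data.List.Base using ([]; _∷_; _++_; [_])
  open import Data.Nat.Base as ℕ using (ℕ; zero; suc; _≤_; _∸_)
  import Data.Nat.Properties as ℕ
  open import Data.Product.Base using (_,_)
  open import Data.Sum.Base using (_⊎_; inj₁; inj₂)
  open import Data.Vec.Base using ([]; _∷_; here; there)
  open import Function.Base using (_∘_)
  open import Relation.Binary.PropositionalEquality as ≡ using (_≡_; refl; cong; cong₂; subst)
  open import Relation.Nullary using (yes; no; contradiction)

  private
    variable
      n : ℕ

  open Matroid

  module ℙ = CommutativeRing polyRing
  import Algebra.Properties.Ring ℙ.ring as ℙₚ
  open import Algebra.Solver.CommutativeMonoid ℙ.*-commutativeMonoid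
    using (solve; _⊜_) renaming (_⊕_ to _⊗_)
  open import Algebra.Properties.CommutativeSemigroup ℙ.*-commutativeSemigroup using (interchange)
  open Σₚ using () renaming (Σ⟦_,_⟧ to Σₚ⟦_,_⟧)

  X Y : Poly
  X = [ 1ℤ , 1 , 0 ]
  Y = [ 1ℤ , 0 , 1 ]

  X≋1-[1-x] : X ≋ const 1ℤ ℙ.- negate x-1
  X≋1-[1-x] ._≋_.at zero          zero    = refl
  X≋1-[1-x] ._≋_.at zero          (suc j) = refl
  X≋1-[1-x] ._≋_.at (suc zero)    zero    = refl
  X≋1-[1-x] ._≋_.at (suc zero)    (suc j) = refl
  X≋1-[1-x] ._≋_.at (suc (suc i)) j       = refl

  Y≋1-[1-y] : Y ≋ const 1ℤ ℙ.- negate y-1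
  Y≋1-[1-y] ._≋_.at zero    zero          = refl
  Y≋1-[1-y] ._≋_.at zero    (suc zero)    = refl
  Y≋1-[1-y] ._≋_.at zero    (suc (suc j)) = refl
  Y≋1-[1-y] ._≋_.at (suc i) zero          = refl
  Y≋1-[1-y] ._≋_.at (suc i) (suc j)       = refl

  const-+ : ∀ a b → const (a + b) ≋ const a ++ const b
  const-+ a b ._≋_.at zero    zero    = lemma a b
    where
    lemma : ∀ a b → a + b + 0ℤ ≡ a + (b + 0ℤ)
    lemma = solve-∀
  const-+ a b ._≋_.at zero    (suc j) = refl
  const-+ a b ._≋_.at (suc i) j       = refl

  const-0 : const 0ℤ ≋ []
  const-0 ._≋_.at zero    zero    = refl
  const-0 ._≋_.at zero    (suc j) = refl
  const-0 ._≋_.at (suc i) j       = refl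

  const-sgn : (A : Subset n) → const (Σℤ.sgn A) ≡ Σₚ.sgn A
  const-sgn []            = refl
  const-sgn (outside ∷ A) = const-sgn A
  const-sgn (inside  ∷ A) = cong negate (const-sgn A)

  const-Σ± : (A B : Subset n) (f : Subset n → ℤ) → const (Σℤ.Σ± A B f) ≋ Σₚ.Σ± A B (const ∘ f)
  const-Σ± A B f = ℙ.trans (Σ-homo {ℤ.+-*-commutativeRing} {polyRing} const const-0 const-+ A B _)
    (Σₚ.Σ-cong′ A B λ C → ℙ.*-congʳ (ℙ.reflexive (const-sgn C)))

  -- Passes from powers of `x-1` and `y-1` to powers of 1-x and 1-y; the split-off signs later
  -- combine with those of the ranks.
  negate-^ : ∀ p → p ≋ const -1ℤ ⊛ negate p → ∀ k → p ^ k ≋ const (ε k) ⊛ negate p ^ k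
  negate-^ p eq zero    = ℙ.refl
  negate-^ p eq (suc k) = begin
    p ⊛ p ^ k                                              ≈⟨ ℙ.*-cong eq (negate-^ p eq k) ⟩
    (const -1ℤ ⊛ negate p) ⊛ (const (ε k) ⊛ negate p ^ k)   ≈⟨ interchange (const -1ℤ) (negate p) (const (ε k)) (negate p ^ k) ⟩
    const (-1ℤ * ε k) ⊛ (negate p ⊛ negate p ^ k)           ≡⟨ cong (λ c → const c ⊛ (negate p ⊛ negate p ^ k)) (ℤ.-1*i≡-i (ε k)) ⟩
    const (ε (suc k)) ⊛ negate p ^ suc k                    ∎
    where
    open import Relation.Binary.Reasoning.Setoid ℙ.setoid

  -- The case of a jump by 1: with `w` a power of z, `z ⊛ w` is the next power, and `c` = 1-z
  -- produces their difference. `zero-step` is the case without a jump, where both powers agree.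
  unit-step : ∀ {c z w} k → c ≋ const 1ℤ ℙ.- z → k ≡ 1ℤ →
              c ⊛ (const k ⊛ w) ≋ w ℙ.- z ⊛ w
  unit-step {c} {z} {w} k c≋ refl = begin
    c ⊛ (const 1ℤ ⊛ w)                    ≈⟨ ℙ.*-cong c≋ (ℙ.*-identityˡ w) ⟩
    (const 1ℤ ℙ.- z) ⊛ w                  ≈⟨ ℙ.distribʳ w (const 1ℤ) (negate z) ⟩
    const 1ℤ ⊛ w ++ negate z ⊛ w          ≈⟨ ℙ.+-cong (ℙ.*-identityˡ w) (ℙ.sym (ℙₚ.-‿distribˡ-* z w)) ⟩
    w ℙ.- z ⊛ w                           ∎
    where open import Relation.Binary.Reasoning.Setoid ℙ.setoid

  zero-step : ∀ {c w} k → k ≡ 0ℤ → c ⊛ (const k ⊛ w) ≋ w ℙ.- w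
  zero-step {c} {w} k refl = begin
    c ⊛ (const 0ℤ ⊛ w)  ≈⟨ ℙ.*-congˡ {c} (ℙ.trans (ℙ.*-congʳ {w} const-0) (ℙ.zeroˡ w)) ⟩
    c ⊛ []              ≈⟨ ℙ.zeroʳ c ⟩
    []                  ≈⟨ ℙ.-‿inverseʳ w ⟨
    w ℙ.- w             ∎
    where open import Relation.Binary.Reasoning.Setoid ℙ.setoid

  [+]-lub : ∀ {A B : Subset n} {e} → A ⊆ B → e ∈ B → A [+ e ] ⊆ B
  [+]-lub {A = a ∷ A} {e = zero}  A⊆B e∈B  here      = e∈B
  [+]-lub {A = a ∷ A} {e = zero}  A⊆B e∈B  (there h) = A⊆B (there h)
  [+]-lub {A = a ∷ A} {b ∷ B} {suc e} A⊆B e∈B here   = A⊆B here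
  [+]-lub {A = a ∷ A} {b ∷ B} {suc e} A⊆B (there e∈B) (there h) =
    there ([+]-lub (drop-∷-⊆ A⊆B) e∈B h)

  ∉-[-] : ∀ (A : Subset n) e → e ∉ A [- e ]
  ∉-[-] (a ∷ A) (suc e) (there h) = ∉-[-] A e h

  [-]-[+] : ∀ {A : Subset n} {e} → e ∈ A → A [- e ] [+ e ] ≡ A
  [-]-[+] here      = refl
  [-]-[+] (there h) = cong (_ ∷_) ([-]-[+] h)

  ∣[+]∣ : ∀ {A : Subset n} {e} → e ∉ A → ∣ A [+ e ] ∣ ≡ suc ∣ A ∣
  ∣[+]∣ {A = outside ∷ A} {zero}  e∉A = refl
  ∣[+]∣ {A = inside  ∷ A} {zero}  e∉A = contradiction here e∉A
  ∣[+]∣ {A = outside ∷ A} {suc e} e∉A = ∣[+]∣ (e∉A ∘ there)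
  ∣[+]∣ {A = inside  ∷ A} {suc e} e∉A = cong suc (∣[+]∣ (e∉A ∘ there))

  module Recursions (M : Matroid n) where

    r-[+] : ∀ {A e} → A [+ e ] ⊆ E M → r M (A [+ e ]) ≡ r M A ⊎ r M (A [+ e ]) ≡ suc (r M A)
    r-[+] {A} {e} A+e⊆E = helper (r-mono M (⊆-[+] e) A+e⊆E) (begin
      r M (A [+ e ])        ≤⟨ r-mono M ([+]-lub (p⊆p∪q ⁅ e ⁆) (q⊆p∪q A ⁅ e ⁆ (x∈⁅x⁆ e))) (∪-lub A⊆E e⊆E) ⟩
      r M (A ∪ ⁅ e ⁆)       ≤⟨ subadditive M A⊆E e⊆E ⟩
      r M A ℕ.+ r M ⁅ e ⁆   ≤⟨ ℕ.+-monoʳ-≤ (r M A) (r≤card M e⊆E) ⟩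
      r M A ℕ.+ ∣ ⁅ e ⁆ ∣   ≡⟨ cong (r M A ℕ.+_) (∣⁅x⁆∣≡1 e) ⟩
      r M A ℕ.+ 1           ≡⟨ ℕ.+-comm (r M A) 1 ⟩
      suc (r M A)           ∎)
      where
      open ℕ.≤-Reasoning

      A⊆E : A ⊆ E M
      A⊆E = A+e⊆E ∘ ⊆-[+] e

      e⊆E : ⁅ e ⁆ ⊆ E M
      e⊆E x∈ rewrite x∈⁅y⁆⇒x≡y e x∈ = A+e⊆E (∈-[+] {A = A} e)

      helper : ∀ {k l} → l ≤ k → k ≤ suc l → k ≡ l ⊎ k ≡ suc l
      helper {k} {l} l≤k k≤1+l with k ℕ.≤? l
      ... | yes k≤l = inj₁ (ℕ.≤-antisym k≤l l≤k)
      ... | no  k≰l = inj₂ (ℕ.≤-antisym k≤1+l (ℕ.≰⇒> k≰l))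

    R : ℕ
    R = r M (E M)

    -- The weights of the corank-nullity expansion, up to sign.

    u v : Subset n → Poly
    u C = negate x-1 ^ (R ∸ r M C)
    v C = negate y-1 ^ (∣ C ∣ ∸ r M C)

    -- t(M / A ; x , 0) and t(M(B) ; 0 , y)

    P Q : Subset n → Poly
    P A = const (Σℤ.sgn A * (ε R * ε (r M A))) ⊛ Σₚ.Σ± A (E M) u
    Q B = const (ε (r M B)) ⊛ Σₚ.Σ± ⊥ B v

    u-step : ∀ {e} C → e ∈ C → C ⊆ E M →
             X ⊛ ((const (+ r M C) ℙ.- const (+ r M (C [- e ]))) ⊛ u C) ≋ u C ℙ.- u (C [- e ])
    u-step {e} C e∈C C⊆E = ℙ.trans
      (ℙ.*-congˡ {X} (ℙ.*-congʳ {u C} (ℙ.sym (const-+ (+ r M C) (- + r M (C [- e ]))))))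
      (cases (subst (λ D → r M D ≡ r M (C [- e ]) ⊎ r M D ≡ suc (r M (C [- e ]))) ([-]-[+] e∈C)
        (r-[+] (subst (_⊆ E M) (≡.sym ([-]-[+] e∈C)) C⊆E))))
      where
      lemma : ∀ a → 1ℤ + a - a ≡ 1ℤ
      lemma = solve-∀

      cases : r M C ≡ r M (C [- e ]) ⊎ r M C ≡ suc (r M (C [- e ])) →
              X ⊛ (const (+ r M C - + r M (C [- e ])) ⊛ u C) ≋ u C ℙ.- u (C [- e ])
      cases (inj₁ eq) = ℙ.trans
        (zero-step {X} {u C} _
          (≡.trans (cong (λ k → + k - + r M (C [- e ])) eq) (ℤ.+-inverseʳ (+ r M (C [- e ])))))
        (ℙ.+-congˡ {u C} (ℙ.reflexive (cong (λ k → negate (negate x-1 ^ (R ∸ k))) eq)))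
      cases (inj₂ eq) = ℙ.trans
        (unit-step {X} {negate x-1} {u C} _ X≋1-[1-x]
          (≡.trans (cong (λ k → + k - + r M (C [- e ])) eq) (lemma (+ r M (C [- e ])))))
        -- The exponent of `u (C [- e ])` exceeds that of `u C` by one; r(C) ≤ R excludes
        -- truncation.
        (ℙ.+-congˡ {u C} (ℙ.reflexive (cong (λ k → negate (negate x-1 ^ k))
          (≡.trans (cong (λ k → suc (R ∸ k)) eq)
            (≡.sym (ℕ.+-∸-assoc 1 (subst (_≤ R) eq (r-mono M C⊆E (λ x∈ → x∈)))))))))

    κ : Subset n → ℤ
    κ C = + r M C - + ∣ C ∣

    -- Here it is the nullity that may jump, so the cases are the reverse of those in `u-step`:
    -- nothing changes exactly when `e` raises the rank.
    v-step : ∀ {e} D → e ∉ D → D [+ e ] ⊆ E M →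
             Y ⊛ ((const (κ D) ℙ.- const (κ (D [+ e ]))) ⊛ v D) ≋ v D ℙ.- v (D [+ e ])
    v-step {e} D e∉D D+e⊆E = ℙ.trans
      (ℙ.*-congˡ {Y} (ℙ.*-congʳ {v D} (ℙ.sym (const-+ (κ D) (- κ (D [+ e ]))))))
      (cases (r-[+] D+e⊆E))
      where
      D⊆E : D ⊆ E M
      D⊆E = D+e⊆E ∘ ⊆-[+] e

      lemma₁ : ∀ a b → a - b - (1ℤ + a - (1ℤ + b)) ≡ 0ℤ
      lemma₁ = solve-∀

      lemma₂ : ∀ a b → a - b - (a - (1ℤ + b)) ≡ 1ℤ
      lemma₂ = solve-∀

      cases : r M (D [+ e ]) ≡ r M D ⊎ r M (D [+ e ]) ≡ suc (r M D) →
              Y ⊛ (const (κ D - κ (D [+ e ])) ⊛ v D) ≋ v D ℙ.- v (D [+ e ])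
      cases (inj₁ eq) = ℙ.trans (unit-step {Y} {negate y-1} {v D} _ Y≋1-[1-y]
          (≡.trans (cong₂ (λ k l → κ D - (+ k - + l)) eq (∣[+]∣ e∉D)) (lemma₂ (+ r M D) (+ ∣ D ∣))))
        (ℙ.+-congˡ {v D} (ℙ.reflexive (cong (λ k → negate (negate y-1 ^ k))
          (≡.sym (≡.trans (cong₂ _∸_ (∣[+]∣ e∉D) eq) (ℕ.+-∸-assoc 1 (r≤card M D⊆E)))))))
      cases (inj₂ eq) = ℙ.trans (zero-step {Y} {v D} _
          (≡.trans (cong₂ (λ k l → κ D - (+ k - + l)) eq (∣[+]∣ e∉D)) (lemma₁ (+ r M D) (+ ∣ D ∣))))
        (ℙ.+-congˡ {v D} (ℙ.reflexive (cong (λ k → negate (negate y-1 ^ k))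
          (≡.sym (cong₂ _∸_ (∣[+]∣ e∉D) eq)))))

    open import Relation.Binary.Reasoning.Setoid ℙ.setoid

    private
      shuffle : ∀ c x k p → (c ⊛ x) ⊛ (k ⊛ p) ≋ x ⊛ ((c ⊛ k) ⊛ p)
      shuffle = solve 4 (λ c x k p → (c ⊗ x) ⊗ (k ⊗ p) ⊜ x ⊗ ((c ⊗ k) ⊗ p)) ℙ.refl

    P-recursion : ∀ {A e} → A ⊆ E M → e ∉ A → e ∈ E M →
      P A ≋ Σₚ⟦ A [+ e ] , E M ⟧ (λ B → (const (β (M ↾ B / A)) ⊛ X) ⊛ P B)
    P-recursion {A} {e} A⊆E e∉A e∈E = begin
      c ⊛ Σₚ.Σ± A (E M) u
        ≈⟨ ℙ.*-congˡ {c} (Σₚ.up-recursion e∉A e∈E X u (λ C → const (+ r M C))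
             λ C A⊆C → u-step C (A⊆C (∈-[+] {A = A} e))) ⟩
      c ⊛ (X ⊛ Σₚ⟦ A [+ e ] , E M ⟧ F)
        ≈⟨ ℙ.*-assoc c X _ ⟨
      (c ⊛ X) ⊛ Σₚ⟦ A [+ e ] , E M ⟧ F
        ≈⟨ Σₚ.Σ-*ˡ (A [+ e ]) (E M) (c ⊛ X) F ⟨
      Σₚ⟦ A [+ e ] , E M ⟧ (λ B → (c ⊛ X) ⊛ F B)
        ≈⟨ Σₚ.Σ-cong (A [+ e ]) (E M) step ⟩
      _ ∎
      where
      c = const (Σℤ.sgn A * (ε R * ε (r M A)))

      F : Subset n → Poly
      F B = (Σₚ.sgn B ⊛ Σₚ.Σ± A B (λ C → const (+ r M C))) ⊛ Σₚ.Σ± B (E M) u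

      -- The sign of r(B) occurs both in `β-minor` and in `P B` but not on the left, so its square
      -- is inserted.
      coefficients : ∀ a R εA b S k → a * (R * εA) * (b * S) ≡ ε k * εA * (a * S) * (b * (R * ε k))
      coefficients a R εA b S k = ≡.trans (≡.sym (ε²-cancel k _)) (lemma a R εA b S (ε k))
        where
        lemma : ∀ a R εA b S εB → εB * εB * (a * (R * εA) * (b * S)) ≡ εB * εA * (a * S) * (b * (R * εB))
        lemma = solve-∀

      step : ∀ B → A [+ e ] ⊆ B → B ⊆ E M → (c ⊛ X) ⊛ F B ≋ (const (β (M ↾ B / A)) ⊛ X) ⊛ P B
      step B A⊆B B⊆E = begin
        (c ⊛ X) ⊛ F B
          ≈⟨ ℙ.*-congˡ {c ⊛ X} (ℙ.*-congʳ {p} (ℙ.*-cong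
               (ℙ.reflexive (≡.sym (const-sgn B))) (ℙ.sym (const-Σ± A B _)))) ⟩
        (c ⊛ X) ⊛ ((const sB ⊛ const S) ⊛ p)
          ≈⟨ shuffle c X (const (sB * S)) p ⟩
        X ⊛ (const (Σℤ.sgn A * (ε R * ε (r M A)) * (sB * S)) ⊛ p)
          ≡⟨ cong (λ k → X ⊛ (const k ⊛ p))
               (coefficients (Σℤ.sgn A) (ε R) (ε (r M A)) sB S (r M B)) ⟩
        X ⊛ (const (ε (r M B) * ε (r M A) * (Σℤ.sgn A * S) * k) ⊛ p)
          ≡⟨ cong (λ b → X ⊛ (const (b * k) ⊛ p)) (≡.sym (Minor.β-minor M A⊂B B⊆E)) ⟩
        X ⊛ ((const (β (M ↾ B / A)) ⊛ const k) ⊛ p)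
          ≈⟨ shuffle (const (β (M ↾ B / A))) X (const k) p ⟨
        (const (β (M ↾ B / A)) ⊛ X) ⊛ P B ∎
        where
        sB = Σℤ.sgn B
        S  = Σℤ.Σ± A B (λ C → + r M C)
        p  = Σₚ.Σ± B (E M) u
        k  = sB * (ε R * ε (r M B))
        A⊂B : A ⊂ B
        A⊂B = A⊆B ∘ ⊆-[+] e , e , A⊆B (∈-[+] {A = A} e) , e∉A

    Q-recursion : ∀ {B e} → B ⊆ E M → e ∈ B →
      Q B ≋ Σₚ⟦ ⊥ , B [- e ] ⟧ (λ A → (const (β* (M ↾ B / A)) ⊛ Y) ⊛ Q A)
    Q-recursion {B} {e} B⊆E e∈B = begin
      c ⊛ Σₚ.Σ± ⊥ B v
        ≈⟨ ℙ.*-congˡ {c} (Σₚ.down-recursion ∉⊥ e∈B Y v (const ∘ κ)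
             λ D _ D⊆B → v-step D (∉-[-] B e ∘ D⊆B) (B⊆E ∘ [+]-lub ([-]-⊆ e ∘ D⊆B) e∈B)) ⟩
      c ⊛ (Y ⊛ Σₚ⟦ ⊥ , B [- e ] ⟧ F)
        ≈⟨ ℙ.*-assoc c Y _ ⟨
      (c ⊛ Y) ⊛ Σₚ⟦ ⊥ , B [- e ] ⟧ F
        ≈⟨ Σₚ.Σ-*ˡ ⊥ (B [- e ]) (c ⊛ Y) F ⟨
      Σₚ⟦ ⊥ , B [- e ] ⟧ (λ A → (c ⊛ Y) ⊛ F A)
        ≈⟨ Σₚ.Σ-cong ⊥ (B [- e ]) (λ A _ → step A) ⟩
      _ ∎
      where
      c = const (ε (r M B))

      F : Subset n → Poly
      F A = (Σₚ.sgn A ⊛ Σₚ.Σ± A B (const ∘ κ)) ⊛ Σₚ.Σ± ⊥ A v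

      coefficients : ∀ εB a S k → εB * (a * S) ≡ εB * ε k * (a * S) * ε k
      coefficients εB a S k = ≡.trans (≡.sym (ε²-cancel k _)) (lemma εB a S (ε k))
        where
        lemma : ∀ εB a S εA → εA * εA * (εB * (a * S)) ≡ εB * εA * (a * S) * εA
        lemma = solve-∀

      step : ∀ A → A ⊆ B [- e ] → (c ⊛ Y) ⊛ F A ≋ (const (β* (M ↾ B / A)) ⊛ Y) ⊛ Q A
      step A A⊆B = begin
        (c ⊛ Y) ⊛ F A
          ≈⟨ ℙ.*-congˡ {c ⊛ Y} (ℙ.*-congʳ {q} (ℙ.*-cong
               (ℙ.reflexive (≡.sym (const-sgn A))) (ℙ.sym (const-Σ± A B κ)))) ⟩
        (c ⊛ Y) ⊛ ((const sA ⊛ const S) ⊛ q)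
          ≈⟨ shuffle c Y (const (sA * S)) q ⟩
        Y ⊛ (const (ε (r M B) * (sA * S)) ⊛ q)
          ≡⟨ cong (λ k → Y ⊛ (const k ⊛ q)) (coefficients (ε (r M B)) sA S (r M A)) ⟩
        Y ⊛ (const (ε (r M B) * εA * (sA * S) * εA) ⊛ q)
          ≡⟨ cong (λ b → Y ⊛ (const (b * εA) ⊛ q)) (≡.sym (Minor.β*-minor M A⊂B B⊆E)) ⟩
        Y ⊛ ((const (β* (M ↾ B / A)) ⊛ const εA) ⊛ q)
          ≈⟨ shuffle (const (β* (M ↾ B / A))) Y (const εA) q ⟨
        (const (β* (M ↾ B / A)) ⊛ Y) ⊛ Q A ∎
        where
        sA = Σℤ.sgn A
        S  = Σℤ.Σ± A B κ
        q  = Σₚ.Σ± ⊥ A v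
        εA = ε (r M A)
        A⊂B : A ⊂ B
        A⊂B = [-]-⊆ e ∘ A⊆B , e , e∈B , ∉-[-] B e ∘ A⊆B

    P-E : P (E M) ≋ const 1ℤ
    P-E = begin
      P (E M)
        ≡⟨ cong (const (s * (ε R * ε R)) ⊛_) (Σₚ.Σ-singleton (E M) _) ⟩
      const (s * (ε R * ε R)) ⊛ (Σₚ.sgn (E M) ⊛ negate x-1 ^ (R ∸ R))
        ≡⟨ cong₂ (λ a k → const (s * a) ⊛ (Σₚ.sgn (E M) ⊛ negate x-1 ^ k)) (ε² R) (ℕ.n∸n≡0 R) ⟩
      const (s * 1ℤ) ⊛ (Σₚ.sgn (E M) ⊛ const 1ℤ)
        ≡⟨ cong₂ (λ a p → const a ⊛ (p ⊛ const 1ℤ)) (ℤ.*-identityʳ s) (≡.sym (const-sgn (E M))) ⟩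
      const (s * (s * 1ℤ))
        ≡⟨ cong const (≡.trans (cong (s *_) (ℤ.*-identityʳ s)) (Σℤ.sgn² (E M))) ⟩
      const 1ℤ ∎
      where s = Σℤ.sgn (E M)

    Q-⊥ : Q ⊥ ≋ const 1ℤ
    Q-⊥ = begin
      Q ⊥
        ≡⟨ cong₂ (λ p k → const (ε k) ⊛ p) (Σₚ.Σ-singleton (⊥ {n}) _) (r-⊥ M) ⟩
      const 1ℤ ⊛ (Σₚ.sgn (⊥ {n}) ⊛ v ⊥)
        ≡⟨ cong₂ (λ p k → const 1ℤ ⊛ (p ⊛ negate y-1 ^ k)) (≡.sym (const-sgn (⊥ {n})))
             (≡.trans (cong₂ _∸_ (∣⊥∣≡0 n) (r-⊥ M)) refl) ⟩
      const 1ℤ ⊛ (const (Σℤ.sgn (⊥ {n})) ⊛ const 1ℤ)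
        ≡⟨ cong (λ k → const 1ℤ ⊛ (const k ⊛ const 1ℤ)) (≡.trans (sgn-ε (⊥ {n})) (cong ε (∣⊥∣≡0 n))) ⟩
      const 1ℤ ∎

    -- In the term of C the parity of r(C) cancels, which leaves `v C ⊛ u C` with the sign of |C|.
    -- Möbius inversion expands `v C` over the sets F ⊆ C; once the sums are exchanged, F carries an
    -- alternating sum of `v` below it and one of `u` above it, that is, `Q F` and `P F` up to sign.
    tutte-convolution : tutte M ≋ Σₚ⟦ ⊥ , E M ⟧ (λ F → Q F ⊛ P F)
    tutte-convolution = begin
      tutte M
        ≡⟨ ∑-subsets (E M) t ⟩
      Σₚ⟦ ⊥ , E M ⟧ t
        ≈⟨ Σₚ.Σ-cong ⊥ (E M) (λ C _ → expansion C) ⟩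
      Σₚ⟦ ⊥ , E M ⟧ (λ C → v C ⊛ (c ⊛ su C))
        ≈⟨ Σₚ.Σ-cong′ ⊥ (E M) (λ C → ℙ.*-congʳ {c ⊛ su C} (Σₚ.möbius ⊥⊆ v)) ⟨
      Σₚ⟦ ⊥ , E M ⟧ (λ C → Σₚ⟦ ⊥ , C ⟧ sq ⊛ (c ⊛ su C))
        ≈⟨ Σₚ.Σ-cong′ ⊥ (E M) (λ C → Σₚ.Σ-*ʳ ⊥ C (c ⊛ su C) sq) ⟨
      Σₚ⟦ ⊥ , E M ⟧ (λ C → Σₚ⟦ ⊥ , C ⟧ (λ F → sq F ⊛ (c ⊛ su C)))
        ≈⟨ Σₚ.Σ-fubini ⊥ (E M) (λ F C → sq F ⊛ (c ⊛ su C)) ⟨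
      Σₚ⟦ ⊥ , E M ⟧ (λ F → Σₚ⟦ F , E M ⟧ (λ C → sq F ⊛ (c ⊛ su C)))
        ≈⟨ Σₚ.Σ-cong′ ⊥ (E M) (λ F → ℙ.trans (Σₚ.Σ-*ˡ F (E M) (sq F) (λ C → c ⊛ su C))
             (ℙ.*-congˡ {sq F} (Σₚ.Σ-*ˡ F (E M) c su))) ⟩
      Σₚ⟦ ⊥ , E M ⟧ (λ F → sq F ⊛ (c ⊛ Σₚ.Σ± F (E M) u))
        ≈⟨ Σₚ.Σ-cong′ ⊥ (E M) product ⟩
      _ ∎
      where
      c = const (ε R)

      t su sq : Subset n → Poly
      t C  = (x-1 ^ (R ∸ r M C)) ⊛ (y-1 ^ (∣ C ∣ ∸ r M C))
      su C = Σₚ.sgn C ⊛ u C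
      sq F = Σₚ.sgn F ⊛ Σₚ.Σ± ⊥ F v

      gather : ∀ a u b v → (a ⊛ u) ⊛ (b ⊛ v) ≋ v ⊛ ((a ⊛ b) ⊛ u)
      gather = solve 4 (λ a u b v → (a ⊗ u) ⊗ (b ⊗ v) ⊜ v ⊗ ((a ⊗ b) ⊗ u)) ℙ.refl

      sign : ∀ C → C ⊆ E M → ε (R ∸ r M C) * ε (∣ C ∣ ∸ r M C) ≡ ε R * Σℤ.sgn C
      sign C C⊆E = ≡.trans
        (cong₂ _*_ (ε-∸ (r-mono M C⊆E (λ x∈ → x∈))) (≡.trans (ε-∸ (r≤card M C⊆E)) (cong (_* ε (r M C)) (≡.sym (sgn-ε C)))))
        (≡.trans (lemma (ε R) (ε (r M C)) (Σℤ.sgn C))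
          (ε²-cancel (r M C) _))
        where
        lemma : ∀ a b s → a * b * (s * b) ≡ b * b * (a * s)
        lemma = solve-∀

      expansion : ∀ C → C ⊆ E M → t C ≋ v C ⊛ (c ⊛ su C)
      expansion C C⊆E = begin
        t C
          ≈⟨ ℙ.*-cong (negate-^ x-1 ℙ.refl (R ∸ r M C)) (negate-^ y-1 ℙ.refl (∣ C ∣ ∸ r M C)) ⟩
        (const (ε (R ∸ r M C)) ⊛ u C) ⊛ (const (ε (∣ C ∣ ∸ r M C)) ⊛ v C)
          ≈⟨ gather (const (ε (R ∸ r M C))) (u C) (const (ε (∣ C ∣ ∸ r M C))) (v C) ⟩
        v C ⊛ (const (ε (R ∸ r M C) * ε (∣ C ∣ ∸ r M C)) ⊛ u C)
          ≡⟨ cong (λ k → v C ⊛ (const k ⊛ u C)) (sign C C⊆E) ⟩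
        v C ⊛ ((c ⊛ const (Σℤ.sgn C)) ⊛ u C)
          ≡⟨ cong (λ s → v C ⊛ ((c ⊛ s) ⊛ u C)) (const-sgn C) ⟩
        v C ⊛ ((c ⊛ Σₚ.sgn C) ⊛ u C)
          ≈⟨ ℙ.*-congˡ {v C} (ℙ.*-assoc c (Σₚ.sgn C) (u C)) ⟩
        v C ⊛ (c ⊛ su C) ∎

      product : ∀ F → sq F ⊛ (c ⊛ Σₚ.Σ± F (E M) u) ≋ Q F ⊛ P F
      product F = begin
        sq F ⊛ (c ⊛ p)
          ≈⟨ interchange (Σₚ.sgn F) q c p ⟩
        (Σₚ.sgn F ⊛ c) ⊛ (q ⊛ p)
          ≡⟨ cong (λ s → (s ⊛ c) ⊛ (q ⊛ p)) (≡.sym (const-sgn F)) ⟩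
        const (Σℤ.sgn F * ε R) ⊛ (q ⊛ p)
          ≡⟨ cong (λ k → const k ⊛ (q ⊛ p)) (coefficients (Σℤ.sgn F) (ε R) (r M F)) ⟩
        (const (ε (r M F)) ⊛ const (Σℤ.sgn F * (ε R * ε (r M F)))) ⊛ (q ⊛ p)
          ≈⟨ interchange (const (ε (r M F))) q (const (Σℤ.sgn F * (ε R * ε (r M F)))) p ⟨
        Q F ⊛ P F ∎
        where
        q = Σₚ.Σ± ⊥ F v
        p = Σₚ.Σ± F (E M) u

        coefficients : ∀ s R k → s * R ≡ ε k * (s * (R * ε k))
        coefficients s R k = ≡.trans (≡.sym (ε²-cancel k _)) (lemma s R (ε k))
          where
          lemma : ∀ s R f → f * f * (s * R) ≡ f * (s * (R * f))
          lemma = solve-∀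

open Recursion

-- Filtrations as chains with a local condition

module Chains where

  open import Data.Fin.Base using (zero; suc; toℕ)
  open import Data.Fin.Properties using (toℕ-injective)
  open import Data.Fin.Subset hiding (_-_)
  open import Data.Fin.Subset.Properties
  open import Data.List.Base using (List; []; _∷_; map)
  open import Data.List.Relation.Unary.All using (All; []; _∷_)
  open import Data.List.Relation.Unary.Linked using (Linked; []; [-]; _∷_)
  open import Data.Nat.Base as ℕ using (ℕ; zero; suc; _≤_; _<_; z≤n; s≤s)
  import Data.Nat.Properties as ℕ
  open import Data.Product.Base using (_×_; _,_; proj₁; proj₂; ∃-syntax)
  open import Data.Sum.Base using (_⊎_; inj₁; inj₂)
  open import Data.Vec.Base using ([]; _∷_; here; there)
  open import Function.Base using (_∘_)
  open import Function.Bundles using (_⇔_; mk⇔)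
  open import Relation.Binary.PropositionalEquality using (_≡_; refl; sym; trans; cong; subst)
  open import Relation.Nullary using (Dec; yes; no; contradiction)
  open import Relation.Nullary.Decidable using (_×-dec_)

  private
    variable
      n : ℕ

  min-≤ : ∀ {S : Subset n} {x} → x ∈ S → min S ≤ toℕ x
  min-≤ {S = inside  ∷ S} h         = z≤n
  min-≤ {S = outside ∷ S} (there h) = s≤s (min-≤ h)

  argmin : ∀ {S : Subset n} → Nonempty S → ∃[ e ] (e ∈ S × toℕ e ≡ min S)
  argmin {S = inside  ∷ S} _               = zero , here , refl
  argmin {S = outside ∷ S} (suc x , there h) =
    let (e , e∈S , eq) = argmin (x , h) in suc e , there e∈S , cong suc eq

  min-antitone : ∀ {S T : Subset n} → S ⊆ T → Nonempty S → min T ≤ min S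
  min-antitone S⊆T ne = let (e , e∈S , eq) = argmin ne in subst (_ ≤_) eq (min-≤ (S⊆T e∈S))

  min∈⇒min≡ : ∀ {S T : Subset n} {e} → S ⊆ T → toℕ e ≡ min T → e ∈ S → min S ≡ min T
  min∈⇒min≡ S⊆T eq e∈S = ℕ.≤-antisym (subst (_ ≤_) eq (min-≤ e∈S)) (min-antitone S⊆T (_ , e∈S))

  min≡⇒min∈ : ∀ {S T : Subset n} {e} → toℕ e ≡ min T → Nonempty S → min S ≡ min T → e ∈ S
  min≡⇒min∈ {S = S} eq ne eq′ = let (f , f∈S , eqf) = argmin ne in
    subst (_∈ S) (toℕ-injective (trans eqf (trans eq′ (sym eq)))) f∈S

  -- S is what a step uses, T what is available to it and U what remains for later steps. If the
  -- minimum of T is used up by S, it cannot lie in U.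
  min≡⇒min< : ∀ {S T U : Subset n} → Nonempty S → U ⊆ T → Nonempty U → (∀ {x} → x ∈ S → x ∉ U) →
              min S ≡ min T → min S < min U
  min≡⇒min< {S = S} {T} {U} neS U⊆T neU disjoint eq =
    let (f , f∈U , eqf) = argmin neU in
    ℕ.≤∧≢⇒< (subst (_≤ min U) (sym eq) (min-antitone U⊆T neU))
      λ eq′ → disjoint (min≡⇒min∈ (trans eqf (trans (sym eq′) eq)) neS eq) f∈U

  -- If the least element of T lay in U, the minimum of U would not exceed that of S.
  min<⇒min≡ : ∀ {S T U : Subset n} → S ⊆ T → Nonempty S → (∀ {x} → x ∈ T → x ∈ S ⊎ x ∈ U) →
              min S < min U → min S ≡ min T
  min<⇒min≡ {S = S} {T} {U} S⊆T ne cover min< with argmin {S = T} (_ , S⊆T (proj₂ ne))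
  ... | e , e∈T , eq with cover e∈T
  ...   | inj₁ e∈S = min∈⇒min≡ S⊆T eq e∈S
  ...   | inj₂ e∈U = contradiction
    (ℕ.≤-trans (min-≤ e∈U) (subst (_≤ min S) (sym eq) (min-antitone S⊆T ne))) (ℕ.<⇒≱ min<)

  ─-antitoneʳ : ∀ (C : Subset n) {A B} → A ⊆ B → C ─ B ⊆ C ─ A
  ─-antitoneʳ C {A} {B} A⊆B h = let (x∈C , x∉B) = x∈p─q⁻ C B h in x∈p∧x∉q⇒x∈p─q x∈C (x∉B ∘ A⊆B)

  ─-monoˡ : ∀ {B C : Subset n} A → B ⊆ C → B ─ A ⊆ C ─ A
  ─-monoˡ {B = B} A B⊆C h = let (x∈B , x∉A) = x∈p─q⁻ B A h in x∈p∧x∉q⇒x∈p─q (B⊆C x∈B) x∉A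

  x∈p⇒x∈p─q⊎x∈q : ∀ {p} (q : Subset n) {x} → x ∈ p → x ∈ p ─ q ⊎ x ∈ q
  x∈p⇒x∈p─q⊎x∈q q {x} x∈p with x ∈? q
  ... | yes x∈q = inj₂ x∈q
  ... | no  x∉q = inj₁ (x∈p∧x∉q⇒x∈p─q x∈p x∉q)

  -- A condition that looks at one step at a time makes the decision for `B ∷ Bs` a product of two
  -- decisions, which is how a sum over chains splits off its first step.
  module Chain {S : Set} (Step : S → S → Set) (End : S → Set) where

    Chain : S → List S → Set
    Chain A []       = End A
    Chain A (B ∷ Bs) = Step A B × Chain B Bs

    module _ (step? : ∀ A B → Dec (Step A B)) (end? : ∀ A → Dec (End A)) where

      chain? : ∀ A Bs → Dec (Chain A Bs)
      chain? A []       = end? A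
      chain? A (B ∷ Bs) = step? A B ×-dec chain? B Bs

  -- In a filtration, the minima increase exactly if each of them is the least
  -- element that is still available. This makes the condition local.

  UpStep : Subset n → Subset n → Subset n → Set
  UpStep E A B = A ⊂ B × B ⊆ E × min (B ─ A) ≡ min (E ─ A)

  upStep? : (E A B : Subset n) → Dec (UpStep E A B)
  upStep? E A B = (A ⊂? B) ×-dec (B ⊆? E) ×-dec (_ ℕ.≟ _)

  DownStep : Subset n → Subset n → Set
  DownStep B A = A ⊂ B × min (B ─ A) ≡ min B

  downStep? : (B A : Subset n) → Dec (DownStep B A)
  downStep? B A = (A ⊂? B) ×-dec (_ ℕ.≟ _)

  module Up {n} (E : Subset n) = Chain (UpStep E) (_≡ E)
  module Down {n} = Chain (DownStep {n}) (_≡ ⊥)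

  up-⊆ : ∀ {E A : Subset n} Bs → Up.Chain E A Bs → A ⊆ E
  up-⊆ []       A≡E              = subst (_ ⊆_) A≡E (λ x∈ → x∈)
  up-⊆ (B ∷ Bs) ((A⊂B , B⊆E , _) , _) = B⊆E ∘ proj₁ A⊂B

  upMins downMins : Subset n → List (Subset n) → List ℕ
  upMins   A Bs = map (λ (A , B) → min (B ─ A)) (steps A Bs)
  downMins B As = map (λ (B , A) → min (B ─ A)) (steps B As)

  up⁻ : ∀ {E} (A : Subset n) Bs → Up.Chain E A Bs →
        All (λ (A , B) → A ⊂ B) (steps A Bs) × last A Bs ≡ E × Linked _<_ (upMins A Bs)
  up⁻ A []       A≡E = [] , A≡E , []
  up⁻ A (B ∷ []) ((A⊂B , _) , B≡E) = A⊂B ∷ [] , B≡E , [-]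
  up⁻ {E = E} A (B ∷ C ∷ Bs) ((A⊂B , B⊆E , eq) , c@((B⊂C , C⊆E , eq′) , _)) =
    let (⊂s , last≡ , linked) = up⁻ B (C ∷ Bs) c in
    A⊂B ∷ ⊂s , last≡ ,
    -- By the local condition of the next step, its minimum is that of everything left, `E ─ B`.
    subst (min (B ─ A) <_) (sym eq′)
      (min≡⇒min< (⊂⇒Nonempty-─ A⊂B) (─-antitoneʳ E (proj₁ A⊂B)) (⊂⇒Nonempty-─ (⊂-⊆-trans B⊂C C⊆E))
        (λ x∈ x∈′ → proj₂ (x∈p─q⁻ E B x∈′) (p─q⊆p B A x∈)) eq)
    ∷ linked

  up⁺ : ∀ {E} (A : Subset n) Bs → All (λ (A , B) → A ⊂ B) (steps A Bs) → last A Bs ≡ E →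
        Linked _<_ (upMins A Bs) → Up.Chain E A Bs
  up⁺ A []       _           A≡E  _ = A≡E
  up⁺ A (B ∷ []) (A⊂B ∷ _)   refl _ = (A⊂B , (λ x∈ → x∈) , refl) , refl
  up⁺ {E = E} A (B ∷ C ∷ Bs) (A⊂B ∷ ⊂s) last≡ (min< ∷ linked)
    -- The tail has to be treated before the head: only its local condition `eq′` turns the
    -- comparison with the next minimum into one with the minimum of `E ─ B`.
    with c@((B⊂C , C⊆E , eq′) , _) ← up⁺ {E = E} B (C ∷ Bs) ⊂s last≡ linked =
    (A⊂B , B⊆E , min<⇒min≡ (─-monoˡ A B⊆E) (⊂⇒Nonempty-─ A⊂B) cover (subst (min (B ─ A) <_) eq′ min<)) , c
    where
    B⊆E : B ⊆ E
    B⊆E = up-⊆ (C ∷ Bs) c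

    cover : ∀ {x} → x ∈ E ─ A → x ∈ B ─ A ⊎ x ∈ E ─ B
    cover {x} x∈ with x∈p─q⁻ E A x∈ | x ∈? B
    ... | x∈E , x∉A | yes x∈B = inj₁ (x∈p∧x∉q⇒x∈p─q x∈B x∉A)
    ... | x∈E , x∉A | no  x∉B = inj₂ (x∈p∧x∉q⇒x∈p─q x∈E x∉B)

  down⁻ : ∀ (B : Subset n) As → Down.Chain B As →
          All (λ (B , A) → A ⊂ B) (steps B As) × last B As ≡ ⊥ × Linked _<_ (downMins B As)
  down⁻ B []       B≡⊥ = [] , B≡⊥ , []
  down⁻ B (A ∷ []) ((A⊂B , _) , A≡⊥) = A⊂B ∷ [] , A≡⊥ , [-]
  down⁻ B (A ∷ C ∷ As) ((A⊂B , eq) , c@((C⊂A , eq′) , _)) =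
    let (⊂s , last≡ , linked) = down⁻ A (C ∷ As) c
        (x , x∈ , _) = proj₂ C⊂A in
    A⊂B ∷ ⊂s , last≡ ,
    subst (min (B ─ A) <_) (sym eq′)
      (min≡⇒min< (⊂⇒Nonempty-─ A⊂B) (proj₁ A⊂B) (x , x∈) (λ y∈ → proj₂ (x∈p─q⁻ B A y∈)) eq)
    ∷ linked

  down⁺ : ∀ (B : Subset n) As → All (λ (B , A) → A ⊂ B) (steps B As) → last B As ≡ ⊥ →
          Linked _<_ (downMins B As) → Down.Chain B As
  down⁺ B []       _           B≡⊥  _ = B≡⊥
  down⁺ B (A ∷ []) (A⊂B ∷ _)   refl _ = (A⊂B , cong min (p─⊥≡p B)) , refl
  down⁺ B (A ∷ C ∷ As) (A⊂B ∷ ⊂s) last≡ (min< ∷ linked)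
    with c@((C⊂A , eq′) , _) ← down⁺ A (C ∷ As) ⊂s last≡ linked =
    (A⊂B , min<⇒min≡ (p─q⊆p B A) (⊂⇒Nonempty-─ A⊂B) (x∈p⇒x∈p─q⊎x∈q A) (subst (min (B ─ A) <_) eq′ min<)) , c

  filtration⇔chains : ∀ {E : Subset n} {F′ Fc F} →
    IsFiltration E (F′ , Fc , F) ⇔ (Down.Chain Fc F′ × Up.Chain E Fc F)
  filtration⇔chains {F′ = F′} {Fc} {F} = mk⇔
    (λ p → let open IsFiltration p in down⁺ Fc F′ down-⊂ down-last down-min , up⁺ Fc F up-⊂ up-last up-min)
    (λ (d , u) → let (a , b , c) = up⁻ Fc F u
                     (a′ , b′ , c′) = down⁻ Fc F′ d in record
      { up-⊂ = a ; up-last = b ; up-min = c ; down-⊂ = a′ ; down-last = b′ ; down-min = c′ })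

open Chains

-- Sums over filtrations

module FiltrationSums where

  open import Data.Bool.Base using (true; false; if_then_else_; _∧_)
  open import Data.Fin.Base using (zero; suc)
  open import Data.Fin.Subset hiding (_-_)
  open import Data.Fin.Subset.Properties
  open import Data.Integer.Base as ℤ using (ℤ; 0ℤ; 1ℤ; +_; _+_; _*_)
  import Data.Integer.Properties as ℤ
  open import Data.List.Base using (List; []; _∷_; _++_; [_]; map; concat; filter; length;
    cartesianProduct; cartesianProductWith)
  import Data.List.Properties as List
  open import Data.List.Relation.Unary.All using (All; []; _∷_)
  open import Data.Nat.Base as ℕ using (ℕ; zero; suc; _≤_; z≤n; s≤s)
  import Data.Nat.Properties as ℕ
  open import Data.Product.Base using (_×_; _,_; proj₁; proj₂)
  open import Data.Vec.Base using ([]; _∷_; here; there)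
  open import Function.Base using (_∘_)
  open import Function.Bundles using (_⇔_; Equivalence)
  open import Relation.Binary.PropositionalEquality as ≡ using (_≡_; _≢_; refl; cong; cong₂; subst)
  open import Relation.Nullary using (¬_; Dec; yes; no; does; contradiction)
  open import Relation.Nullary.Decidable using (_×-dec_)
  open import Relation.Unary using (Pred; Decidable)
  open import Level using (0ℓ)

  private
    variable
      n : ℕ
      S T : Set

  open Matroid
  open Σₚ using () renaming (Σ⟦_,_⟧ to Σₚ⟦_,_⟧)

  open import Relation.Binary.Reasoning.Setoid ℙ.setoid

  ∑-cong : ∀ (xs : List S) {f g : S → Poly} → (∀ x → f x ≋ g x) → ∑ xs f ≋ ∑ xs g
  ∑-cong []       h = ℙ.refl
  ∑-cong (x ∷ xs) h = ℙ.+-cong (h x) (∑-cong xs h)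

  ∑-map : ∀ (g : S → T) xs (f : T → Poly) → ∑ (map g xs) f ≡ ∑ xs (f ∘ g)
  ∑-map g xs f = cong concat (≡.sym (List.map-∘ xs))

  ∑-++ : ∀ (xs ys : List S) (f : S → Poly) → ∑ (xs ++ ys) f ≡ ∑ xs f ++ ∑ ys f
  ∑-++ xs ys f = ≡.trans (cong concat (List.map-++ f xs ys)) (≡.sym (List.concat-++ (map f xs) (map f ys)))

  ∑-cartesianProductWith : ∀ {U : Set} (g : S → T → U) xs ys (f : U → Poly) →
    ∑ (cartesianProductWith g xs ys) f ≡ ∑ xs (λ x → ∑ ys (λ y → f (g x y)))
  ∑-cartesianProductWith g []       ys f = refl
  ∑-cartesianProductWith g (x ∷ xs) ys f = ≡.trans (∑-++ (map (g x) ys) _ f)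
    (cong₂ _++_ (∑-map (g x) ys f) (∑-cartesianProductWith g xs ys f))

  ∑-0 : (xs : List S) → ∑ xs (λ _ → []) ≡ []
  ∑-0 []       = refl
  ∑-0 (x ∷ xs) = ∑-0 xs

  ∑-+ : ∀ (xs : List S) f g → ∑ xs (λ x → f x ++ g x) ≋ ∑ xs f ++ ∑ xs g
  ∑-+ []       f g = ℙ.refl
  ∑-+ (x ∷ xs) f g = ℙ.trans (ℙ.+-congˡ {f x ++ g x} (∑-+ xs f g)) (interchange (f x) (g x) _ _)
    where open import Algebra.Properties.CommutativeSemigroup ℙ.+-commutativeSemigroup using (interchange)

  ∑-swap : ∀ (xs : List S) (ys : List T) (f : S → T → Poly) →
           ∑ xs (λ x → ∑ ys (f x)) ≋ ∑ ys (λ y → ∑ xs (λ x → f x y))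
  ∑-swap []       ys f = ℙ.reflexive (≡.sym (∑-0 ys))
  ∑-swap (x ∷ xs) ys f = ℙ.trans (ℙ.+-congˡ {∑ ys (f x)} (∑-swap xs ys f)) (ℙ.sym (∑-+ ys (f x) _))

  ∑-*ˡ : ∀ (xs : List S) p f → ∑ xs (λ x → p ⊛ f x) ≋ p ⊛ ∑ xs f
  ∑-*ˡ []       p f = ℙ.sym (ℙ.zeroʳ p)
  ∑-*ˡ (x ∷ xs) p f = ℙ.trans (ℙ.+-congˡ {p ⊛ f x} (∑-*ˡ xs p f)) (ℙ.sym (ℙ.distribˡ p (f x) _))

  ∑-*ʳ : ∀ (xs : List S) p f → ∑ xs (λ x → f x ⊛ p) ≡ ∑ xs f ⊛ p
  ∑-*ʳ []       p f = refl
  ∑-*ʳ (x ∷ xs) p f = ≡.trans (cong (f x ⊛ p ++_) (∑-*ʳ xs p f)) (≡.sym (⊛-distribʳ p (f x) (∑ xs f)))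

  -- Filtering is replaced by zero terms in a sum over a fixed list, so that sums can be exchanged
  -- and factored.
  when : {A : Set} → Dec A → Poly → Poly
  when d p = if does d then p else []

  when-true : ∀ {A : Set} (d : Dec A) → A → ∀ {p} → when d p ≡ p
  when-true (yes _) a = refl
  when-true (no ¬a) a = contradiction a ¬a

  when-false : ∀ {A : Set} (d : Dec A) → ¬ A → ∀ {p} → when d p ≡ []
  when-false (yes a) ¬a = contradiction a ¬a
  when-false (no _)  ¬a = refl

  when-⇔ : ∀ {A B : Set} → A ⇔ B → (d : Dec A) (d′ : Dec B) → ∀ {p} → when d p ≡ when d′ p
  when-⇔ A⇔B (yes a) d′ = ≡.sym (when-true d′ (Equivalence.to A⇔B a))
  when-⇔ A⇔B (no ¬a) d′ = ≡.sym (when-false d′ (¬a ∘ Equivalence.from A⇔B))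

  when-×-⊛ : ∀ {A B : Set} (d : Dec A) (d′ : Dec B) p q → when (d ×-dec d′) (p ⊛ q) ≡ when d p ⊛ when d′ q
  when-×-⊛ d d′ p q with does d | does d′
  ... | true  | true  = refl
  ... | true  | false = ≡.sym (⊛-zeroʳ p)
  ... | false | _     = refl

  when-⊛ˡ : ∀ {A : Set} (d : Dec A) p q → when d p ⊛ q ≡ when d (p ⊛ q)
  when-⊛ˡ d p q with does d
  ... | true  = refl
  ... | false = refl

  ∑-filter : ∀ {P : Pred S 0ℓ} (P? : Decidable P) xs (f : S → Poly) →
             ∑ (filter P? xs) f ≡ ∑ xs (λ x → when (P? x) (f x))
  ∑-filter P? []       f = refl
  ∑-filter P? (x ∷ xs) f with does (P? x)
  ... | true  = cong (f x ++_) (∑-filter P? xs f)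
  ... | false = ∑-filter P? xs f

  module ChainSum {Step : Subset n → Subset n → Set} {End : Subset n → Set}
    (step? : ∀ A B → Dec (Step A B)) (end? : ∀ A → Dec (End A))
    (w : Subset n → Subset n → Poly) where

    open Chain Step End

    weight : Subset n → List (Subset n) → Poly
    weight A []       = const 1ℤ
    weight A (B ∷ Bs) = w A B ⊛ weight B Bs

    -- The bound `k` on the number of steps comes from the finite list `candidates`; it is also what
    -- the inductions below recurse on.
    chainSum : ℕ → Subset n → Poly
    chainSum k A = ∑ (listsUpTo k (subsets (⊤ {n}))) λ Bs → when (chain? step? end? A Bs) (weight A Bs)

    chainSum-zero : ∀ A → chainSum 0 A ≡ when (end? A) (const 1ℤ)
    chainSum-zero A = List.++-identityʳ _

    chainSum-suc : ∀ k A → chainSum (suc k) A ≋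
      when (end? A) (const 1ℤ) ++ Σₚ⟦ ⊥ , ⊤ {n} ⟧ (λ B → when (step? A B) (w A B ⊛ chainSum k B))
    chainSum-suc k A = ℙ.+-congˡ {when (end? A) (const 1ℤ)} (begin
      ∑ (cartesianProductWith _∷_ (subsets (⊤ {n})) chains) (λ Bs → when (chain? step? end? A Bs) (weight A Bs))
        ≡⟨ ∑-cartesianProductWith _∷_ (subsets (⊤ {n})) chains (λ Bs → when (chain? step? end? A Bs) (weight A Bs)) ⟩
      ∑ (subsets (⊤ {n})) (λ B → ∑ chains (λ Bs →
        when (step? A B ×-dec chain? step? end? B Bs) (w A B ⊛ weight B Bs)))
        ≈⟨ ∑-cong (subsets (⊤ {n})) step ⟩
      ∑ (subsets (⊤ {n})) (λ B → when (step? A B) (w A B ⊛ chainSum k B))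
        ≡⟨ ∑-subsets (⊤ {n}) _ ⟩
      _ ∎)
      where
      chains = listsUpTo k (subsets (⊤ {n}))

      step : ∀ B → ∑ chains (λ Bs → when (step? A B ×-dec chain? step? end? B Bs) (w A B ⊛ weight B Bs)) ≋
             when (step? A B) (w A B ⊛ chainSum k B)
      step B = begin
        ∑ chains (λ Bs → when (step? A B ×-dec chain? step? end? B Bs) (w A B ⊛ weight B Bs))
          ≈⟨ ∑-cong chains (λ Bs → ℙ.reflexive (when-×-⊛ (step? A B) (chain? step? end? B Bs) (w A B) (weight B Bs))) ⟩
        ∑ chains (λ Bs → when (step? A B) (w A B) ⊛ when (chain? step? end? B Bs) (weight B Bs))
          ≈⟨ ∑-*ˡ chains (when (step? A B) (w A B)) _ ⟩
        when (step? A B) (w A B) ⊛ chainSum k B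
          ≡⟨ when-⊛ˡ (step? A B) (w A B) (chainSum k B) ⟩
        when (step? A B) (w A B ⊛ chainSum k B) ∎

    chainSum-end : ∀ k A → End A → (∀ B → ¬ Step A B) → chainSum k A ≋ const 1ℤ
    chainSum-end zero    A end ¬step = ℙ.reflexive (≡.trans (chainSum-zero A) (when-true (end? A) end))
    chainSum-end (suc k) A end ¬step = begin
      chainSum (suc k) A
        ≈⟨ chainSum-suc k A ⟩
      when (end? A) (const 1ℤ) ++ Σₚ⟦ ⊥ , ⊤ {n} ⟧ (λ B → when (step? A B) (w A B ⊛ chainSum k B))
        ≈⟨ ℙ.+-cong (ℙ.reflexive (when-true (end? A) end))
             (Σₚ.Σ-cong′ ⊥ ⊤ λ B → ℙ.reflexive (when-false (step? A B) (¬step B))) ⟩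
      const 1ℤ ++ Σₚ⟦ ⊥ , ⊤ {n} ⟧ (λ _ → [])
        ≈⟨ ℙ.+-congˡ {const 1ℤ} (Σₚ.Σ⊥⊤-0 {n}) ⟩
      const 1ℤ ++ [] ∎

    -- The possible next members of a filtration form an interval, because the local condition only
    -- fixes whether one particular element belongs to them.
    chainSum-step : ∀ k A → ¬ End A → ∀ L U (f : Subset n → Poly) →
      (∀ B → L ⊆ B → B ⊆ U → Step A B) → (∀ B → Step A B → L ⊆ B × B ⊆ U) →
      (∀ B → Step A B → chainSum k B ≋ f B) →
      chainSum (suc k) A ≋ Σₚ⟦ L , U ⟧ (λ B → w A B ⊛ f B)
    chainSum-step k A ¬end L U f step⁺ step⁻ h = begin
      chainSum (suc k) A
        ≈⟨ chainSum-suc k A ⟩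
      when (end? A) (const 1ℤ) ++ Σₚ⟦ ⊥ , ⊤ {n} ⟧ (λ B → when (step? A B) (w A B ⊛ chainSum k B))
        ≡⟨ cong (_++ Σₚ⟦ ⊥ , ⊤ {n} ⟧ (λ B → when (step? A B) (w A B ⊛ chainSum k B))) (when-false (end? A) ¬end) ⟩
      Σₚ⟦ ⊥ , ⊤ {n} ⟧ (λ B → when (step? A B) (w A B ⊛ chainSum k B))
        ≈⟨ Σₚ.Σ-restrict L U
             (λ B L⊆B B⊆U → let s = step⁺ B L⊆B B⊆U in
               ℙ.trans (ℙ.reflexive (when-true (step? A B) s)) (ℙ.*-congˡ {w A B} (h B s)))
             (λ B ∉ → ℙ.reflexive (when-false (step? A B) (∉ ∘ step⁻ B))) ⟩
      Σₚ⟦ L , U ⟧ (λ B → w A B ⊛ f B) ∎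

  module Filtrations (M : Matroid n) where
    open Recursions M using (P; Q; P-recursion; Q-recursion; P-E; Q-⊥; tutte-convolution)

    upWeight downWeight : Subset n → Subset n → Poly
    upWeight   A B = const (β (M ↾ B / A)) ⊛ X
    downWeight B A = const (β* (M ↾ B / A)) ⊛ Y

    module UpSum = ChainSum (upStep? (E M)) (_≟ˢ E M) upWeight
    module DownSum = ChainSum downStep? (_≟ˢ ⊥) downWeight

    -- Every step adds an element, so under this bound lists of length up to `k` contain all chains
    -- from A to the ground set, and the truncation loses nothing.
    upSum≋P : ∀ k A → A ⊆ E M → ∣ E M ∣ ≤ k ℕ.+ ∣ A ∣ → UpSum.chainSum k A ≋ P A
    upSum≋P k A A⊆E bound with A ≟ˢ E M
    upSum≋P k A A⊆E bound | yes refl = ℙ.trans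
      (UpSum.chainSum-end k A refl λ B ((_ , x , x∈B , x∉A) , B⊆E , _) → x∉A (B⊆E x∈B)) (ℙ.sym P-E)
    upSum≋P zero A A⊆E bound | no A≢E = contradiction bound (ℕ.<⇒≱ (p⊂q⇒∣p∣<∣q∣ (⊆∧≢⇒⊂ A⊆E A≢E)))
    upSum≋P (suc k) A A⊆E bound | no A≢E
      -- With this `e`, a set B between A and the ground set satisfies the condition on minima
      -- exactly if it contains `e`.
      with e , e∈E─A , eq ← argmin (⊂⇒Nonempty-─ (⊆∧≢⇒⊂ A⊆E A≢E))
      with e∈E , e∉A ← x∈p─q⁻ (E M) A e∈E─A = begin
      UpSum.chainSum (suc k) A
        ≈⟨ UpSum.chainSum-step k A A≢E (A [+ e ]) (E M) P
             (λ B A+e⊆B B⊆E → let e∈B = A+e⊆B (∈-[+] {A = A} e) in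
               (A+e⊆B ∘ ⊆-[+] e , e , e∈B , e∉A) , B⊆E ,
               min∈⇒min≡ (─-monoˡ A B⊆E) eq (x∈p∧x∉q⇒x∈p─q e∈B e∉A))
             (λ B (A⊂B , B⊆E , min≡) →
               [+]-lub (proj₁ A⊂B) (p─q⊆p B A (min≡⇒min∈ eq (⊂⇒Nonempty-─ A⊂B) min≡)) , B⊆E)
             (λ B (A⊂B , B⊆E , _) → upSum≋P k B B⊆E
               (ℕ.≤-trans (subst (∣ E M ∣ ≤_) (≡.sym (ℕ.+-suc k ∣ A ∣)) bound) (ℕ.+-monoʳ-≤ k (p⊂q⇒∣p∣<∣q∣ A⊂B)))) ⟩
      Σₚ⟦ A [+ e ] , E M ⟧ (λ B → upWeight A B ⊛ P B)
        ≈⟨ P-recursion A⊆E e∉A e∈E ⟨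
      P A ∎

    downSum≋Q : ∀ k B → B ⊆ E M → ∣ B ∣ ≤ k → DownSum.chainSum k B ≋ Q B
    downSum≋Q k B B⊆E bound with B ≟ˢ ⊥
    downSum≋Q k B B⊆E bound | yes refl = ℙ.trans
      (DownSum.chainSum-end k B refl λ A ((_ , x , x∈⊥ , _) , _) → ∉⊥ x∈⊥) (ℙ.sym Q-⊥)
    downSum≋Q zero B B⊆E bound | no B≢⊥ =
      contradiction (ℕ.≤-trans (s≤s z≤n) (p⊂q⇒∣p∣<∣q∣ (⊆∧≢⇒⊂ ⊥⊆ (B≢⊥ ∘ ≡.sym)))) (ℕ.<⇒≱ (s≤s bound))
    downSum≋Q (suc k) B B⊆E bound | no B≢⊥
      with e , e∈B , eq ← argmin (Nonempty-≢⊥ B≢⊥) = begin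
      DownSum.chainSum (suc k) B
        ≈⟨ DownSum.chainSum-step k B B≢⊥ ⊥ (B [- e ]) Q
             (λ A _ A⊆B-e → let e∉A = ∉-[-] B e ∘ A⊆B-e in
               ([-]-⊆ e ∘ A⊆B-e , e , e∈B , e∉A) ,
               min∈⇒min≡ (p─q⊆p B A) eq (x∈p∧x∉q⇒x∈p─q e∈B e∉A))
             (λ A (A⊂B , min≡) → ⊥⊆ ,
               λ {x} x∈A → [-]-glb (proj₁ A⊂B) (proj₂ (x∈p─q⁻ B A (min≡⇒min∈ eq (⊂⇒Nonempty-─ A⊂B) min≡))) x∈A)
             (λ A (A⊂B , _) → downSum≋Q k A (B⊆E ∘ proj₁ A⊂B)
               (ℕ.≤-pred (ℕ.≤-trans (p⊂q⇒∣p∣<∣q∣ A⊂B) bound))) ⟩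
      Σₚ⟦ ⊥ , B [- e ] ⟧ (λ A → downWeight B A ⊛ Q A)
        ≈⟨ Q-recursion B⊆E e∈B ⟨
      Q B ∎
      where
      [-]-glb : ∀ {m} {A B : Subset m} {e} → A ⊆ B → e ∉ A → A ⊆ B [- e ]
      [-]-glb {B = b ∷ B} {zero}  A⊆B e∉A here = contradiction here e∉A
      [-]-glb {B = b ∷ B} {suc e} A⊆B e∉A here with here ← A⊆B here = here
      [-]-glb {A = a ∷ A} {b ∷ B} {zero}  A⊆B e∉A (there h) with there h′ ← A⊆B (there h) = there h′
      [-]-glb {A = a ∷ A} {b ∷ B} {suc e} A⊆B e∉A (there h) = there ([-]-glb (drop-∷-⊆ A⊆B) (e∉A ∘ there) h)

    -- In `candidates` the middle member runs through all subsets of `Fin n`; this discards those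
    -- that leave the ground set.
    upSum≋[] : ∀ k A → ¬ A ⊆ E M → UpSum.chainSum k A ≋ []
    upSum≋[] k A A⊈E = ℙ.trans
      (∑-cong chains λ Bs → ℙ.reflexive (when-false (Up.chain? (E M) (upStep? (E M)) (_≟ˢ E M) A Bs)
        λ c → A⊈E (up-⊆ Bs c)))
      (ℙ.reflexive (∑-0 chains))
      where chains = listsUpTo k (subsets (⊤ {n}))

    upWeights : ∀ A Bs → UpSum.weight A Bs ≡ [ ∏ (steps A Bs) (λ (A , B) → β (M ↾ B / A)) , length Bs , 0 ]
    upWeights A []       = refl
    upWeights A (B ∷ Bs) rewrite upWeights B Bs | ℤ.*-identityʳ (β (M ↾ B / A)) = refl

    downWeights : ∀ B As → DownSum.weight B As ≡ [ ∏ (steps B As) (λ (B , A) → β* (M ↾ B / A)) , 0 , length As ]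
    downWeights B []       = refl
    downWeights B (A ∷ As) rewrite downWeights A As | ℤ.*-identityʳ (β* (M ↾ B / A)) = refl

    term-weights : ∀ F′ Fc F → term M (F′ , Fc , F) ≡ DownSum.weight Fc F′ ⊛ UpSum.weight Fc F
    term-weights F′ Fc F rewrite upWeights Fc F | downWeights Fc F′ =
      cong₂ (λ c k → [ c , length F , k ])
        (ℤ.*-comm (∏ (steps Fc F) (λ (A , B) → β (M ↾ B / A))) _) (≡.sym (ℕ.+-identityʳ (length F′)))

    tutte-filtrations : tutte M ≋ ∑ (filtrations (E M)) (term M)
    tutte-filtrations = begin
      tutte M
        ≈⟨ tutte-convolution ⟩
      Σₚ⟦ ⊥ , E M ⟧ (λ F → Q F ⊛ P F)
        ≈⟨ Σₚ.Σ-restrict ⊥ (E M)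
             (λ F _ F⊆E → ℙ.*-cong (downSum≋Q n F F⊆E (∣p∣≤n F))
               (upSum≋P n F F⊆E (ℕ.≤-trans (∣p∣≤n (E M)) (ℕ.m≤m+n n ∣ F ∣))))
             (λ F ∉ → ℙ.trans (ℙ.*-congˡ {down F} (upSum≋[] n F λ F⊆E → ∉ (⊥⊆ , F⊆E))) (ℙ.zeroʳ (down F))) ⟨
      Σₚ⟦ ⊥ , ⊤ {n} ⟧ (λ F → down F ⊛ up F)
        ≡⟨ ∑-subsets (⊤ {n}) _ ⟨
      ∑ (subsets (⊤ {n})) (λ F → down F ⊛ up F)
        ≈⟨ ∑-cong (subsets (⊤ {n})) (λ Fc → ℙ.reflexive (≡.sym (∑-*ʳ chains (up Fc) _))) ⟩
      ∑ (subsets (⊤ {n})) (λ Fc → ∑ chains (λ F′ → down₁ F′ Fc ⊛ up Fc))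
        -- `candidates` lists the descending part before the middle member, whereas the convolution
        -- sums over the middle member first.
        ≈⟨ ∑-swap (subsets (⊤ {n})) chains (λ Fc F′ → down₁ F′ Fc ⊛ up Fc) ⟩
      ∑ chains (λ F′ → ∑ (subsets (⊤ {n})) (λ Fc → down₁ F′ Fc ⊛ up Fc))
        ≈⟨ ∑-cong chains (λ F′ → ∑-cong (subsets (⊤ {n})) λ Fc → ∑-*ˡ chains (down₁ F′ Fc) _) ⟨
      ∑ chains (λ F′ → ∑ (subsets (⊤ {n})) (λ Fc → ∑ chains (λ F → down₁ F′ Fc ⊛ up₁ Fc F)))
        ≈⟨ ∑-cong chains (λ F′ → ∑-cong (subsets (⊤ {n})) λ Fc → ∑-cong chains λ F → ℙ.reflexive (summand F′ Fc F)) ⟨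
      ∑ chains (λ F′ → ∑ (subsets (⊤ {n})) (λ Fc → ∑ chains (λ F → f (F′ , Fc , F))))
        ≈⟨ ∑-cong chains (λ F′ → ℙ.reflexive (∑-cartesianProductWith _,_ (subsets (⊤ {n})) chains (λ F → f (F′ , F)))) ⟨
      ∑ chains (λ F′ → ∑ (cartesianProduct (subsets (⊤ {n})) chains) (λ F → f (F′ , F)))
        ≡⟨ ∑-cartesianProductWith _,_ chains (cartesianProduct (subsets (⊤ {n})) chains) f ⟨
      ∑ (candidates n) f
        ≡⟨ ∑-filter (isFiltration? (E M)) (candidates n) (term M) ⟨
      ∑ (filtrations (E M)) (term M) ∎
      where
      chains = listsUpTo n (subsets (⊤ {n}))

      f : Seq n → Poly
      f F = when (isFiltration? (E M) F) (term M F)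

      up down : Subset n → Poly
      up   = UpSum.chainSum n
      down = DownSum.chainSum n

      up? : ∀ A Bs → Dec (Up.Chain (E M) A Bs)
      up? = Up.chain? (E M) (upStep? (E M)) (_≟ˢ E M)

      down? : ∀ B As → Dec (Down.Chain B As)
      down? = Down.chain? downStep? (_≟ˢ ⊥)

      up₁ : Subset n → List (Subset n) → Poly
      up₁ Fc F = when (up? Fc F) (UpSum.weight Fc F)

      down₁ : List (Subset n) → Subset n → Poly
      down₁ F′ Fc = when (down? Fc F′) (DownSum.weight Fc F′)

      summand : ∀ F′ Fc F → f (F′ , Fc , F) ≡ down₁ F′ Fc ⊛ up₁ Fc F
      summand F′ Fc F = ≡.trans
        (when-⇔ filtration⇔chains (isFiltration? (E M) (F′ , Fc , F)) (down? Fc F′ ×-dec up? Fc F))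
        (≡.trans (cong (when (down? Fc F′ ×-dec up? Fc F)) (term-weights F′ Fc F))
          (when-×-⊛ (down? Fc F′) (up? Fc F) _ _))

    ∏≢0⇒All≢0 : ∀ {S : Set} (xs : List S) (f : S → ℤ) → ∏ xs f ≢ 0ℤ → All (λ x → f x ≢ 0ℤ) xs
    ∏≢0⇒All≢0 []       f ∏≢0 = []
    ∏≢0⇒All≢0 (x ∷ xs) f ∏≢0 =
      (λ fx≡0 → ∏≢0 (cong (_* ∏ xs f) fx≡0)) ∷
      ∏≢0⇒All≢0 xs f (λ ∏≡0 → ∏≢0 (≡.trans (cong (f x *_) ∏≡0) (ℤ.*-zeroʳ (f x))))

    up-connected : ∀ A Bs → Up.Chain (E M) A Bs → All (λ (A , B) → β (M ↾ B / A) ≢ 0ℤ) (steps A Bs) →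
      All (λ (A , B) → Connected (M ↾ B / A) × ¬ IsLoop (M ↾ B / A)) (steps A Bs)
    up-connected A []       _ _ = []
    up-connected A (B ∷ Bs) ((A⊂B , B⊆E , _) , c) (β≢0 ∷ βs) =
      Vanishing.β≢0⇒connected (M ↾ B / A) (Minor.nonempty-minor M A⊂B B⊆E) β≢0 ∷ up-connected B Bs c βs

    down-connected : ∀ B As → B ⊆ E M → Down.Chain B As → All (λ (B , A) → β* (M ↾ B / A) ≢ 0ℤ) (steps B As) →
      All (λ (B , A) → Connected (M ↾ B / A) × ¬ IsIsthmus (M ↾ B / A)) (steps B As)
    down-connected B []       _ _ _ = []
    down-connected B (A ∷ As) B⊆E ((A⊂B , _) , c) (β≢0 ∷ βs) =
      Vanishing.β*≢0⇒connected (M ↾ B / A) (Minor.nonempty-minor M A⊂B B⊆E) β≢0 ∷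
      down-connected A As (B⊆E ∘ proj₁ A⊂B) c βs

    coefficient : Seq n → ℤ
    coefficient (F′ , Fc , F) =
      ∏ (steps Fc F) (λ (A , B) → β (M ↾ B / A)) * ∏ (steps Fc F′) (λ (B , A) → β* (M ↾ B / A))

    -- The contrapositive form spares a search for the offending minor: a nonzero product has only
    -- nonzero factors, and each of them certifies its own minor.
    filtration-connected : ∀ F → IsFiltration (E M) F → coefficient F ≢ 0ℤ → IsConnectedFiltration M F
    filtration-connected (F′ , Fc , F) isF c≢0 = record
      { isFiltration = isF
      ; up-conn      = up-connected Fc F up (∏≢0⇒All≢0 (steps Fc F) _ λ ∏≡0 →
          c≢0 (cong (_* ∏ (steps Fc F′) (λ (B , A) → β* (M ↾ B / A))) ∏≡0))
      ; down-conn    = down-connected Fc F′ (up-⊆ F up) down (∏≢0⇒All≢0 (steps Fc F′) _ λ ∏≡0 →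
          c≢0 (≡.trans (cong (∏ (steps Fc F) (λ (A , B) → β (M ↾ B / A)) *_) ∏≡0) (ℤ.*-zeroʳ (∏ (steps Fc F) (λ (A , B) → β (M ↾ B / A))))))
      }
      where
      down = proj₁ (Equivalence.to filtration⇔chains isF)
      up   = proj₂ (Equivalence.to filtration⇔chains isF)

    -- A term with coefficient 0 is still a nonempty list, so it vanishes only up to `≋`.
    zero-monomial : ∀ {c} i j → c ≡ 0ℤ → [ c , i , j ] ≋ []
    zero-monomial i j refl ._≋_.at a b with (i ℕ.≡ᵇ a) ∧ (j ℕ.≡ᵇ b)
    ... | true  = refl
    ... | false = refl

    -- Both lists are filtered from `candidates`, so the sums can be compared term by term.
    connected-filtrations : ∑ (connectedFiltrations M) (term M) ≋ ∑ (filtrations (E M)) (term M)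
    connected-filtrations = begin
      ∑ (connectedFiltrations M) (term M)
        ≡⟨ ∑-filter (isConnectedFiltration? M) (candidates n) (term M) ⟩
      ∑ (candidates n) (λ F → when (isConnectedFiltration? M F) (term M F))
        ≈⟨ ∑-cong (candidates n) (λ F → summand F (isConnectedFiltration? M F) (isFiltration? (E M) F)) ⟩
      ∑ (candidates n) (λ F → when (isFiltration? (E M) F) (term M F))
        ≡⟨ ∑-filter (isFiltration? (E M)) (candidates n) (term M) ⟨
      ∑ (filtrations (E M)) (term M) ∎
      where
      summand : ∀ F (d : Dec (IsConnectedFiltration M F)) (d′ : Dec (IsFiltration (E M) F)) →
                when d (term M F) ≋ when d′ (term M F)
      summand F (yes c) d′ =
        ℙ.reflexive (≡.sym (when-true d′ (IsConnectedFiltration.isFiltration c)))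
      summand F (no ¬c) (no _) = ℙ.refl
      summand F@(F′ , Fc , G) (no ¬c) (yes isF) with coefficient F ℤ.≟ 0ℤ
      ... | yes c≡0 = ℙ.sym (zero-monomial (length G) (length F′) c≡0)
      ... | no  c≢0 = contradiction (filtration-connected F isF c≢0) ¬c

open FiltrationSums

theorem3p5 : ∀ {n : ℕ} (M : Matroid n) →
    (tutte M ≈ ∑ (connectedFiltrations M) (term M)) ×
    (tutte M ≈ ∑ (filtrations (Matroid.E M)) (term M))
theorem3p5 M =
  _≋_.at (ℙ.trans tutte-filtrations (ℙ.sym connected-filtrations)) , _≋_.at tutte-filtrations
  where open Filtrations M
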